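{- Let $\mathcal{M}(n)$ denote the maximum number of edges of an edge-magic graph with $n$ vertices. Then there is a constant $C>0$ such that $\mathcal{M}(n)\ge \frac27 n^2 - Cn$ for all $n\ge 1$, and $$\mathcal{M}(n)\le \left(\frac12-\frac{2}{(2+(1+2\sqrt2)\pi)^2}+o(1)\right)n^2 \qquad (n\to\infty),$$ where $\frac12-\frac{2}{(2+(1+2\sqrt2)\pi)^2}=0.489\ldots$.
   Context: Write $[k]=\{1,\dots,k\}$. All graphs are finite and simple, with $V(G)\cap E(G)=\emptyset$. For a graph $G$ with $n$ vertices and $m$ edges, an edge-magic labelling is a bijection $l:V(G)\cup E(G)\to[n+m]$ for which there is a constant $s$ (the magic sum) such that $l(a)+l(b)+l(ab)=s$ for every edge $ab\in E(G)$. $G$ is edge-magic if it admits an edge-magic labelling. -}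

module Defs where

open import Data.Nat as ℕ using (ℕ; zero; suc)
open import Data.Integer using (+_)
open import Data.Fin as Fin using (Fin; toℕ; _↑ˡ_; _↑ʳ_)
open import Data.Product using (_×_; _,_; proj₁; proj₂; ∃; Σ)
open import Data.List using (List; length; lookup)
open import Data.List.Relation.Unary.All using (All)
open import Data.List.Relation.Unary.Unique.Propositional using (Unique)
open import Data.Rational using (ℚ; 0ℚ; 1ℚ; ½; _+_; _*_; -_; _-_; _/_; _<_; _≤_)
open import Function.Definitions using (Bijective)
open import Relation.Binary.PropositionalEquality using (_≡_)

record Graph (n : ℕ) : Set where
  field
    edges   : List (Fin n × Fin n)
    ordered : All (λ e → proj₁ e Fin.< proj₂ e) edges
    unique  : Unique edges

open Graph public

numEdges : ∀ {n} → Graph n → ℕ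
numEdges G = length (edges G)

-- V(G) ∪ E(G) is identified with Fin (n + m): vertex v ↦ v ↑ˡ m,
-- the k-th edge ↦ n ↑ʳ k.  A labelling is a bijection
-- l : Fin (n + m) → Fin (n + m); the label of x is 1 + toℕ (l x) ∈ [n+m].
record EdgeMagicLabelling {n : ℕ} (G : Graph n) : Set where
  field
    l         : Fin (n ℕ.+ numEdges G) → Fin (n ℕ.+ numEdges G)
    bijective : Bijective _≡_ _≡_ l
    s         : ℕ
    magic     : ∀ (k : Fin (numEdges G)) →
      let e = lookup (edges G) k
          lab : Fin (n ℕ.+ numEdges G) → ℕ
          lab x = suc (toℕ (l x))
      in lab (proj₁ e ↑ˡ numEdges G) ℕ.+ lab (proj₂ e ↑ˡ numEdges G)
           ℕ.+ lab (n ↑ʳ k) ≡ s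

EdgeMagic : ∀ {n} → Graph n → Set
EdgeMagic G = EdgeMagicLabelling G

ℕtoℚ : ℕ → ℚ
ℕtoℚ k = + k / 1

-- Leibniz partial sums  L k = Σ_{i<k} (-1)^i · 4/(2i+1),  which converge to π;
-- the odd-indexed ones L (2j+1) decrease strictly to π.
sgn : ℕ → ℚ
sgn zero = 1ℚ
sgn (suc k) = - sgn k

leibniz : ℕ → ℚ
leibniz zero = 0ℚ
leibniz (suc k) = leibniz k + sgn k * (+ 4 / suc (2 ℕ.* k))

PiUpper : ℚ → Set
PiUpper A = ∃ λ j → leibniz (suc (2 ℕ.* j)) < A

Sqrt2Upper : ℚ → Set
Sqrt2Upper B = (0ℚ ≤ B) × (ℕtoℚ 2 < B * B)

-- c < q, where c = 1/2 - 2/(2+(1+2√2)π)^2.  By monotonicity and continuity of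
-- c in (√2, π) this holds iff there are rational upper bounds A > π, B > √2
-- with 1/2 - 2/X^2 < q, X = 2+(1+2B)A, i.e. (1/2 - q)·X^2 < 2.
ConstBelow : ℚ → Set
ConstBelow q = ∃ λ A → ∃ λ B → PiUpper A × Sqrt2Upper B ×
  let X = ℕtoℚ 2 + (1ℚ + ℕtoℚ 2 * B) * A in
  (½ - q) * (X * X) < ℕtoℚ 2

{-# OPTIONS --safe #-}

-- Upper bound.  Let N = n + m, let a_v be the vertex labels and f(j) = Σ_v e(j a_v / N).
-- The ends of an edge labelled x have a_u + a_v = s − x, and the edge labels are all of [N]
-- except n values, so in f(j)² = Σ_{u,v} e(j (a_u + a_v) / N) the adjacent pairs contribute
-- O(n).  Hence |f(j)| ≤ δ n with δ² ≈ 1 − 2m/n².  Two labels that both lie below (s − N)/2,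
-- or both above s/2, never belong to adjacent vertices, so at most √2 δ n labels lie outside
-- the half period where a suitably shifted sine is nonnegative, and Σ_v |sin| ≤ (1 + 2√2) δ n.
-- On the other hand |sin| = √(1 − cos²) = 1 − Σ_j b_j cos²ʲ with b_j ≥ 0, and the powers of
-- cos² have nonnegative Fourier coefficients, so Σ_v |sin| ≥ (2/π) (1 − δ) n.
--
-- To stay rational, e(·) is replaced by the powers of a rational point z of the unit circle
-- near 1, with labels grouped into blocks so that a quarter turn is a fixed number of steps.
-- The mean 2/π of |sin| then appears as a Wallis product, which is compared with Leibniz's
-- series through the Wilf–Zeilberger proof of Kummer's theorem.
--
-- Lower bound.  Labels from Mrose's additive 2-basis, whose pairwise sums cover an interval.
module Submission where

open import Defs
open import Algebra.Bundles using (CommutativeRing)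
open import Data.Bool using (if_then_else_)
open import Data.Fin as Fin using (Fin; toℕ; fromℕ<; _↑ˡ_; _↑ʳ_)
import Data.Fin.Properties as FinP
import Data.Integer as ℤ
open import Data.Integer using (+_)
import Data.Integer.Properties as ℤP
open import Data.List as List using (List; []; _∷_; length; lookup)
open import Data.List.Membership.Propositional using (_∈_; _∉_)
open import Data.List.Membership.Propositional.Properties
  using (∈-++⁺ˡ; ∈-++⁺ʳ; ∈-applyUpTo⁺; ∈-upTo⁺; ∈-upTo⁻; ∈-filter⁺; ∈-filter⁻; ∈-lookup; ∈-map⁻)
import Data.List.Properties as ListP
open import Data.List.Relation.Binary.Pointwise as Pointwise using (Pointwise; []; _∷_)
open import Data.List.Relation.Unary.All as All using (All; []; _∷_)
import Data.List.Relation.Unary.All.Properties as AllP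
open import Data.List.Relation.Unary.AllPairs as AllPairs using (AllPairs; []; _∷_)
import Data.List.Relation.Unary.AllPairs.Properties as AllPairsP
import Data.List.Relation.Unary.Any as Any
open import Data.List.Relation.Unary.Any.Properties using (lookup-index)
open import Data.List.Relation.Unary.Unique.Propositional using (Unique)
import Data.List.Relation.Unary.Unique.Propositional.Properties as UniqueP
open import Data.Nat as ℕ using (ℕ; zero; suc)
open import Data.List.Membership.DecPropositional ℕ._≟_ using (_∈?_; _∉?_)
open import Data.Nat.Divisibility using (divides-refl)
import Data.Nat.DivMod as ℕD
import Data.Nat.Properties as ℕP
import Data.Nat.Tactic.RingSolver as ℕSolver
open import Data.Product using (_×_; _,_; proj₁; proj₂; ∃; ∃₂; swap; uncurry)
import Data.Rational as ℚ
open import Data.Rational using (ℚ; 0ℚ; 1ℚ; ½; _+_; _*_; -_; _-_; _/_; _<_; _≤_)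
open import Data.Rational.Properties as ℚP using
  ( <⇒≤; ≤-trans; ≤-reflexive; ≤-refl; <-≤-trans; ≤-<-trans; positive⁻¹; nonNegative⁻¹; *-zeroʳ; *-identityʳ
  ; *-identityˡ; +-identityˡ; +-identityʳ; +-mono-≤; ≰⇒>; ≮⇒≥; +-monoʳ-≤; +-monoˡ-≤; <-irrefl; neg-antimono-≤; module ≤-Reasoning )
import Data.Rational.Unnormalised as ℚᵘ
import Data.Rational.Unnormalised.Properties as ℚᵘP
open import Algebra.Properties.Semiring.Sum (CommutativeRing.semiring ℚP.+-*-commutativeRing)
  using (sum; sum-cong-≗; ∑-distrib-+; *-distribˡ-sum; sum-permute)
open import Data.Sum using (_⊎_; inj₁; inj₂; [_,_]′)
open import Function using (_∘_)
open import Function.Bundles using (mk⤖)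
open import Function.Definitions using (Bijective)
open import Function.Properties.Bijection using (Bijection⇒Inverse)
open import Level using (0ℓ)
open import Relation.Binary.Definitions using (tri<; tri≈; tri>)
open import Relation.Binary.PropositionalEquality hiding (J)
open import Relation.Nullary using (¬_; Dec; does; yes; no; contradiction)
open import Relation.Nullary.Decidable.Core using (dec⇒maybe; decidable-stable)
open import Tactic.RingSolver using (solve-∀)
open import Tactic.RingSolver.Core.AlmostCommutativeRing using (AlmostCommutativeRing; fromCommutativeRing)

-- Ordered-field arithmetic in ℚ

-- The constant comes from the two bounds on the sum of |sin|: (2/π)(1 - δ) ≤ (1 + 2√2) δ forces δ ≥
-- 2/X with X = 2 + (1 + 2√2) π, and δ² ≈ 1 - 2m/n² turns this into m ≤ (1/2 - 2/X² + o(1)) n². In 1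
-- + 2√2 the 1 is the first exponential sum, and the 2 appears because reflecting a negative sine
-- costs twice its size. The obstacle is the absence of e(1/N) from ℚ: a full turn of 4Q steps of z
-- need not end at 1. It misses 1 by at most a bounded multiple of |z - 1|, which is also the order
-- of the denominator of the geometric sum. So a sum over a full turn is O(j) instead of 0, and
-- blocks of w ≈ N/(4Q) labels make it O(jεn²), negligible once ε is small. As π enters only through
-- rational upper bounds, every series is truncated and its error carried along. For the lower
-- bound, each label x outside the basis receives one edge, joining two basis elements of sum S - x.
-- About 7t vertices serve 14t² = (2/7)(7t)² labels.

ℚ-ring : AlmostCommutativeRing 0ℓ 0ℓ
ℚ-ring = fromCommutativeRing ℚP.+-*-commutativeRing (λ x → dec⇒maybe (0ℚ ℚP.≟ x))

2ℚ 4ℚ ¼ : ℚ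
2ℚ = + 2 / 1
4ℚ = + 4 / 1
¼ = + 1 / 4

0≤1 : 0ℚ ≤ 1ℚ
0≤1 = nonNegative⁻¹ 1ℚ

0<1 : 0ℚ < 1ℚ
0<1 = positive⁻¹ 1ℚ

0≤2 : 0ℚ ≤ 2ℚ
0≤2 = nonNegative⁻¹ 2ℚ

0≤4 : 0ℚ ≤ 4ℚ
0≤4 = nonNegative⁻¹ 4ℚ

0≤½ : 0ℚ ≤ ½
0≤½ = nonNegative⁻¹ ½

0≤¼ : 0ℚ ≤ ¼
0≤¼ = nonNegative⁻¹ ¼

a≡b+[a-b] : ∀ a b → a ≡ b + (a - b)
a≡b+[a-b] = solve-∀ ℚ-ring

≤⇒0≤- : ∀ {a b} → a ≤ b → 0ℚ ≤ b - a
≤⇒0≤- {a} {b} a≤b = subst (_≤ b - a) (ℚP.+-inverseʳ a) (+-monoˡ-≤ (- a) a≤b)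

<⇒0<- : ∀ {a b} → a < b → 0ℚ < b - a
<⇒0<- {a} {b} a<b = subst (_< b - a) (ℚP.+-inverseʳ a) (ℚP.+-monoˡ-< (- a) a<b)

-- The standard form of an inequality below: the difference is exhibited as an expression whose
-- nonnegativity is visible, and the equation is left to the ring solver.
≤-by : ∀ {a b} e → b ≡ a + e → 0ℚ ≤ e → a ≤ b
≤-by {a} e eq 0≤e =
  subst₂ _≤_ (+-identityʳ a) (sym eq) (+-monoʳ-≤ a 0≤e)

<-by : ∀ {a b} e → b ≡ a + e → 0ℚ < e → a < b
<-by {a} e eq 0<e =
  subst₂ _<_ (+-identityʳ a) (sym eq) (ℚP.+-monoʳ-< a 0<e)

+-nonNeg : ∀ {a b} → 0ℚ ≤ a → 0ℚ ≤ b → 0ℚ ≤ a + b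
+-nonNeg = +-mono-≤

*-nonNeg : ∀ {a b} → 0ℚ ≤ a → 0ℚ ≤ b → 0ℚ ≤ a * b
*-nonNeg {a} {b} 0≤a 0≤b =
  nonNegative⁻¹ _ {{ℚP.nonNeg*nonNeg⇒nonNeg a {{ℚ.nonNegative 0≤a}} b {{ℚ.nonNegative 0≤b}}}}

*-pos : ∀ {a b} → 0ℚ < a → 0ℚ < b → 0ℚ < a * b
*-pos {a} {b} 0<a 0<b =
  subst (_< a * b) (*-zeroʳ a) (ℚP.*-monoʳ-<-pos a {{ℚ.positive 0<a}} 0<b)

neg-nonPos : ∀ {a} → ¬ (0ℚ ≤ a) → 0ℚ ≤ - a
neg-nonPos {a} ¬p = neg-antimono-≤ (<⇒≤ (≰⇒> ¬p))

[-a]² : ∀ a → - a * - a ≡ a * a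
[-a]² = solve-∀ ℚ-ring

²-nonNeg : ∀ a → 0ℚ ≤ a * a
²-nonNeg a with 0ℚ ℚP.≤? a
... | yes p = *-nonNeg p p
... | no ¬p = subst (0ℚ ≤_) ([-a]² a) (*-nonNeg (neg-nonPos ¬p) (neg-nonPos ¬p))

*-monoʳ : ∀ {c a b} → 0ℚ ≤ c → a ≤ b → c * a ≤ c * b
*-monoʳ {c} 0≤c = ℚP.*-monoˡ-≤-nonNeg c {{ℚ.nonNegative 0≤c}}

*-monoˡ : ∀ {c a b} → 0ℚ ≤ c → a ≤ b → a * c ≤ b * c
*-monoˡ {c} 0≤c = ℚP.*-monoʳ-≤-nonNeg c {{ℚ.nonNegative 0≤c}}

*-mono : ∀ {a b c d} → 0ℚ ≤ a → 0ℚ ≤ d → a ≤ b → c ≤ d → a * c ≤ b * d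
*-mono 0≤a 0≤d a≤b c≤d = ≤-trans (*-monoʳ 0≤a c≤d) (*-monoˡ 0≤d a≤b)

*-cancelˡ : ∀ {c a b} → 0ℚ < c → c * a ≤ c * b → a ≤ b
*-cancelˡ {c} 0<c = ℚP.*-cancelˡ-≤-pos c {{ℚ.positive 0<c}}

*-cancelˡ-≡ : ∀ {c a b} → 0ℚ < c → c * a ≡ c * b → a ≡ b
*-cancelˡ-≡ 0<c eq = ℚP.≤-antisym (*-cancelˡ 0<c (≤-reflexive eq))
                                  (*-cancelˡ 0<c (≤-reflexive (sym eq)))

-- Stands in for square roots: moduli are bounded through their squares, and linear bounds are
-- extracted here.
²-cancel-≤ : ∀ {a b} → 0ℚ ≤ b → a * a ≤ b * b → a ≤ b
²-cancel-≤ {a} {b} 0≤b a²≤b² with a ℚP.≤? b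
... | yes p = p
... | no ¬p = contradiction (≤-<-trans a²≤b² b²<a²) (<-irrefl refl)
  where
  b<a : b < a
  b<a = ≰⇒> ¬p
  b²<a² : b * b < a * a
  b²<a² = ≤-<-trans (*-monoʳ 0≤b (<⇒≤ b<a))
                       (ℚP.*-monoˡ-<-pos a {{ℚ.positive (≤-<-trans 0≤b b<a)}} b<a)

-- 1/ a, with the junk value 0 at a = 0
inv : ℚ → ℚ
inv a with a ℚP.≟ 0ℚ
... | yes _ = 0ℚ
... | no a≢0 = ℚ.1/_ a {{ℚ.≢-nonZero a≢0}}

inv-* : ∀ {a} → 0ℚ < a → a * inv a ≡ 1ℚ
inv-* {a} 0<a with a ℚP.≟ 0ℚ
... | yes refl = contradiction 0<a (<-irrefl refl)
... | no a≢0 = ℚP.*-inverseʳ a {{ℚ.≢-nonZero a≢0}}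

inv-pos : ∀ {a} → 0ℚ < a → 0ℚ < inv a
inv-pos {a} 0<a with 0ℚ ℚP.<? inv a
... | yes p = p
... | no ¬p = contradiction
  (<-≤-trans 0<1
    (subst₂ _≤_ (inv-* 0<a) (*-zeroʳ a) (*-monoʳ (<⇒≤ 0<a) (≮⇒≥ ¬p))))
  (<-irrefl refl)

abstract
  -- An opaque copy of `ℕtoℚ`, so that `ι n` is an atom in ring identities instead of unfolding to a
  -- normalised fraction.
  ι : ℕ → ℚ
  ι = ℕtoℚ

  ι≡ℕtoℚ : ∀ n → ι n ≡ ℕtoℚ n
  ι≡ℕtoℚ n = refl

  ι-0 : ι 0 ≡ 0ℚ
  ι-0 = refl

  ι-suc : ∀ n → ι (suc n) ≡ ι n + 1ℚ
  ι-suc n = ℚP.toℚᵘ-injective (begin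
    ℚ.toℚᵘ (+ suc n / 1)                    ≈⟨ ℚP.toℚᵘ-fromℚᵘ (ℚᵘ.mkℚᵘ (+ suc n) 0) ⟩
    ℚᵘ.mkℚᵘ (+ suc n) 0                      ≈⟨ ℚᵘ.*≡* (cong (ℤ._* + 1) num) ⟩
    ℚᵘ.mkℚᵘ (+ n) 0 ℚᵘ.+ ℚ.toℚᵘ 1ℚ           ≈⟨ ℚᵘP.+-congˡ (ℚ.toℚᵘ 1ℚ) (ℚP.toℚᵘ-fromℚᵘ (ℚᵘ.mkℚᵘ (+ n) 0)) ⟨
    ℚ.toℚᵘ (+ n / 1) ℚᵘ.+ ℚ.toℚᵘ 1ℚ         ≈⟨ ℚP.toℚᵘ-homo-+ (+ n / 1) 1ℚ ⟨
    ℚ.toℚᵘ (+ n / 1 + 1ℚ)                   ∎)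
    where
    open ℚᵘP.≃-Reasoning
    num : + suc n ≡ + n ℤ.* + 1 ℤ.+ + 1 ℤ.* + 1
    num = trans (cong +_ (sym (ℕP.+-comm n 1))) (sym (cong (ℤ._+ + 1) (ℤP.*-identityʳ (+ n))))

ι-1 : ι 1 ≡ 1ℚ
ι-1 = trans (ι-suc 0) (trans (cong (_+ 1ℚ) ι-0) (+-identityˡ 1ℚ))

ι-nonNeg : ∀ n → 0ℚ ≤ ι n
ι-nonNeg zero = ≤-reflexive (sym ι-0)
ι-nonNeg (suc n) = subst (0ℚ ≤_) (sym (ι-suc n)) (+-nonNeg (ι-nonNeg n) 0≤1)

ι-pos : ∀ n → 0ℚ < ι (suc n)
ι-pos n = <-by (ι n + 1ℚ) (trans (ι-suc n) (sym (+-identityˡ _)))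
                (<-≤-trans 0<1 (≤-by (ι n) (ℚP.+-comm (ι n) 1ℚ) (ι-nonNeg n)))

ι-+ : ∀ m n → ι (m ℕ.+ n) ≡ ι m + ι n
ι-+ zero n = sym (trans (cong (_+ ι n) ι-0) (+-identityˡ (ι n)))
ι-+ (suc m) n = begin
  ι (suc (m ℕ.+ n))   ≡⟨ ι-suc (m ℕ.+ n) ⟩
  ι (m ℕ.+ n) + 1ℚ    ≡⟨ cong (_+ 1ℚ) (ι-+ m n) ⟩
  ι m + ι n + 1ℚ      ≡⟨ shuffle (ι m) (ι n) ⟩
  ι m + 1ℚ + ι n      ≡⟨ cong (_+ ι n) (ι-suc m) ⟨
  ι (suc m) + ι n     ∎
  where
  open ≡-Reasoning
  shuffle : ∀ a b → a + b + 1ℚ ≡ a + 1ℚ + b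
  shuffle = solve-∀ ℚ-ring

ι-* : ∀ m n → ι (m ℕ.* n) ≡ ι m * ι n
ι-* zero n = trans ι-0 (sym (trans (cong (_* ι n) ι-0) (ℚP.*-zeroˡ (ι n))))
ι-* (suc m) n = begin
  ι (n ℕ.+ m ℕ.* n)    ≡⟨ ι-+ n (m ℕ.* n) ⟩
  ι n + ι (m ℕ.* n)    ≡⟨ cong (_+_ (ι n)) (ι-* m n) ⟩
  ι n + ι m * ι n      ≡⟨ shuffle (ι m) (ι n) ⟩
  (ι m + 1ℚ) * ι n     ≡⟨ cong (_* ι n) (ι-suc m) ⟨
  ι (suc m) * ι n      ∎
  where
  open ≡-Reasoning
  shuffle : ∀ a b → b + a * b ≡ (a + 1ℚ) * b
  shuffle = solve-∀ ℚ-ring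

ι-mono : ∀ {m n} → m ℕ.≤ n → ι m ≤ ι n
ι-mono {m} {n} m≤n = ≤-by (ι (n ℕ.∸ m))
  (trans (cong ι (sym (ℕP.m+[n∸m]≡n m≤n))) (ι-+ m (n ℕ.∸ m))) (ι-nonNeg _)

abstract
  i≤∣i∣ : ∀ i → i ℤ.≤ + ℤ.∣ i ∣
  i≤∣i∣ (+ n) = ℤP.≤-refl
  i≤∣i∣ ℤ.-[1+ n ] = ℤ.-≤+

  -- The absolute value of the numerator serves, because the denominator is at least 1.
  archimedes : ∀ q → ∃ λ n → q ≤ ι n
  archimedes q@(ℚ.mkℚ n d c) = ℤ.∣ n ∣ , ℚP.toℚᵘ-cancel-≤ (ℚᵘP.≤-respʳ-≃
    (ℚᵘP.≃-sym (ℚP.toℚᵘ-fromℚᵘ (ℚᵘ.mkℚᵘ (+ ℤ.∣ n ∣) 0)))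
    (ℚᵘ.*≤* (ℤP.≤-trans (ℤP.*-monoʳ-≤-nonNeg (+ 1) (i≤∣i∣ n))
                       (ℤP.*-monoˡ-≤-nonNeg (+ ℤ.∣ n ∣) (ℤ.+≤+ (ℕ.s≤s ℕ.z≤n))))))

archimedes-* : ∀ p {ε} → 0ℚ < ε → ∃ λ n → p ≤ ε * ι (suc n)
archimedes-* p {ε} 0<ε = let n , le = archimedes (inv ε * p) in
  n , ≤-trans
    (≤-reflexive (begin
      p                  ≡⟨ *-identityˡ p ⟨
      1ℚ * p             ≡⟨ cong (_* p) (inv-* 0<ε) ⟨
      ε * inv ε * p      ≡⟨ ℚP.*-assoc ε (inv ε) p ⟩
      ε * (inv ε * p)    ∎))
    (*-monoʳ (<⇒≤ 0<ε) (≤-trans le (ι-mono (ℕP.n≤1+n n))))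
  where open ≡-Reasoning

≤⇒≯ : ∀ {a b} → a ≤ b → ¬ (b < a)
≤⇒≯ a≤b b<a = <-irrefl refl (≤-<-trans a≤b b<a)

-- The binomial series of the square root and Wallis's product

≡⇒-≡0 : ∀ {a b} → a ≡ b → a - b ≡ 0ℚ
≡⇒-≡0 {a} refl = ℚP.+-inverseʳ a

-- Reduces an equation with hypotheses to a ring identity for the solver.
≡-by₁ : ∀ {L R a b} p → L ≡ R + p * (a - b) → a ≡ b → L ≡ R
≡-by₁ {L} {R} {a} {b} p eq h = trans eq (trans (cong (λ x → R + p * x) (≡⇒-≡0 h)) (simp R p))
  where
  simp : ∀ R p → R + p * 0ℚ ≡ R
  simp = solve-∀ ℚ-ring

≡-by₂ : ∀ {L R a b c d} p q → L ≡ R + p * (a - b) + q * (c - d) → a ≡ b → c ≡ d → L ≡ R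
≡-by₂ p q eq h₁ h₂ = ≡-by₁ p (≡-by₁ q eq h₂) h₁

≡-by₃ : ∀ {L R a b c d e f} p q r → L ≡ R + p * (a - b) + q * (c - d) + r * (e - f) →
        a ≡ b → c ≡ d → e ≡ f → L ≡ R
≡-by₃ p q r eq h₁ h₂ h₃ = ≡-by₂ p q (≡-by₁ r eq h₃) h₁ h₂

Σ< : ℕ → (ℕ → ℚ) → ℚ
Σ< zero f = 0ℚ
Σ< (suc n) f = Σ< n f + f n

infixr 8 _^_
_^_ : ℚ → ℕ → ℚ
v ^ zero = 1ℚ
v ^ suc k = v ^ k * v

^-nonNeg : ∀ {v} k → 0ℚ ≤ v → 0ℚ ≤ v ^ k
^-nonNeg zero 0≤v = 0≤1
^-nonNeg (suc k) 0≤v = *-nonNeg (^-nonNeg k 0≤v) 0≤v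

Σ<-nonNeg : ∀ n {f} → (∀ i → 0ℚ ≤ f i) → 0ℚ ≤ Σ< n f
Σ<-nonNeg zero h = ≤-refl
Σ<-nonNeg (suc n) h = +-nonNeg (Σ<-nonNeg n h) (h n)

-- The probability C(2j, j + k) / 4^j that a lazy walk on ℕ, reflected at 0,
-- is at 0 after j steps from k; equivalently the k-th Fourier coefficient of cos²ʲ.
walk : ℕ → ℕ → ℚ
walk zero zero = 1ℚ
walk zero (suc k) = 0ℚ
walk (suc j) zero = ½ * walk j 0 + ½ * walk j 1
walk (suc j) (suc k) = ½ * walk j (suc k) + ¼ * (walk j (suc (suc k)) + walk j k)

walk-nonNeg : ∀ j k → 0ℚ ≤ walk j k
walk-nonNeg zero zero = 0≤1
walk-nonNeg zero (suc k) = ≤-refl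
walk-nonNeg (suc j) zero = +-nonNeg (*-nonNeg 0≤½ (walk-nonNeg j 0)) (*-nonNeg 0≤½ (walk-nonNeg j 1))
walk-nonNeg (suc j) (suc k) = +-nonNeg (*-nonNeg 0≤½ (walk-nonNeg j (suc k)))
  (*-nonNeg 0≤¼ (+-nonNeg (walk-nonNeg j (suc (suc k))) (walk-nonNeg j k)))

-- The quotient (j - k)/(j + k + 1) of neighbouring binomial coefficients, multiplied out so that it
-- also holds where they vanish. The induction runs on the recursion of `walk` alone: three
-- consecutive quotients at j give one at j + 1.
walk-ratio : ∀ j k → (ι j + 1ℚ + ι k) * walk j (suc k) ≡ (ι j - ι k) * walk j k
walk-ratio zero zero = trans (cong (λ x → (x + 1ℚ + x) * 0ℚ) ι-0) (sym (cong (λ x → (x - x) * 1ℚ) ι-0))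
walk-ratio zero (suc k) = trans (*-zeroʳ (ι 0 + 1ℚ + ι (suc k))) (sym (*-zeroʳ (ι 0 - ι (suc k))))
walk-ratio (suc j) zero = begin
  (ι (suc j) + 1ℚ + ι 0) * (½ * c + ¼ * (e + b))  ≡⟨ cong₂ (λ x y → (x + 1ℚ + y) * (½ * c + ¼ * (e + b))) (ι-suc j) ι-0 ⟩
  (ι j + 1ℚ + 1ℚ + 0ℚ) * (½ * c + ¼ * (e + b))      ≡⟨ ≡-by₂ ¼ ¼ (ident (ι j) b c e) h₁ h₂ ⟩
  (ι j + 1ℚ - 0ℚ) * (½ * b + ½ * c)  ≡⟨ cong₂ (λ x y → (x - y) * (½ * b + ½ * c)) (ι-suc j) ι-0 ⟨
  (ι (suc j) - ι 0) * (½ * b + ½ * c)                ∎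
  where
  open ≡-Reasoning
  b = walk j 0
  c = walk j 1
  e = walk j 2
  h₁ : (ι j + 1ℚ + 0ℚ) * c ≡ (ι j - 0ℚ) * b
  h₁ = subst (λ x → (ι j + 1ℚ + x) * c ≡ (ι j - x) * b) ι-0 (walk-ratio j 0)
  h₂ : (ι j + 1ℚ + 1ℚ) * e ≡ (ι j - 1ℚ) * c
  h₂ = subst (λ x → (ι j + 1ℚ + x) * e ≡ (ι j - x) * c) ι-1 (walk-ratio j 1)
  ident : ∀ J b c e → (J + 1ℚ + 1ℚ + 0ℚ) * (½ * c + ¼ * (e + b)) ≡
    (J + 1ℚ - 0ℚ) * (½ * b + ½ * c) + ¼ * ((J + 1ℚ + 0ℚ) * c - (J - 0ℚ) * b)
      + ¼ * ((J + 1ℚ + 1ℚ) * e - (J - 1ℚ) * c)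
  ident = solve-∀ ℚ-ring
walk-ratio (suc j) (suc k) = begin
  (ι (suc j) + 1ℚ + ι (suc k)) * (½ * c + ¼ * (e + b))
    ≡⟨ cong₂ (λ x y → (x + 1ℚ + y) * (½ * c + ¼ * (e + b))) (ι-suc j) (ι-suc k) ⟩
  (ι j + 1ℚ + 1ℚ + (ι k + 1ℚ)) * (½ * c + ¼ * (e + b))
    ≡⟨ ≡-by₃ ¼ ¼ ½ (ident (ι j) (ι k) a b c e) h₁ h₃ h₂ ⟩
  (ι j + 1ℚ - (ι k + 1ℚ)) * (½ * b + ¼ * (c + a))
    ≡⟨ cong₂ (λ x y → (x - y) * (½ * b + ¼ * (c + a))) (ι-suc j) (ι-suc k) ⟨
  (ι (suc j) - ι (suc k)) * (½ * b + ¼ * (c + a))   ∎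
  where
  open ≡-Reasoning
  a = walk j k
  b = walk j (suc k)
  c = walk j (suc (suc k))
  e = walk j (suc (suc (suc k)))
  h₁ : (ι j + 1ℚ + ι k) * b ≡ (ι j - ι k) * a
  h₁ = walk-ratio j k
  h₂ : (ι j + 1ℚ + (ι k + 1ℚ)) * c ≡ (ι j - (ι k + 1ℚ)) * b
  h₂ = subst (λ x → (ι j + 1ℚ + x) * c ≡ (ι j - x) * b) (ι-suc k) (walk-ratio j (suc k))
  h₃ : (ι j + 1ℚ + (ι k + 1ℚ + 1ℚ)) * e ≡ (ι j - (ι k + 1ℚ + 1ℚ)) * c
  h₃ = subst (λ x → (ι j + 1ℚ + x) * e ≡ (ι j - x) * c)
         (trans (ι-suc (suc k)) (cong (_+ 1ℚ) (ι-suc k))) (walk-ratio j (suc (suc k)))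
  ident : ∀ J K a b c e → (J + 1ℚ + 1ℚ + (K + 1ℚ)) * (½ * c + ¼ * (e + b)) ≡
    (J + 1ℚ - (K + 1ℚ)) * (½ * b + ¼ * (c + a)) + ¼ * ((J + 1ℚ + K) * b - (J - K) * a)
      + ¼ * ((J + 1ℚ + (K + 1ℚ + 1ℚ)) * e - (J - (K + 1ℚ + 1ℚ)) * c)
      + ½ * ((J + 1ℚ + (K + 1ℚ)) * c - (J - (K + 1ℚ)) * b)
  ident = solve-∀ ℚ-ring

central : ℕ → ℚ
central j = walk j 0

central-nonNeg : ∀ j → 0ℚ ≤ central j
central-nonNeg j = walk-nonNeg j 0

central-suc : ∀ j → (2ℚ * ι j + 2ℚ) * central (suc j) ≡ (2ℚ * ι j + 1ℚ) * central j
central-suc j = ≡-by₁ 1ℚ (ident (ι j) (walk j 0) (walk j 1))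
  (subst (λ x → (ι j + 1ℚ + x) * walk j 1 ≡ (ι j - x) * walk j 0) ι-0 (walk-ratio j 0))
  where
  ident : ∀ J b c → (2ℚ * J + 2ℚ) * (½ * b + ½ * c) ≡
    (2ℚ * J + 1ℚ) * b + 1ℚ * ((J + 1ℚ + 0ℚ) * c - (J - 0ℚ) * b)
  ident = solve-∀ ℚ-ring

2ι+1-pos : ∀ j → 0ℚ < 2ℚ * ι j + 1ℚ
2ι+1-pos j = <-by (2ℚ * ι j + 1ℚ) (sym (+-identityˡ (2ℚ * ι j + 1ℚ)))
  (<-≤-trans 0<1 (≤-by (2ℚ * ι j) (ℚP.+-comm (2ℚ * ι j) 1ℚ) (*-nonNeg 0≤2 (ι-nonNeg j))))

2ι+2-pos : ∀ j → 0ℚ < 2ℚ * ι j + 2ℚ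
2ι+2-pos j = <-≤-trans (2ι+1-pos j) (≤-by 1ℚ (ident (ι j)) 0≤1)
  where
  ident : ∀ J → 2ℚ * J + 2ℚ ≡ 2ℚ * J + 1ℚ + 1ℚ
  ident = solve-∀ ℚ-ring

central-pos : ∀ j → 0ℚ < central j
central-pos zero = 0<1
central-pos (suc j) with 0ℚ ℚP.<? central (suc j)
... | yes p = p
... | no ¬p = contradiction (*-pos (2ι+1-pos j) (central-pos j)) (≤⇒≯ (begin
  (2ℚ * ι j + 1ℚ) * central j         ≡⟨ central-suc j ⟨
  (2ℚ * ι j + 2ℚ) * central (suc j)   ≤⟨ *-monoʳ (<⇒≤ (2ι+2-pos j)) (≮⇒≥ ¬p) ⟩
  (2ℚ * ι j + 2ℚ) * 0ℚ                ≡⟨ *-zeroʳ (2ℚ * ι j + 2ℚ) ⟩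
  0ℚ                                  ∎))
  where open ≤-Reasoning

central-anti : ∀ j → central (suc j) ≤ central j
central-anti j = *-cancelˡ (2ι+2-pos j) (≤-by (central j)
  (≡-by₁ (- 1ℚ) (ident (ι j) (central j) (central (suc j))) (central-suc j)) (central-nonNeg j))
  where
  ident : ∀ J c c′ → (2ℚ * J + 2ℚ) * c ≡ (2ℚ * J + 2ℚ) * c′ + c
    + - 1ℚ * ((2ℚ * J + 2ℚ) * c′ - (2ℚ * J + 1ℚ) * c)
  ident = solve-∀ ℚ-ring

-- The truncated binomial series of 1/√(1 − v).
invSqrt : ℚ → ℕ → ℚ
invSqrt v J = Σ< J (λ i → central i * v ^ i)

-- For J ≥ 1, multiplied by v^J this is the integral of u^(J-1) `invSqrt` u k over [0, v].
weighted : ℚ → ℕ → ℕ → ℚ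
weighted v J k = Σ< k (λ i → central i * v ^ i * inv (ι J + ι i))

ι+ι-inv : ∀ J i → (ι (suc J) + ι i) * inv (ι (suc J) + ι i) ≡ 1ℚ
ι+ι-inv J i = inv-* (subst (0ℚ <_) (ι-+ (suc J) i) (ι-pos (J ℕ.+ i)))

-- Integration by parts in algebraic form: differentiate u^J (1 - u) p with p = `invSqrt` u k, use
-- 2(1 - u) p′ = p - 2k c_k u^(k-1), where c_k = `central k`, integrate and divide by v^J.
weighted-rec : ∀ v j k → let J = suc j in
  2ℚ * ι J * weighted v J k - (2ℚ * ι J + 1ℚ) * v * weighted v (suc J) k ≡
  2ℚ * (1ℚ - v) * invSqrt v k + 2ℚ * ι k * central k * v ^ k * inv (ι J + ι k)
weighted-rec v j zero = trans (ident₁ (ι (suc j)) v)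
  (sym (trans (cong (λ x → 2ℚ * (1ℚ - v) * 0ℚ + 2ℚ * x * 1ℚ * 1ℚ * inv (ι (suc j) + ι 0)) ι-0)
              (ident₂ v (inv (ι (suc j) + ι 0)))))
  where
  ident₁ : ∀ J v → 2ℚ * J * 0ℚ - (2ℚ * J + 1ℚ) * v * 0ℚ ≡ 0ℚ
  ident₁ = solve-∀ ℚ-ring
  ident₂ : ∀ v r → 2ℚ * (1ℚ - v) * 0ℚ + 2ℚ * 0ℚ * 1ℚ * 1ℚ * r ≡ 0ℚ
  ident₂ = solve-∀ ℚ-ring
weighted-rec v j (suc k) = trans
  (split (2ℚ * ι J) ((2ℚ * ι J + 1ℚ) * v) (weighted v J k) (weighted v (suc J) k) (c * V * r₀) (c * V * r₁))
  (trans (cong (_+ (2ℚ * ι J * (c * V * r₀) - (2ℚ * ι J + 1ℚ) * v * (c * V * r₁))) (weighted-rec v j k))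
  (trans (≡-by₃ (2ℚ * c * V) (- (2ℚ * v * c * V)) (- (v * V * r₁))
      (ident (ι J) (ι k) c c′ V v r₀ r₁ (invSqrt v k)) h₁ h₂ (central-suc k))
    (sym (cong₂ (λ x y → 2ℚ * (1ℚ - v) * (invSqrt v k + c * V) + 2ℚ * x * c′ * (V * v) * y)
      (ι-suc k) (cong inv (trans (cong (_+_ (ι J)) (ι-suc k)) (trans (shuffle (ι J) (ι k)) (cong (_+ ι k) (sym (ι-suc J))))))))))
  where
  J = suc j
  c = central k
  c′ = central (suc k)
  V = v ^ k
  r₀ = inv (ι J + ι k)
  r₁ = inv (ι (suc J) + ι k)
  h₁ : (ι J + ι k) * r₀ ≡ 1ℚ
  h₁ = ι+ι-inv j k
  h₂ : (ι J + 1ℚ + ι k) * r₁ ≡ 1ℚ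
  h₂ = trans (cong (λ x → (x + ι k) * r₁) (sym (ι-suc J))) (ι+ι-inv J k)
  shuffle : ∀ a b → a + (b + 1ℚ) ≡ a + 1ℚ + b
  shuffle = solve-∀ ℚ-ring
  split : ∀ a b s t x y → a * (s + x) - b * (t + y) ≡ a * s - b * t + (a * x - b * y)
  split = solve-∀ ℚ-ring
  ident : ∀ J K c c′ V v r₀ r₁ p →
    2ℚ * (1ℚ - v) * p + 2ℚ * K * c * V * r₀ + (2ℚ * J * (c * V * r₀) - (2ℚ * J + 1ℚ) * v * (c * V * r₁)) ≡
    2ℚ * (1ℚ - v) * (p + c * V) + 2ℚ * (K + 1ℚ) * c′ * (V * v) * r₁
      + 2ℚ * c * V * ((J + K) * r₀ - 1ℚ) + - (2ℚ * v * c * V) * ((J + 1ℚ + K) * r₁ - 1ℚ)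
      + - (v * V * r₁) * ((2ℚ * K + 2ℚ) * c′ - (2ℚ * K + 1ℚ) * c)
  ident = solve-∀ ℚ-ring

-- With p the truncated series, the derivative of (1 - v) p² is -2J c_J v^(J-1) p; integrating from
-- 0, where p = 1, gives the identity. The correction is nonnegative for v ≥ 0, so every truncation
-- stays below 1/√(1 - v).
invSqrt-² : ∀ v j → let J = suc j in
  (1ℚ - v) * (invSqrt v J * invSqrt v J) ≡ 1ℚ - 2ℚ * ι J * central J * v ^ J * weighted v J J
invSqrt-² v zero = sym (trans
  (cong₂ (λ x y → 1ℚ - 2ℚ * x * central 1 * (1ℚ * v) * (0ℚ + 1ℚ * 1ℚ * y)) ι-1 (cong₂ (λ x y → inv (x + y)) ι-1 ι-0))
  (ident v))
  where
  ident : ∀ v → 1ℚ - 2ℚ * 1ℚ * (½ * 1ℚ + ½ * 0ℚ) * (1ℚ * v) * (0ℚ + 1ℚ * 1ℚ * 1ℚ)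
    ≡ (1ℚ - v) * ((0ℚ + 1ℚ * 1ℚ) * (0ℚ + 1ℚ * 1ℚ))
  ident = solve-∀ ℚ-ring
invSqrt-² v (suc j) = trans (split v p (c * V)) (trans (cong (_+ (1ℚ - v) * (2ℚ * p * (c * V) + c * V * (c * V))) (invSqrt-² v j))
  (trans (lin (weighted-rec v j J))
    (sym (cong (λ x → 1ℚ - 2ℚ * x * c′ * (V * v) * (S′ + c * V * r′)) (ι-suc J)))))
  where
  J = suc j
  c = central J
  c′ = central (suc J)
  V = v ^ J
  p = invSqrt v J
  S = weighted v J J
  S′ = weighted v (suc J) J
  r₀ = inv (ι J + ι J)
  r′ = inv (ι (suc J) + ι J)
  split : ∀ v p x → (1ℚ - v) * ((p + x) * (p + x)) ≡ (1ℚ - v) * (p * p) + (1ℚ - v) * (2ℚ * p * x + x * x)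
  split = solve-∀ ℚ-ring
  h₂ : (ι J + 1ℚ + ι J) * r′ ≡ 1ℚ
  h₂ = trans (cong (λ x → (x + ι J) * r′) (sym (ι-suc J))) (ι+ι-inv J J)
  ident : ∀ J c c′ V v r₀ r′ p S S′ →
    1ℚ - 2ℚ * J * c * V * S + (1ℚ - v) * (2ℚ * p * (c * V) + c * V * (c * V)) ≡
    1ℚ - 2ℚ * (J + 1ℚ) * c′ * (V * v) * (S′ + c * V * r′)
    + (V * v * (S′ + c * V * r′)) * ((2ℚ * J + 2ℚ) * c′ - (2ℚ * J + 1ℚ) * c)
    + - (c * V) * ((2ℚ * J * S - (2ℚ * J + 1ℚ) * v * S′) - (2ℚ * (1ℚ - v) * p + 2ℚ * J * c * V * r₀))
    + (- (c * c * V * V)) * ((J + J) * r₀ - v * ((J + 1ℚ + J) * r′) - (1ℚ - v))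
  ident = solve-∀ ℚ-ring
  h₃ : (ι J + ι J) * r₀ - v * ((ι J + 1ℚ + ι J) * r′) ≡ 1ℚ - v
  h₃ = trans (cong₂ (λ x y → x - v * y) (ι+ι-inv j J) h₂) (cong (λ x → 1ℚ - x) (*-identityʳ v))
  lin : 2ℚ * ι J * S - (2ℚ * ι J + 1ℚ) * v * S′ ≡ 2ℚ * (1ℚ - v) * p + 2ℚ * ι J * c * V * r₀ →
    1ℚ - 2ℚ * ι J * c * V * S + (1ℚ - v) * (2ℚ * p * (c * V) + c * V * (c * V)) ≡
    1ℚ - 2ℚ * (ι J + 1ℚ) * c′ * (V * v) * (S′ + c * V * r′)
  lin h = ≡-by₃ (V * v * (S′ + c * V * r′)) (- (c * V)) (- (c * c * V * V)) (ident (ι J) c c′ V v r₀ r′ p S S′) (central-suc J) h h₃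

invSqrt-bound : ∀ {v} J → 0ℚ ≤ v → (1ℚ - v) * (invSqrt v J * invSqrt v J) ≤ 1ℚ
invSqrt-bound {v} zero 0≤v = ≤-by 1ℚ (ident v) 0≤1
  where
  ident : ∀ v → 1ℚ ≡ (1ℚ - v) * (0ℚ * 0ℚ) + 1ℚ
  ident = solve-∀ ℚ-ring
invSqrt-bound {v} (suc j) 0≤v = ≤-by e (trans (ident e) (cong (_+ e) (sym (invSqrt-² v j))))
  (*-nonNeg (*-nonNeg (*-nonNeg (*-nonNeg 0≤2 (ι-nonNeg J)) (central-nonNeg J)) (^-nonNeg J 0≤v))
    (Σ<-nonNeg J (λ i → *-nonNeg (*-nonNeg (central-nonNeg i) (^-nonNeg i 0≤v))
      (<⇒≤ (inv-pos (subst (0ℚ <_) (ι-+ J i) (ι-pos (j ℕ.+ i))))))))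
  where
  J = suc j
  e = 2ℚ * ι J * central J * v ^ J * weighted v J J
  ident : ∀ e → 1ℚ ≡ 1ℚ - e + e
  ident = solve-∀ ℚ-ring

-- The coefficient of v^(j+1) in √(1 − v), up to sign.
weight : ℕ → ℚ
weight j = central j - central (suc j)

weight-nonNeg : ∀ j → 0ℚ ≤ weight j
weight-nonNeg j = ≤⇒0≤- (central-anti j)

-- The weights sum to 1 in the limit, so this tends to 1 - Σ `weight j` v^(j+1) = √(1 - v) for 0 ≤ v
-- < 1. Written with 1 - v^(j+1), its partial sums increase on [0, 1] and each is a lower bound.
sqrtSeries : ℚ → ℕ → ℚ
sqrtSeries v J = Σ< J (λ j → weight j * (1ℚ - v ^ suc j))

-- Summation by parts, moving the factor 1 - v onto the differences of `central`.
sqrtSeries-eq : ∀ v J → sqrtSeries v J + central J * (1ℚ - v ^ J) ≡ (1ℚ - v) * invSqrt v J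
sqrtSeries-eq v zero = ident v
  where
  ident : ∀ v → 0ℚ + 1ℚ * (1ℚ - 1ℚ) ≡ (1ℚ - v) * 0ℚ
  ident = solve-∀ ℚ-ring
sqrtSeries-eq v (suc J) =
  ≡-by₁ 1ℚ (ident (sqrtSeries v J) (central J) (central (suc J)) (v ^ J) v (invSqrt v J)) (sqrtSeries-eq v J)
  where
  ident : ∀ s c c′ V v p → s + (c - c′) * (1ℚ - V * v) + c′ * (1ℚ - V * v) ≡
    (1ℚ - v) * (p + c * V) + 1ℚ * (s + c * (1ℚ - V) - (1ℚ - v) * p)
  ident = solve-∀ ℚ-ring

^-≤1 : ∀ {v} k → 0ℚ ≤ v → v ≤ 1ℚ → v ^ k ≤ 1ℚ
^-≤1 zero 0≤v v≤1 = ≤-refl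
^-≤1 (suc k) 0≤v v≤1 = ≤-trans (*-mono (^-nonNeg k 0≤v) 0≤1 (^-≤1 k 0≤v v≤1) v≤1)
                                   (≤-reflexive (*-identityˡ 1ℚ))

sqrtSeries-≤ : ∀ {x y} J → 0ℚ ≤ y → x * x + y * y ≡ 1ℚ → sqrtSeries (x * x) J ≤ y
sqrtSeries-≤ {x} {y} J 0≤y unit = begin
  sqrtSeries v J  ≤⟨ ≤-by _ refl (*-nonNeg (central-nonNeg J) (≤⇒0≤- (^-≤1 J 0≤v v≤1))) ⟩
  sqrtSeries v J + central J * (1ℚ - v ^ J)         ≡⟨ sqrtSeries-eq v J ⟩
  (1ℚ - v) * p                                      ≡⟨ cong (_* p) 1-v ⟩
  y * y * p                                         ≡⟨ ℚP.*-assoc y y p ⟩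
  y * (y * p)                                       ≤⟨ *-monoʳ 0≤y (²-cancel-≤ 0≤1 yp²≤1) ⟩
  y * 1ℚ                                            ≡⟨ *-identityʳ y ⟩
  y                                                 ∎
  where
  open ≤-Reasoning
  v = x * x
  p = invSqrt v J
  0≤v : 0ℚ ≤ v
  0≤v = ²-nonNeg x
  v≤1 : v ≤ 1ℚ
  v≤1 = ≤-by (y * y) (sym unit) (²-nonNeg y)
  ident₁ : ∀ v w → v + w - v ≡ w
  ident₁ = solve-∀ ℚ-ring
  1-v : 1ℚ - v ≡ y * y
  1-v = trans (cong (_- v) (sym unit)) (ident₁ v (y * y))
  ident₂ : ∀ y p → y * p * (y * p) ≡ y * y * (p * p)
  ident₂ = solve-∀ ℚ-ring
  yp²≤1 : y * p * (y * p) ≤ 1ℚ * 1ℚ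
  yp²≤1 = begin
    y * p * (y * p)      ≡⟨ ident₂ y p ⟩
    y * y * (p * p)      ≡⟨ cong (_* (p * p)) 1-v ⟨
    (1ℚ - v) * (p * p)   ≤⟨ invSqrt-bound J 0≤v ⟩
    1ℚ                   ≡⟨ *-identityˡ 1ℚ ⟨
    1ℚ * 1ℚ              ∎

-- The reciprocal of the J-th Wallis product; it decreases to 2/π, the mean of |sin|.
wallis : ℕ → ℚ
wallis J = (2ℚ * ι J + 1ℚ) * (central J * central J)

wallis-suc : ∀ J → wallis (suc J) ≡ wallis J - weight J * central (suc J)
wallis-suc J = trans (cong (λ x → (2ℚ * x + 1ℚ) * (c′ * c′)) (ι-suc J))
  (≡-by₁ (c + c′) (ident (ι J) c c′) (central-suc J))
  where
  c = central J
  c′ = central (suc J)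
  ident : ∀ J c c′ → (2ℚ * (J + 1ℚ) + 1ℚ) * (c′ * c′) ≡
    (2ℚ * J + 1ℚ) * (c * c) - (c - c′) * c′ + (c + c′) * ((2ℚ * J + 2ℚ) * c′ - (2ℚ * J + 1ℚ) * c)
  ident = solve-∀ ℚ-ring

wallis-0 : wallis 0 ≡ 1ℚ
wallis-0 = cong (λ x → (2ℚ * x + 1ℚ) * (1ℚ * 1ℚ)) ι-0

-- The left side is the mean over the circle of `sqrtSeries` evaluated at cos², since cos²ʲ has mean
-- `central j`. It is thus the truncated mean of |sin|, found by telescoping `wallis`.
wallis-sum : ∀ J → Σ< J (λ j → weight j * (1ℚ - central (suc j))) ≡ wallis J - central J
wallis-sum zero = sym (cong (_- 1ℚ) wallis-0)
wallis-sum (suc J) = ≡-by₂ 1ℚ (- 1ℚ)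
  (ident (Σ< J (λ j → weight j * (1ℚ - central (suc j)))) (central J) (central (suc J)) (wallis J) (wallis (suc J)))
  (wallis-sum J) (wallis-suc J)
  where
  ident : ∀ s c c′ m m′ → s + (c - c′) * (1ℚ - c′) ≡
    m′ - c′ + 1ℚ * (s - (m - c)) + - 1ℚ * (m′ - (m - (c - c′) * c′))
  ident = solve-∀ ℚ-ring

wallis-≤1 : ∀ J → wallis J ≤ 1ℚ
wallis-≤1 zero = ≤-reflexive wallis-0
wallis-≤1 (suc J) = ≤-trans (≤-by (weight J * central (suc J))
    (trans (ident (wallis J) (weight J * central (suc J))) (cong (_+ weight J * central (suc J)) (sym (wallis-suc J))))
    (*-nonNeg (weight-nonNeg J) (central-nonNeg (suc J))))
  (wallis-≤1 J)
  where
  ident : ∀ m e → m ≡ m - e + e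
  ident = solve-∀ ℚ-ring

-- From (2J + 1) `central J`² = `wallis J` ≤ 1.
central-small : ∀ {ε} → 0ℚ < ε → ∃ λ J → central J ≤ ε
central-small {ε} 0<ε = let J , le = archimedes-* 1ℚ (*-pos 0<ε 0<ε) in
  J , ²-cancel-≤ (<⇒≤ 0<ε) (*-cancelˡ (2ι+1-pos J) (begin
    wallis J                         ≤⟨ wallis-≤1 J ⟩
    1ℚ                               ≤⟨ le ⟩
    ε * ε * ι (suc J)                ≡⟨ cong (_*_ (ε * ε)) (ι-suc J) ⟩
    ε * ε * (ι J + 1ℚ)  ≤⟨ ≤-by (ε * ε * ι J) (ident ε (ι J)) (*-nonNeg (²-nonNeg ε) (ι-nonNeg J)) ⟩
    (2ℚ * ι J + 1ℚ) * (ε * ε)        ∎))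
  where
  open ≤-Reasoning
  ident : ∀ ε J → (2ℚ * J + 1ℚ) * (ε * ε) ≡ ε * ε * (J + 1ℚ) + ε * ε * J
  ident = solve-∀ ℚ-ring

-- Wallis's product and Leibniz's series

Σ<-cong : ∀ n {f g} → (∀ i → f i ≡ g i) → Σ< n f ≡ Σ< n g
Σ<-cong zero h = refl
Σ<-cong (suc n) h = cong₂ _+_ (Σ<-cong n h) (h n)

Σ<-split : ∀ m n f → Σ< (m ℕ.+ n) f ≡ Σ< m f + Σ< n (λ i → f (m ℕ.+ i))
Σ<-split m zero f = trans (cong (λ x → Σ< x f) (ℕP.+-identityʳ m)) (sym (+-identityʳ _))
Σ<-split m (suc n) f = trans (cong (λ x → Σ< x f) (ℕP.+-suc m n))
  (trans (cong (_+ f (m ℕ.+ n)) (Σ<-split m n f)) (ℚP.+-assoc (Σ< m f) (Σ< n (λ i → f (m ℕ.+ i))) (f (m ℕ.+ n))))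

Σ<-mono : ∀ n {f g} → (∀ i → i ℕ.< n → f i ≤ g i) → Σ< n f ≤ Σ< n g
Σ<-mono zero h = ≤-refl
Σ<-mono (suc n) h = +-mono-≤ (Σ<-mono n (λ i i<n → h i (ℕP.m<n⇒m<1+n i<n))) (h n ℕP.≤-refl)

Σ<-*ˡ : ∀ n c f → Σ< n (λ i → c * f i) ≡ c * Σ< n f
Σ<-*ˡ zero c f = sym (*-zeroʳ c)
Σ<-*ˡ (suc n) c f = trans (cong (_+ c * f n) (Σ<-*ˡ n c f)) (sym (ℚP.*-distribˡ-+ c (Σ< n f) (f n)))

walk-outside : ∀ j k → j ℕ.< k → walk j k ≡ 0ℚ
walk-outside zero (suc k) _ = refl
walk-outside (suc j) (suc k) (ℕ.s≤s j<k)
  rewrite walk-outside j (suc k) (ℕP.m<n⇒m<1+n j<k)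
        | walk-outside j (suc (suc k)) (ℕP.m<n⇒m<1+n (ℕP.m<n⇒m<1+n j<k))
        | walk-outside j k j<k = refl

-- On the whole line, the mass within distance K changes only by the flux through its two ends; the
-- factor 2 folds the line onto ℕ.
walk-mass-suc : ∀ j K →
  walk (suc j) 0 + 2ℚ * Σ< K (λ k → walk (suc j) (suc k)) ≡
  walk j 0 + 2ℚ * Σ< K (λ k → walk j (suc k)) + ½ * (walk j (suc K) - walk j K)
walk-mass-suc j zero = ident (walk j 0) (walk j 1)
  where
  ident : ∀ a b → ½ * a + ½ * b + 2ℚ * 0ℚ ≡ a + 2ℚ * 0ℚ + ½ * (b - a)
  ident = solve-∀ ℚ-ring
walk-mass-suc j (suc K) = ≡-by₁ 1ℚ (ident (walk (suc j) 0) (Σ< K (λ k → walk (suc j) (suc k)))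
  (walk j 0) (Σ< K (λ k → walk j (suc k))) (walk j K) (walk j (suc K)) (walk j (suc (suc K)))) (walk-mass-suc j K)
  where
  ident : ∀ a′ s′ a s x y z → a′ + 2ℚ * (s′ + (½ * y + ¼ * (z + x))) ≡
    a + 2ℚ * (s + y) + ½ * (z - y) + 1ℚ * (a′ + 2ℚ * s′ - (a + 2ℚ * s + ½ * (y - x)))
  ident = solve-∀ ℚ-ring

walk-mass : ∀ j K → j ℕ.≤ K → walk j 0 + 2ℚ * Σ< K (λ k → walk j (suc k)) ≡ 1ℚ
walk-mass zero K _ = trans (cong (λ x → 1ℚ + 2ℚ * x) (Σ0 K)) refl
  where
  Σ0 : ∀ K → Σ< K (λ _ → 0ℚ) ≡ 0ℚ
  Σ0 zero = refl
  Σ0 (suc K) = cong (_+ 0ℚ) (Σ0 K)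
walk-mass (suc j) K j<K = trans (walk-mass-suc j K) (trans
  (cong₂ (λ x y → walk j 0 + 2ℚ * Σ< K (λ k → walk j (suc k)) + ½ * (x - y))
    (walk-outside j (suc K) (ℕP.m<n⇒m<1+n j<K)) (walk-outside j K j<K))
  (trans (cong (_+ ½ * (0ℚ - 0ℚ)) (walk-mass j K (ℕP.<⇒≤ j<K))) refl))

-- The summand ∏_{i<k} (n − ½ − i) / (n + 3/2 + i) of ₂F₁(1, ½ − n; n + 3/2; −1).
-- For n = 0 the sum is Leibniz's series for π/4; Kummer's theorem relates it to
-- the sums for larger n, which are comparable to a row of Pascal's triangle.
kummer : ℕ → ℕ → ℚ
kummer n zero = 1ℚ
kummer n (suc k) = kummer n k * (2ℚ * ι n - 1ℚ - 2ℚ * ι k) * inv (2ℚ * ι n + (2ℚ * ι k + 1ℚ + 2ℚ))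

kummer-den-pos : ∀ n k → 0ℚ < 2ℚ * ι n + (2ℚ * ι k + 1ℚ + 2ℚ)
kummer-den-pos n k = <-≤-trans (2ι+1-pos k) (≤-by (2ℚ * ι n + 2ℚ) (ident (2ℚ * ι n) (2ℚ * ι k + 1ℚ))
    (+-nonNeg (*-nonNeg 0≤2 (ι-nonNeg n)) 0≤2))
  where
  ident : ∀ a b → a + (b + 2ℚ) ≡ b + (a + 2ℚ)
  ident = solve-∀ ℚ-ring

kummer-suc : ∀ n k → (2ℚ * ι n + (2ℚ * ι k + 1ℚ + 2ℚ)) * kummer n (suc k) ≡ (2ℚ * ι n - 1ℚ - 2ℚ * ι k) * kummer n k
kummer-suc n k = ≡-by₁ ((2ℚ * ι n - 1ℚ - 2ℚ * ι k) * kummer n k)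
  (ident (2ℚ * ι n + (2ℚ * ι k + 1ℚ + 2ℚ)) (kummer n k) (2ℚ * ι n - 1ℚ - 2ℚ * ι k) (inv (2ℚ * ι n + (2ℚ * ι k + 1ℚ + 2ℚ))))
  (inv-* (kummer-den-pos n k))
  where
  ident : ∀ d t m r → d * (t * m * r) ≡ m * t + m * t * (d * r - 1ℚ)
  ident = solve-∀ ℚ-ring

-- The terms are hypergeometric in n as well as in k. This quotient certifies the telescoping in
-- `kummerSum-suc` and later carries estimates from n to n + 1.
kummer-shift : ∀ n k → (2ℚ * ι n + 1ℚ - 2ℚ * ι k) * (2ℚ * ι n + (2ℚ * ι k + 1ℚ + 2ℚ)) * kummer (suc n) k ≡
                       (2ℚ * ι n + 1ℚ) * (2ℚ * ι n + 1ℚ + 2ℚ) * kummer n k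
kummer-shift n zero = trans (cong (λ z → (2ℚ * ι n + 1ℚ - 2ℚ * z) * (2ℚ * ι n + (2ℚ * z + 1ℚ + 2ℚ)) * 1ℚ) ι-0) (ident (ι n))
  where
  ident : ∀ n → (2ℚ * n + 1ℚ - 2ℚ * 0ℚ) * (2ℚ * n + (2ℚ * 0ℚ + 1ℚ + 2ℚ)) * 1ℚ ≡ (2ℚ * n + 1ℚ) * (2ℚ * n + 1ℚ + 2ℚ) * 1ℚ
  ident = solve-∀ ℚ-ring
kummer-shift n (suc k) = trans
  (cong (λ z → (2ℚ * ι n + 1ℚ - 2ℚ * z) * (2ℚ * ι n + (2ℚ * z + 1ℚ + 2ℚ)) * kummer (suc n) (suc k)) (ι-suc k))
  (*-cancelˡ-≡ (kummer-den-pos n k)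
    (≡-by₃ ((2ℚ * N - 1ℚ - 2ℚ * K) * (2ℚ * N + (2ℚ * K + 1ℚ + 2ℚ))) (2ℚ * N - 1ℚ - 2ℚ * K) (- ((2ℚ * N + 1ℚ) * (2ℚ * N + 1ℚ + 2ℚ)))
      (ident N K (kummer n k) (kummer n (suc k)) (kummer (suc n) k) (kummer (suc n) (suc k)))
      (subst (λ x → (2ℚ * x + (2ℚ * ι k + 1ℚ + 2ℚ)) * kummer (suc n) (suc k) ≡ (2ℚ * x - 1ℚ - 2ℚ * ι k) * kummer (suc n) k) (ι-suc n) (kummer-suc (suc n) k))
      (kummer-shift n k) (kummer-suc n k)))
  where
  N = ι n
  K = ι k
  ident : ∀ n k t t₁ u u₁ →
    (2ℚ * n + (2ℚ * k + 1ℚ + 2ℚ)) * ((2ℚ * n + 1ℚ - 2ℚ * (k + 1ℚ)) * (2ℚ * n + (2ℚ * (k + 1ℚ) + 1ℚ + 2ℚ)) * u₁) ≡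
    (2ℚ * n + (2ℚ * k + 1ℚ + 2ℚ)) * ((2ℚ * n + 1ℚ) * (2ℚ * n + 1ℚ + 2ℚ) * t₁)
    + (2ℚ * n - 1ℚ - 2ℚ * k) * (2ℚ * n + (2ℚ * k + 1ℚ + 2ℚ)) * ((2ℚ * (n + 1ℚ) + (2ℚ * k + 1ℚ + 2ℚ)) * u₁ - (2ℚ * (n + 1ℚ) - 1ℚ - 2ℚ * k) * u)
    + (2ℚ * n - 1ℚ - 2ℚ * k) * ((2ℚ * n + 1ℚ - 2ℚ * k) * (2ℚ * n + (2ℚ * k + 1ℚ + 2ℚ)) * u - (2ℚ * n + 1ℚ) * (2ℚ * n + 1ℚ + 2ℚ) * t)
    + - ((2ℚ * n + 1ℚ) * (2ℚ * n + 1ℚ + 2ℚ)) * ((2ℚ * n + (2ℚ * k + 1ℚ + 2ℚ)) * t₁ - (2ℚ * n - 1ℚ - 2ℚ * k) * t)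
  ident = solve-∀ ℚ-ring

kummerSum : ℕ → ℕ → ℚ
kummerSum n K = Σ< K (kummer n)

-- A Wilf–Zeilberger telescoping.
kummerSum-suc : ∀ n K →
  (2ℚ * ι n + 1ℚ) * (2ℚ * ι n + 1ℚ + 2ℚ) * kummerSum n K ≡
  (2ℚ * ι n + 1ℚ) * (2ℚ * ι n + 2ℚ) * kummerSum (suc n) K + ι K * (2ℚ * ι n + (2ℚ * ι K + 1ℚ + 2ℚ)) * kummer (suc n) K
kummerSum-suc n zero = sym (trans (cong (λ z → (2ℚ * ι n + 1ℚ) * (2ℚ * ι n + 2ℚ) * 0ℚ + z * (2ℚ * ι n + (2ℚ * z + 1ℚ + 2ℚ)) * 1ℚ) ι-0)
    (ident (ι n)))
  where
  ident : ∀ n → (2ℚ * n + 1ℚ) * (2ℚ * n + 2ℚ) * 0ℚ + 0ℚ * (2ℚ * n + (2ℚ * 0ℚ + 1ℚ + 2ℚ)) * 1ℚ ≡ (2ℚ * n + 1ℚ) * (2ℚ * n + 1ℚ + 2ℚ) * 0ℚ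
  ident = solve-∀ ℚ-ring
kummerSum-suc n (suc k) = trans
  (≡-by₃ 1ℚ (- 1ℚ) (- (K + 1ℚ)) (ident (ι n) K (kummerSum n k) (kummerSum (suc n) k) (kummer n k) (kummer (suc n) k) (kummer (suc n) (suc k)))
    (kummerSum-suc n k) (kummer-shift n k)
    (subst (λ x → (2ℚ * x + (2ℚ * ι k + 1ℚ + 2ℚ)) * kummer (suc n) (suc k) ≡ (2ℚ * x - 1ℚ - 2ℚ * ι k) * kummer (suc n) k) (ι-suc n) (kummer-suc (suc n) k)))
  (sym (cong (λ z → (2ℚ * ι n + 1ℚ) * (2ℚ * ι n + 2ℚ) * kummerSum (suc n) (suc k)
       + z * (2ℚ * ι n + (2ℚ * z + 1ℚ + 2ℚ)) * kummer (suc n) (suc k)) (ι-suc k)))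
  where
  K = ι k
  ident : ∀ n k e e₁ t u u₁ →
    (2ℚ * n + 1ℚ) * (2ℚ * n + 1ℚ + 2ℚ) * (e + t) ≡
    (2ℚ * n + 1ℚ) * (2ℚ * n + 2ℚ) * (e₁ + u) + (k + 1ℚ) * (2ℚ * n + (2ℚ * (k + 1ℚ) + 1ℚ + 2ℚ)) * u₁
    + 1ℚ * ((2ℚ * n + 1ℚ) * (2ℚ * n + 1ℚ + 2ℚ) * e - ((2ℚ * n + 1ℚ) * (2ℚ * n + 2ℚ) * e₁ + k * (2ℚ * n + (2ℚ * k + 1ℚ + 2ℚ)) * u))
    + - 1ℚ * ((2ℚ * n + 1ℚ - 2ℚ * k) * (2ℚ * n + (2ℚ * k + 1ℚ + 2ℚ)) * u - (2ℚ * n + 1ℚ) * (2ℚ * n + 1ℚ + 2ℚ) * t)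
    + - (k + 1ℚ) * ((2ℚ * (n + 1ℚ) + (2ℚ * k + 1ℚ + 2ℚ)) * u₁ - (2ℚ * (n + 1ℚ) - 1ℚ - 2ℚ * k) * u)
  ident = solve-∀ ℚ-ring

Σ<-first : ∀ m f → Σ< (suc m) f ≡ f 0 + Σ< m (f ∘ suc)
Σ<-first m f = trans (Σ<-split 1 m f) (cong (_+ Σ< m (f ∘ suc)) (+-identityˡ (f 0)))

Alternating : (ℕ → ℚ) → Set
Alternating f = ∀ i → ∃ λ ρ → 0ℚ ≤ ρ × ρ ≤ 1ℚ × f (suc i) ≡ - ρ * f i

alternating-sum : ∀ m f → Alternating f → 0ℚ ≤ f 0 → 0ℚ ≤ Σ< m f × Σ< m f ≤ f 0
alternating-sum zero f alt 0≤f0 = ≤-refl , 0≤f0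
alternating-sum (suc m) f alt 0≤f0 with alt 0
... | ρ , 0≤ρ , ρ≤1 , eq = lower , upper
  where
  g : ℕ → ℚ
  g i = - 1ℚ * f (suc i)
  ident₁ : ∀ ρ x → - 1ℚ * (- ρ * x) ≡ ρ * x
  ident₁ = solve-∀ ℚ-ring
  ident₂ : ∀ ρ x → - 1ℚ * (- ρ * x) ≡ - ρ * (- 1ℚ * x)
  ident₂ = solve-∀ ℚ-ring
  ident₃ : ∀ a s → a + s ≡ a - - 1ℚ * s
  ident₃ = solve-∀ ℚ-ring
  g0≡ : g 0 ≡ ρ * f 0
  g0≡ = trans (cong (_*_ (- 1ℚ)) eq) (ident₁ ρ (f 0))
  ih : 0ℚ ≤ Σ< m g × Σ< m g ≤ g 0
  ih = alternating-sum m g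
    (λ i → let σ , 0≤σ , σ≤1 , e = alt (suc i) in σ , 0≤σ , σ≤1 , trans (cong (_*_ (- 1ℚ)) e) (ident₂ σ (f (suc i))))
    (subst (0ℚ ≤_) (sym g0≡) (*-nonNeg 0≤ρ 0≤f0))
  sum≡ : Σ< (suc m) f ≡ f 0 - Σ< m g
  sum≡ = trans (Σ<-first m f) (trans (ident₃ (f 0) (Σ< m (f ∘ suc))) (cong (λ x → f 0 - x) (sym (Σ<-*ˡ m (- 1ℚ) (f ∘ suc)))))
  g0≤ : g 0 ≤ f 0
  g0≤ = ≤-trans (≤-reflexive g0≡) (≤-trans (*-monoˡ 0≤f0 ρ≤1) (≤-reflexive (*-identityˡ (f 0))))
  lower : 0ℚ ≤ Σ< (suc m) f
  lower = subst (0ℚ ≤_) (sym sum≡) (≤⇒0≤- (≤-trans (proj₂ ih) g0≤))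
  upper : Σ< (suc m) f ≤ f 0
  upper = ≤-by (Σ< m g) (trans (ident₄ (f 0) (Σ< m g)) (cong (_+ Σ< m g) (sym sum≡))) (proj₁ ih)
    where
    ident₄ : ∀ a s → a ≡ a - s + s
    ident₄ = solve-∀ ℚ-ring

-- From the index n on, the factor n - ½ - i is negative and smaller in modulus than n + 3/2 + i.
kummer-alternating : ∀ n → Alternating (λ i → kummer n (n ℕ.+ i))
kummer-alternating n i = a * inv d , *-nonNeg 0≤a (<⇒≤ (inv-pos d>0)) ,
  ≤-trans (*-monoˡ (<⇒≤ (inv-pos d>0)) a≤d) (≤-reflexive (inv-* d>0)) ,
  trans (cong (kummer n) (ℕP.+-suc n i)) (trans (cong (λ z → t * (2ℚ * ι n - 1ℚ - 2ℚ * z) * inv d) (ι-+ n i))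
    (ident (ι n) (ι i) t (inv d)))
  where
  t = kummer n (n ℕ.+ i)
  a = 2ℚ * ι i + 1ℚ
  d = 2ℚ * ι n + (2ℚ * ι (n ℕ.+ i) + 1ℚ + 2ℚ)
  d>0 = kummer-den-pos n (n ℕ.+ i)
  0≤a : 0ℚ ≤ a
  0≤a = <⇒≤ (2ι+1-pos i)
  ident : ∀ n i t r → t * (2ℚ * n - 1ℚ - 2ℚ * (n + i)) * r ≡ - ((2ℚ * i + 1ℚ) * r) * t
  ident = solve-∀ ℚ-ring
  ident₂ : ∀ n i → 2ℚ * n + (2ℚ * (n + i) + 1ℚ + 2ℚ) ≡ 2ℚ * i + 1ℚ + (4ℚ * n + 2ℚ)
  ident₂ = solve-∀ ℚ-ring
  a≤d : a ≤ d
  a≤d = ≤-by (4ℚ * ι n + 2ℚ) (trans (cong (λ z → 2ℚ * ι n + (2ℚ * z + 1ℚ + 2ℚ)) (ι-+ n i)) (ident₂ (ι n) (ι i)))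
    (+-nonNeg (*-nonNeg 0≤4 (ι-nonNeg n)) 0≤2)

-- The walk has quotients (n - k - 1)/(n + k + 2), while the Kummer terms have (n - k - ½)/(n + k +
-- 3/2), with a larger numerator and a smaller denominator.
walk-≤-kummer : ∀ n k → k ℕ.≤ n → walk n (suc k) ≤ central n * kummer n k
walk-≤-kummer n zero _ = *-cancelˡ {ι n + 1ℚ} (subst (0ℚ <_) (ι-suc n) (ι-pos n))
  (≤-by (central n) (≡-by₁ (- 1ℚ) (ident (ι n) (central n) (walk n 1))
    (subst (λ x → (ι n + 1ℚ + x) * walk n 1 ≡ (ι n - x) * walk n 0) ι-0 (walk-ratio n 0))) (central-nonNeg n))
  where
  ident : ∀ n c w → (n + 1ℚ) * (c * 1ℚ) ≡ (n + 1ℚ) * w + c + - 1ℚ * ((n + 1ℚ + 0ℚ) * w - (n - 0ℚ) * c)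
  ident = solve-∀ ℚ-ring
walk-≤-kummer n (suc k) k<n = *-cancelˡ (*-pos d>0 (kummer-den-pos n k))
  (≤-by _ (≡-by₂ ((N + 1ℚ + (K + 1ℚ)) * c) (- (2ℚ * N + (2ℚ * K + 1ℚ + 2ℚ)))
      (ident N K (walk n (suc k)) (walk n (suc (suc k))) (kummer n k) (kummer n (suc k)) c)
      (kummer-suc n k) (subst (λ x → (ι n + 1ℚ + x) * walk n (suc (suc k)) ≡ (ι n - x) * walk n (suc k)) (ι-suc k) (walk-ratio n (suc k))))
    (+-nonNeg (*-nonNeg (*-nonNeg (<⇒≤ d>0) m≥0) (≤⇒0≤- (walk-≤-kummer n k (ℕP.<⇒≤ k<n))))
              (*-nonNeg (<⇒≤ (2ι+1-pos n)) (walk-nonNeg n (suc k)))))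
  where
  N = ι n
  K = ι k
  c = central n
  d>0 : 0ℚ < N + 1ℚ + (K + 1ℚ)
  d>0 = subst (0ℚ <_) (trans (ι-+ (suc n) (suc k)) (cong₂ _+_ (ι-suc n) (ι-suc k))) (ι-pos (n ℕ.+ suc k))
  m≥0 : 0ℚ ≤ 2ℚ * N - 1ℚ - 2ℚ * K
  m≥0 = ≤-trans (+-nonNeg 0≤1 (*-nonNeg 0≤2 (≤⇒0≤- (subst (_≤ N) (ι-suc k) (ι-mono k<n))))) (≤-reflexive (id₂ N K))
    where
    id₂ : ∀ n k → 1ℚ + 2ℚ * (n - (k + 1ℚ)) ≡ 2ℚ * n - 1ℚ - 2ℚ * k
    id₂ = solve-∀ ℚ-ring
  ident : ∀ n k w w₁ t t₁ c →
    (n + 1ℚ + (k + 1ℚ)) * (2ℚ * n + (2ℚ * k + 1ℚ + 2ℚ)) * (c * t₁) ≡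
    (n + 1ℚ + (k + 1ℚ)) * (2ℚ * n + (2ℚ * k + 1ℚ + 2ℚ)) * w₁
    + ((n + 1ℚ + (k + 1ℚ)) * (2ℚ * n - 1ℚ - 2ℚ * k) * (c * t - w) + (2ℚ * n + 1ℚ) * w)
    + (n + 1ℚ + (k + 1ℚ)) * c * ((2ℚ * n + (2ℚ * k + 1ℚ + 2ℚ)) * t₁ - (2ℚ * n - 1ℚ - 2ℚ * k) * t)
    + - (2ℚ * n + (2ℚ * k + 1ℚ + 2ℚ)) * ((n + 1ℚ + (k + 1ℚ)) * w₁ - (n - (k + 1ℚ)) * w)
  ident = solve-∀ ℚ-ring

-- The first n terms dominate half a row of Pascal's triangle, whose mass is known from `walk-mass`.
-- The later terms alternate and start with a nonnegative one, so they cannot lower the sum below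
-- that.
kummerSum-lower : ∀ n K → n ℕ.≤ K → ½ * (1ℚ - central n) ≤ central n * kummerSum n K
kummerSum-lower n K n≤K = begin
  ½ * (1ℚ - c)  ≡⟨ ≡-by₁ (- ½) (ident₁ c s) (walk-mass n n ℕP.≤-refl) ⟩
  s  ≤⟨ Σ<-mono n (λ k k<n → walk-≤-kummer n k (ℕP.<⇒≤ k<n)) ⟩
  Σ< n (λ k → c * kummer n k)                                   ≡⟨ Σ<-*ˡ n c (kummer n) ⟩
  c * kummerSum n n  ≤⟨ *-monoʳ (central-nonNeg n) (≤-by tail refl 0≤tail) ⟩
  c * (kummerSum n n + tail)  ≡⟨ cong (_*_ c) (Σ<-split n (K ℕ.∸ n) (kummer n)) ⟨
  c * kummerSum n (n ℕ.+ (K ℕ.∸ n))  ≡⟨ cong (λ x → c * kummerSum n x) (ℕP.m+[n∸m]≡n n≤K) ⟩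
  c * kummerSum n K                                             ∎
  where
  open ≤-Reasoning
  c = central n
  s = Σ< n (λ k → walk n (suc k))
  tail = Σ< (K ℕ.∸ n) (λ i → kummer n (n ℕ.+ i))
  ident₁ : ∀ c s → ½ * (1ℚ - c) ≡ s + - ½ * (c + 2ℚ * s - 1ℚ)
  ident₁ = solve-∀ ℚ-ring
  0≤t : 0ℚ ≤ kummer n (n ℕ.+ 0)
  0≤t = subst (λ x → 0ℚ ≤ kummer n x) (sym (ℕP.+-identityʳ n)) (*-cancelˡ (central-pos n)
    (≤-trans (≤-reflexive (*-zeroʳ c)) (≤-trans (walk-nonNeg n (suc n)) (walk-≤-kummer n n ℕP.≤-refl))))
  0≤tail : 0ℚ ≤ tail
  0≤tail = proj₁ (alternating-sum (K ℕ.∸ n) _ (kummer-alternating n) 0≤t)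

2ι+3-pos : ∀ n → 0ℚ < 2ℚ * ι n + 1ℚ + 2ℚ
2ι+3-pos n = <-≤-trans (2ι+1-pos n) (≤-by 2ℚ refl 0≤2)

/-*ι : ∀ a b → (+ a / suc b) * ι (suc b) ≡ + a / 1
/-*ι a b = trans (cong (_*_ (+ a / suc b)) (ι≡ℕtoℚ (suc b))) (ℚP.toℚᵘ-injective (begin
  ℚ.toℚᵘ ((+ a / suc b) * (+ suc b / 1))               ≈⟨ ℚP.toℚᵘ-homo-* (+ a / suc b) (+ suc b / 1) ⟩
  ℚ.toℚᵘ (+ a / suc b) ℚᵘ.* ℚ.toℚᵘ (+ suc b / 1)       ≈⟨ ℚᵘP.*-cong (ℚP.toℚᵘ-fromℚᵘ (ℚᵘ.mkℚᵘ (+ a) b)) (ℚP.toℚᵘ-fromℚᵘ (ℚᵘ.mkℚᵘ (+ suc b) 0)) ⟩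
  ℚᵘ.mkℚᵘ (+ a) b ℚᵘ.* ℚᵘ.mkℚᵘ (+ suc b) 0             ≈⟨ ℚᵘ.*≡* (trans (ℤP.*-identityʳ (+ a ℤ.* + suc b)) (cong (λ x → + a ℤ.* + suc x) (sym (ℕP.*-identityʳ b)))) ⟩
  ℚᵘ.mkℚᵘ (+ a) 0                                      ≈⟨ ℚP.toℚᵘ-fromℚᵘ (ℚᵘ.mkℚᵘ (+ a) 0) ⟨
  ℚ.toℚᵘ (+ a / 1)                                     ∎))
  where open ℚᵘP.≃-Reasoning

kummer-0 : ∀ k → (2ℚ * ι k + 1ℚ) * kummer 0 k ≡ sgn k
kummer-0 zero = cong (λ x → (2ℚ * x + 1ℚ) * 1ℚ) ι-0
kummer-0 (suc k) = trans (cong (λ x → (2ℚ * x + 1ℚ) * kummer 0 (suc k)) (ι-suc k))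
  (≡-by₂ 1ℚ (- 1ℚ) (ident (ι k) (kummer 0 k) (kummer 0 (suc k)) (sgn k))
    (subst (λ x → (2ℚ * x + (2ℚ * ι k + 1ℚ + 2ℚ)) * kummer 0 (suc k) ≡ (2ℚ * x - 1ℚ - 2ℚ * ι k) * kummer 0 k) ι-0 (kummer-suc 0 k))
    (kummer-0 k))
  where
  ident : ∀ k t t₁ s → (2ℚ * (k + 1ℚ) + 1ℚ) * t₁ ≡ - s
    + 1ℚ * ((2ℚ * 0ℚ + (2ℚ * k + 1ℚ + 2ℚ)) * t₁ - (2ℚ * 0ℚ - 1ℚ - 2ℚ * k) * t)
    + - 1ℚ * ((2ℚ * k + 1ℚ) * t - s)
  ident = solve-∀ ℚ-ring

sgn² : ∀ k → sgn k * sgn k ≡ 1ℚ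
sgn² zero = refl
sgn² (suc k) = trans ([-a]² (sgn k)) (sgn² k)

sgn-even : ∀ j → sgn (2 ℕ.* j) ≡ 1ℚ
sgn-even zero = refl
sgn-even (suc j) = trans (cong sgn (ℕP.*-suc 2 j)) (trans (ident (sgn (2 ℕ.* j))) (sgn-even j))
  where
  ident : ∀ s → - (- s) ≡ s
  ident = solve-∀ ℚ-ring

ι-odd : ∀ k → ι (suc (2 ℕ.* k)) ≡ 2ℚ * ι k + 1ℚ
ι-odd k = trans (ι-suc (2 ℕ.* k)) (cong (_+ 1ℚ) (trans (ι-* 2 k) (cong (_* ι k) (ι≡ℕtoℚ 2))))

leibniz-kummer : ∀ K → leibniz K ≡ 4ℚ * kummerSum 0 K
leibniz-kummer zero = refl
leibniz-kummer (suc k) = trans (cong₂ _+_ (leibniz-kummer k) term) (sym (ℚP.*-distribˡ-+ 4ℚ (kummerSum 0 k) (kummer 0 k)))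
  where
  r = + 4 / suc (2 ℕ.* k)
  ident : ∀ d t r → d * t * r ≡ r * d * t
  ident = solve-∀ ℚ-ring
  term : sgn k * r ≡ 4ℚ * kummer 0 k
  term = trans (cong (_* r) (sym (kummer-0 k))) (trans (ident (2ℚ * ι k + 1ℚ) (kummer 0 k) r)
    (cong (_* kummer 0 k) (trans (cong (_*_ r) (sym (ι-odd k))) (/-*ι 4 (2 ℕ.* k)))))

leibniz-odd-anti : ∀ j i → leibniz (suc (2 ℕ.* (i ℕ.+ j))) ≤ leibniz (suc (2 ℕ.* j))
leibniz-odd-anti j zero = ≤-refl
leibniz-odd-anti j (suc i) = ≤-trans (≤-reflexive (cong (leibniz ∘ suc) (ℕP.*-suc 2 (i ℕ.+ j)))) (≤-trans
  (subst₂ _≤_ (sym (leibniz-kummer (suc (suc k)))) (sym (leibniz-kummer k))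
    (*-monoʳ {4ℚ} {kummerSum 0 (suc (suc k))} {kummerSum 0 k} 0≤4
      (≤-by (- (t + t₁)) (ident (kummerSum 0 k) t t₁) nonneg)))
  (leibniz-odd-anti j i))
  where
  k = suc (2 ℕ.* (i ℕ.+ j))
  t = kummer 0 k
  t₁ = kummer 0 (suc k)
  ident : ∀ e t t₁ → e ≡ e + t + t₁ + - (t + t₁)
  ident = solve-∀ ℚ-ring
  K>0 = 2ι+1-pos k
  sgn≡ : (2ℚ * ι k + 1ℚ) * t ≡ - 1ℚ
  sgn≡ = trans (kummer-0 k) (cong -_ (sgn-even (i ℕ.+ j)))
  sgn≡₁ : (2ℚ * ι (suc k) + 1ℚ) * t₁ ≡ 1ℚ
  sgn≡₁ = trans (kummer-0 (suc k)) (cong (λ x → - (- x)) (sgn-even (i ℕ.+ j)))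
  ident₂ : ∀ k t t₁ → (2ℚ * k + 1ℚ) * (2ℚ * (k + 1ℚ) + 1ℚ) * - (t + t₁) ≡
    (2ℚ * k + 1ℚ) * (2ℚ * (k + 1ℚ) + 1ℚ) * 0ℚ + 2ℚ
    + - (2ℚ * (k + 1ℚ) + 1ℚ) * ((2ℚ * k + 1ℚ) * t - - 1ℚ) + - (2ℚ * k + 1ℚ) * ((2ℚ * (k + 1ℚ) + 1ℚ) * t₁ - 1ℚ)
  ident₂ = solve-∀ ℚ-ring
  nonneg : 0ℚ ≤ - (t + t₁)
  nonneg = *-cancelˡ (*-pos K>0 (2ι+1-pos (suc k))) (≤-by 2ℚ
    (subst (λ x → (2ℚ * ι k + 1ℚ) * (2ℚ * x + 1ℚ) * - (t + t₁) ≡ (2ℚ * ι k + 1ℚ) * (2ℚ * x + 1ℚ) * 0ℚ + 2ℚ) (sym (ι-suc k))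
      (≡-by₂ (- (2ℚ * (ι k + 1ℚ) + 1ℚ)) (- (2ℚ * ι k + 1ℚ)) (ident₂ (ι k) t t₁) sgn≡
        (subst (λ x → (2ℚ * x + 1ℚ) * t₁ ≡ 1ℚ) (ι-suc k) sgn≡₁))) 0≤2)

-- Kummer's theorem with an explicit truncation error

module _ (K : ℕ) where

  -- The modulus of `kummer 0 K`, the first Leibniz term left out (up to the factor 4).
  δ : ℚ
  δ = inv (2ℚ * ι K + 1ℚ)

  δ>0 : 0ℚ < δ
  δ>0 = inv-pos (2ι+1-pos K)

  δ-inv : (2ℚ * ι K + 1ℚ) * δ ≡ 1ℚ
  δ-inv = inv-* (2ι+1-pos K)

  -- The negative of the factor 2n + 1 - 2K of `kummer-shift`, positive because K dominates n.
  lead : ℕ → ℚ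
  lead n = 2ℚ * ι K - 2ℚ * ι n - 1ℚ

  lead-lower : ∀ n → 2 ℕ.* suc n ℕ.≤ K → 2ℚ * ι n + 2ℚ ≤ ι K
  lead-lower n le = subst (_≤ ι K) (trans (ι-* 2 (suc n)) (trans (cong₂ _*_ (ι≡ℕtoℚ 2) (ι-suc n)) (ident (ι n)))) (ι-mono le)
    where
    ident : ∀ n → 2ℚ * (n + 1ℚ) ≡ 2ℚ * n + 2ℚ
    ident = solve-∀ ℚ-ring

  K≤lead : ∀ n → 2 ℕ.* suc n ℕ.≤ K → ι K ≤ lead n
  K≤lead n le = ≤-by (ι K - (2ℚ * ι n + 2ℚ) + 1ℚ) (ident (ι K) (ι n)) (+-nonNeg (≤⇒0≤- (lead-lower n le)) 0≤1)
    where
    ident : ∀ k n → 2ℚ * k - 2ℚ * n - 1ℚ ≡ k + (k - (2ℚ * n + 2ℚ) + 1ℚ)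
    ident = solve-∀ ℚ-ring

  lead-pos : ∀ n → 2 ℕ.* suc n ℕ.≤ K → 0ℚ < lead n
  lead-pos n le = <-≤-trans (2ι+2-pos n) (≤-trans (lead-lower n le) (K≤lead n le))

  -- Squares are compared because the signs alternate: passing from n to n + 1 multiplies the term
  -- by -R/P with 0 < R ≤ P.
  kummer-small : ∀ n → 2 ℕ.* n ℕ.≤ K → kummer n K * kummer n K ≤ δ * δ
  kummer-small zero _ = ≤-reflexive (trans (cong₂ _*_ t≡ t≡)
      (trans (ident₂ (sgn K) δ) (trans (cong (_* (δ * δ)) (sgn² K)) (*-identityˡ (δ * δ)))))
    where
    ident₁ : ∀ d t δ s → t ≡ s * δ + (- t) * (d * δ - 1ℚ) + δ * (d * t - s)
    ident₁ = solve-∀ ℚ-ring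
    ident₂ : ∀ s d → s * d * (s * d) ≡ s * s * (d * d)
    ident₂ = solve-∀ ℚ-ring
    t≡ : kummer 0 K ≡ sgn K * δ
    t≡ = ≡-by₂ (- kummer 0 K) δ (ident₁ (2ℚ * ι K + 1ℚ) (kummer 0 K) δ (sgn K)) δ-inv (kummer-0 K)
  kummer-small (suc n) le = *-cancelˡ (*-pos P>0 P>0) (begin
    P * P * (y * y)         ≡⟨ ident₁ P y ⟩
    - (P * y) * - (P * y)   ≡⟨ cong (λ z → z * z) Py≡ ⟩
    R * x * (R * x)         ≡⟨ ident₂ R x ⟩
    R * R * (x * x)  ≤⟨ *-mono (²-nonNeg R) (²-nonNeg δ) (*-mono (<⇒≤ R>0) (<⇒≤ P>0) R≤P R≤P) (kummer-small n (ℕP.≤-trans (ℕP.*-monoʳ-≤ 2 (ℕP.n≤1+n n)) le)) ⟩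
    P * P * (δ * δ)         ∎)
    where
    open ≤-Reasoning
    x = kummer n K
    y = kummer (suc n) K
    R = (2ℚ * ι n + 1ℚ) * (2ℚ * ι n + 1ℚ + 2ℚ)
    P = lead n * (2ℚ * ι n + (2ℚ * ι K + 1ℚ + 2ℚ))
    P>0 : 0ℚ < P
    P>0 = *-pos (lead-pos n le) (kummer-den-pos n K)
    R>0 : 0ℚ < R
    R>0 = *-pos (2ι+1-pos n) (2ι+3-pos n)
    R≤P : R ≤ P
    R≤P = *-mono (<⇒≤ (2ι+1-pos n)) (<⇒≤ (kummer-den-pos n K))
      (≤-trans (≤-by 1ℚ (id₁ (2ℚ * ι n)) 0≤1) (≤-trans (lead-lower n le) (K≤lead n le)))
      (≤-by (2ℚ * ι K) (id₂ (2ℚ * ι n) (2ℚ * ι K)) (*-nonNeg 0≤2 (ι-nonNeg K)))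
      where
      id₁ : ∀ n → n + 2ℚ ≡ n + 1ℚ + 1ℚ
      id₁ = solve-∀ ℚ-ring
      id₂ : ∀ n k → n + (k + 1ℚ + 2ℚ) ≡ n + 1ℚ + 2ℚ + k
      id₂ = solve-∀ ℚ-ring
    ident₁ : ∀ p y → p * p * (y * y) ≡ - (p * y) * - (p * y)
    ident₁ = solve-∀ ℚ-ring
    ident₂ : ∀ p y → p * y * (p * y) ≡ p * p * (y * y)
    ident₂ = solve-∀ ℚ-ring
    ident₃ : ∀ n k y → - ((2ℚ * k - 2ℚ * n - 1ℚ) * (2ℚ * n + (2ℚ * k + 1ℚ + 2ℚ)) * y) ≡ (2ℚ * n + 1ℚ - 2ℚ * k) * (2ℚ * n + (2ℚ * k + 1ℚ + 2ℚ)) * y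
    ident₃ = solve-∀ ℚ-ring
    Py≡ : - (P * y) ≡ R * x
    Py≡ = trans (ident₃ (ι n) (ι K) y) (kummer-shift n K)

  -- Bounds the boundary term of `kummerSum-suc`. By `kummer-shift` it is -K R x / `lead n` with x =
  -- `kummer n K`, and both x ≤ `δ` and K ≤ `lead n` are known.
  boundary-lower : ∀ n → 2 ℕ.* suc n ℕ.≤ K →
    0ℚ ≤ ι K * (2ℚ * ι n + (2ℚ * ι K + 1ℚ + 2ℚ)) * kummer (suc n) K + (2ℚ * ι n + 1ℚ) * (2ℚ * ι n + 1ℚ + 2ℚ) * δ
  boundary-lower n le = *-cancelˡ (lead-pos n le) (≤-by
    (R * (ι K * (δ - x) + (lead n - ι K) * δ))
    (≡-by₁ (- ι K) (ident (ι n) (ι K) x (kummer (suc n) K) δ) (kummer-shift n K))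
    (*-nonNeg (*-nonNeg (<⇒≤ (2ι+1-pos n)) (<⇒≤ (2ι+3-pos n)))
      (+-nonNeg (*-nonNeg (ι-nonNeg K) (≤⇒0≤- (²-cancel-≤ (<⇒≤ δ>0) (kummer-small n (ℕP.≤-trans (ℕP.*-monoʳ-≤ 2 (ℕP.n≤1+n n)) le)))))
        (*-nonNeg (≤⇒0≤- (K≤lead n le)) (<⇒≤ δ>0)))))
    where
    x = kummer n K
    R = (2ℚ * ι n + 1ℚ) * (2ℚ * ι n + 1ℚ + 2ℚ)
    ident : ∀ n k x y δ →
      (2ℚ * k - 2ℚ * n - 1ℚ) * (k * (2ℚ * n + (2ℚ * k + 1ℚ + 2ℚ)) * y + (2ℚ * n + 1ℚ) * (2ℚ * n + 1ℚ + 2ℚ) * δ) ≡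
      (2ℚ * k - 2ℚ * n - 1ℚ) * 0ℚ
      + ((2ℚ * n + 1ℚ) * (2ℚ * n + 1ℚ + 2ℚ)) * (k * (δ - x) + (2ℚ * k - 2ℚ * n - 1ℚ - k) * δ)
      + - k * ((2ℚ * n + 1ℚ - 2ℚ * k) * (2ℚ * n + (2ℚ * k + 1ℚ + 2ℚ)) * y - (2ℚ * n + 1ℚ) * (2ℚ * n + 1ℚ + 2ℚ) * x)
    ident = solve-∀ ℚ-ring

  -- The product of (2i + 3)/(2i + 2) over i < n, accumulated by iterating `kummerSum-suc`.
  -- Multiplied by `central n` it is `wallis n`, which is how Wallis's product enters.
  scale : ℕ → ℚ
  scale n = (2ℚ * ι n + 1ℚ) * central n

  scale-suc : ∀ n → (2ℚ * ι n + 2ℚ) * scale (suc n) ≡ (2ℚ * ι n + 1ℚ + 2ℚ) * scale n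
  scale-suc n = trans (cong (λ x → (2ℚ * ι n + 2ℚ) * ((2ℚ * x + 1ℚ) * central (suc n))) (ι-suc n))
    (≡-by₁ (2ℚ * (ι n + 1ℚ) + 1ℚ) (ident (ι n) (central n) (central (suc n))) (central-suc n))
    where
    ident : ∀ n c c′ → (2ℚ * n + 2ℚ) * ((2ℚ * (n + 1ℚ) + 1ℚ) * c′) ≡ (2ℚ * n + 1ℚ + 2ℚ) * ((2ℚ * n + 1ℚ) * c)
      + (2ℚ * (n + 1ℚ) + 1ℚ) * ((2ℚ * n + 2ℚ) * c′ - (2ℚ * n + 1ℚ) * c)
    ident = solve-∀ ℚ-ring

  scale-0 : scale 0 ≡ 1ℚ
  scale-0 = cong (λ x → (2ℚ * x + 1ℚ) * 1ℚ) ι-0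

  scale≥1 : ∀ n → 1ℚ ≤ scale n
  scale≥1 zero = ≤-reflexive (sym scale-0)
  scale≥1 (suc n) = ≤-trans (scale≥1 n) (*-cancelˡ (2ι+2-pos n)
    (≤-by (scale n) (trans (scale-suc n) (ident (ι n) (scale n))) (≤-trans 0≤1 (scale≥1 n))))
    where
    ident : ∀ n s → (2ℚ * n + 1ℚ + 2ℚ) * s ≡ (2ℚ * n + 2ℚ) * s + s
    ident = solve-∀ ℚ-ring

  -- Each telescoping step costs at most one `δ` in the first factor, because `scale` never falls
  -- below 1.
  kummerSum-upper : ∀ n → 2 ℕ.* n ℕ.≤ K → kummerSum n K ≤ (kummerSum 0 K + ι n * δ) * scale n
  kummerSum-upper zero _ = ≤-reflexive (sym (trans (cong₂ (λ x y → (kummerSum 0 K + x * δ) * y) ι-0 scale-0) (ident (kummerSum 0 K) δ)))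
    where
    ident : ∀ e d → (e + 0ℚ * d) * 1ℚ ≡ e
    ident = solve-∀ ℚ-ring
  kummerSum-upper (suc n) le = *-cancelˡ (*-pos (2ι+1-pos n) (2ι+2-pos n)) (≤-by
    (((2ℚ * N + 1ℚ) * (2ℚ * N + 1ℚ + 2ℚ)) * ((E₀ + N * δ) * s - E + δ * (s - 1ℚ))
      + (ι K * (2ℚ * N + (2ℚ * ι K + 1ℚ + 2ℚ)) * kummer (suc n) K + (2ℚ * N + 1ℚ) * (2ℚ * N + 1ℚ + 2ℚ) * δ))
    (trans (cong (λ x → (2ℚ * N + 1ℚ) * (2ℚ * N + 2ℚ) * ((E₀ + x * δ) * s′)) (ι-suc n))
      (≡-by₂ ((2ℚ * N + 1ℚ) * (E₀ + (N + 1ℚ) * δ)) 1ℚ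
       (ident N E₀ δ s s′ E E′ (ι K * (2ℚ * N + (2ℚ * ι K + 1ℚ + 2ℚ)) * kummer (suc n) K)) (scale-suc n) (kummerSum-suc n K)))
    (+-nonNeg (*-nonNeg (*-nonNeg (<⇒≤ (2ι+1-pos n)) (<⇒≤ (2ι+3-pos n)))
       (+-nonNeg (≤⇒0≤- (kummerSum-upper n (ℕP.≤-trans (ℕP.*-monoʳ-≤ 2 (ℕP.n≤1+n n)) le)))
                 (*-nonNeg (<⇒≤ δ>0) (≤⇒0≤- (scale≥1 n)))))
      (boundary-lower n le)))
    where
    N = ι n
    E₀ = kummerSum 0 K
    E = kummerSum n K
    E′ = kummerSum (suc n) K
    s = scale n
    s′ = scale (suc n)
    ident : ∀ n e₀ δ s s′ e e′ z →
      (2ℚ * n + 1ℚ) * (2ℚ * n + 2ℚ) * ((e₀ + (n + 1ℚ) * δ) * s′) ≡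
      (2ℚ * n + 1ℚ) * (2ℚ * n + 2ℚ) * e′
      + (((2ℚ * n + 1ℚ) * (2ℚ * n + 1ℚ + 2ℚ)) * ((e₀ + n * δ) * s - e + δ * (s - 1ℚ))
        + (z + (2ℚ * n + 1ℚ) * (2ℚ * n + 1ℚ + 2ℚ) * δ))
      + (2ℚ * n + 1ℚ) * (e₀ + (n + 1ℚ) * δ) * ((2ℚ * n + 2ℚ) * s′ - (2ℚ * n + 1ℚ + 2ℚ) * s)
      + 1ℚ * ((2ℚ * n + 1ℚ) * (2ℚ * n + 1ℚ + 2ℚ) * e - ((2ℚ * n + 1ℚ) * (2ℚ * n + 2ℚ) * e′ + z))
    ident = solve-∀ ℚ-ring

  -- As K grows it becomes 2 (1 - `central n`) ≤ π `wallis n`, the half of Wallis's formula that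
  -- bounds the mean of |sin| from below.
  wallis-≤-leibniz : ∀ n → 2 ℕ.* n ℕ.≤ K → 2ℚ * (1ℚ - central n) ≤ (leibniz K + 4ℚ * ι n * δ) * wallis n
  wallis-≤-leibniz n le = begin
    2ℚ * (1ℚ - c)                                        ≡⟨ id₁ c ⟩
    4ℚ * (½ * (1ℚ - c))  ≤⟨ *-monoʳ 0≤4 (kummerSum-lower n K (ℕP.≤-trans (ℕP.m≤m+n n (n ℕ.+ 0)) le)) ⟩
    4ℚ * (c * kummerSum n K)  ≤⟨ *-monoʳ 0≤4 (*-monoʳ (central-nonNeg n) (kummerSum-upper n le)) ⟩
    4ℚ * (c * ((kummerSum 0 K + ι n * δ) * scale n))     ≡⟨ id₂ (kummerSum 0 K) (ι n) δ c ⟩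
    (4ℚ * kummerSum 0 K + 4ℚ * ι n * δ) * wallis n  ≡⟨ cong (λ x → (x + 4ℚ * ι n * δ) * wallis n) (leibniz-kummer K) ⟨
    (leibniz K + 4ℚ * ι n * δ) * wallis n                ∎
    where
    open ≤-Reasoning
    c = central n
    id₁ : ∀ c → 2ℚ * (1ℚ - c) ≡ 4ℚ * (½ * (1ℚ - c))
    id₁ = solve-∀ ℚ-ring
    id₂ : ∀ e n δ c → 4ℚ * (c * ((e + n * δ) * ((2ℚ * n + 1ℚ) * c))) ≡ (4ℚ * e + 4ℚ * n * δ) * ((2ℚ * n + 1ℚ) * (c * c))
    id₂ = solve-∀ ℚ-ring

wallis-nonNeg : ∀ n → 0ℚ ≤ wallis n
wallis-nonNeg n = *-nonNeg (<⇒≤ (2ι+1-pos n)) (²-nonNeg (central n))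

PiUpper⇒wallis : ∀ {A} → PiUpper A → ∀ n → 2ℚ * (1ℚ - central n) ≤ A * wallis n
PiUpper⇒wallis {A} (j , L<A) n = ≤-trans (wallis-≤-leibniz K n 2n≤K) (*-monoˡ (wallis-nonNeg n) (begin
    leibniz K + 4ℚ * ι n * δ K  ≤⟨ +-mono-≤ (leibniz-odd-anti j (n ℕ.+ M)) (*-cancelˡ (2ι+1-pos K) err) ⟩
    leibniz (suc (2 ℕ.* j)) + gap     ≡⟨ a≡b+[a-b] A (leibniz (suc (2 ℕ.* j))) ⟨
    A                                 ∎))
  where
  open ≤-Reasoning
  gap = A - leibniz (suc (2 ℕ.* j))
  gap>0 : 0ℚ < gap
  gap>0 = <⇒0<- L<A
  arch = archimedes-* (4ℚ * ι n) gap>0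
  M = proj₁ arch
  -- Makes K odd and past the index of the hypothesis, at least 2n, and so large that the error 4nδ
  -- fits into the gap below A.
  j′ = n ℕ.+ M ℕ.+ j
  K = suc (2 ℕ.* j′)
  n+M≤j′ : n ℕ.+ M ℕ.≤ j′
  n+M≤j′ = ℕP.m≤m+n (n ℕ.+ M) j
  2n≤K : 2 ℕ.* n ℕ.≤ K
  2n≤K = ℕP.≤-trans (ℕP.*-monoʳ-≤ 2 (ℕP.≤-trans (ℕP.m≤m+n n M) n+M≤j′)) (ℕP.n≤1+n (2 ℕ.* j′))
  M<K : suc M ℕ.≤ K
  M<K = ℕ.s≤s (ℕP.≤-trans (ℕP.≤-trans (ℕP.m≤n+m M n) n+M≤j′) (ℕP.m≤m+n j′ (j′ ℕ.+ 0)))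
  id₁ : ∀ d δ x → d * (x * δ) ≡ x + x * (d * δ - 1ℚ)
  id₁ = solve-∀ ℚ-ring
  id₂ : ∀ g k → (2ℚ * k + 1ℚ) * g ≡ g * k + g * (k + 1ℚ)
  id₂ = solve-∀ ℚ-ring
  err : (2ℚ * ι K + 1ℚ) * (4ℚ * ι n * δ K) ≤ (2ℚ * ι K + 1ℚ) * gap
  err = begin
    (2ℚ * ι K + 1ℚ) * (4ℚ * ι n * δ K)  ≡⟨ ≡-by₁ (4ℚ * ι n) (id₁ (2ℚ * ι K + 1ℚ) (δ K) (4ℚ * ι n)) (δ-inv K) ⟩
    4ℚ * ι n                              ≤⟨ proj₂ arch ⟩
    gap * ι (suc M)                       ≤⟨ *-monoʳ (<⇒≤ gap>0) (ι-mono M<K) ⟩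
    gap * ι K  ≤⟨ ≤-by (gap * (ι K + 1ℚ)) (id₂ gap (ι K)) (*-nonNeg (<⇒≤ gap>0) (+-nonNeg (ι-nonNeg K) 0≤1)) ⟩
    (2ℚ * ι K + 1ℚ) * gap                 ∎

-- Rational rotations of the plane

record ℂ : Set where
  constructor _+𝐢_
  field
    re im : ℚ

open ℂ public

infixl 7 _*ᶜ_
infixl 6 _+ᶜ_ _-ᶜ_ _+𝐢_
infixr 8 _^ᶜ_

1ᶜ : ℂ
1ᶜ = 1ℚ +𝐢 0ℚ

_+ᶜ_ _-ᶜ_ _*ᶜ_ : ℂ → ℂ → ℂ
x +ᶜ y = (re x + re y) +𝐢 (im x + im y)
x -ᶜ y = (re x - re y) +𝐢 (im x - im y)
x *ᶜ y = (re x * re y - im x * im y) +𝐢 (re x * im y + im x * re y)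

conj : ℂ → ℂ
conj x = re x +𝐢 (- im x)

∣_∣² : ℂ → ℚ
∣ x ∣² = re x * re x + im x * im x

_^ᶜ_ : ℂ → ℕ → ℂ
x ^ᶜ zero = 1ᶜ
x ^ᶜ suc k = x ^ᶜ k *ᶜ x

*ᶜ-comm : ∀ x y → x *ᶜ y ≡ y *ᶜ x
*ᶜ-comm (a +𝐢 b) (c +𝐢 d) = cong₂ _+𝐢_ (r a b c d) (i a b c d)
  where
  r : ∀ a b c d → a * c - b * d ≡ c * a - d * b
  r = solve-∀ ℚ-ring
  i : ∀ a b c d → a * d + b * c ≡ c * b + d * a
  i = solve-∀ ℚ-ring

*ᶜ-assoc : ∀ x y z → x *ᶜ y *ᶜ z ≡ x *ᶜ (y *ᶜ z)
*ᶜ-assoc (a +𝐢 b) (c +𝐢 d) (e +𝐢 f) = cong₂ _+𝐢_ (r a b c d e f) (i a b c d e f)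
  where
  r : ∀ a b c d e f → (a * c - b * d) * e - (a * d + b * c) * f ≡ a * (c * e - d * f) - b * (c * f + d * e)
  r = solve-∀ ℚ-ring
  i : ∀ a b c d e f → (a * c - b * d) * f + (a * d + b * c) * e ≡ a * (c * f + d * e) + b * (c * e - d * f)
  i = solve-∀ ℚ-ring

*ᶜ-identityʳ : ∀ x → x *ᶜ 1ᶜ ≡ x
*ᶜ-identityʳ (a +𝐢 b) = cong₂ _+𝐢_ (r a b) (i a b)
  where
  r : ∀ a b → a * 1ℚ - b * 0ℚ ≡ a
  r = solve-∀ ℚ-ring
  i : ∀ a b → a * 0ℚ + b * 1ℚ ≡ b
  i = solve-∀ ℚ-ring

*ᶜ-identityˡ : ∀ x → 1ᶜ *ᶜ x ≡ x
*ᶜ-identityˡ x = trans (*ᶜ-comm 1ᶜ x) (*ᶜ-identityʳ x)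

*ᶜ-interchange : ∀ a b c d → (a *ᶜ b) *ᶜ (c *ᶜ d) ≡ (a *ᶜ c) *ᶜ (b *ᶜ d)
*ᶜ-interchange a b c d = begin
  (a *ᶜ b) *ᶜ (c *ᶜ d)   ≡⟨ *ᶜ-assoc a b (c *ᶜ d) ⟩
  a *ᶜ (b *ᶜ (c *ᶜ d))   ≡⟨ cong (a *ᶜ_) (*ᶜ-assoc b c d) ⟨
  a *ᶜ (b *ᶜ c *ᶜ d)     ≡⟨ cong (λ x → a *ᶜ (x *ᶜ d)) (*ᶜ-comm b c) ⟩
  a *ᶜ (c *ᶜ b *ᶜ d)     ≡⟨ cong (a *ᶜ_) (*ᶜ-assoc c b d) ⟩
  a *ᶜ (c *ᶜ (b *ᶜ d))   ≡⟨ *ᶜ-assoc a c (b *ᶜ d) ⟨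
  (a *ᶜ c) *ᶜ (b *ᶜ d)   ∎
  where open ≡-Reasoning

^ᶜ-+ : ∀ x m n → x ^ᶜ (m ℕ.+ n) ≡ x ^ᶜ m *ᶜ x ^ᶜ n
^ᶜ-+ x zero n = sym (*ᶜ-identityˡ (x ^ᶜ n))
^ᶜ-+ x (suc m) n = begin
  x ^ᶜ (m ℕ.+ n) *ᶜ x      ≡⟨ cong (_*ᶜ x) (^ᶜ-+ x m n) ⟩
  x ^ᶜ m *ᶜ x ^ᶜ n *ᶜ x    ≡⟨ *ᶜ-assoc (x ^ᶜ m) (x ^ᶜ n) x ⟩
  x ^ᶜ m *ᶜ (x ^ᶜ n *ᶜ x)  ≡⟨ cong (x ^ᶜ m *ᶜ_) (*ᶜ-comm (x ^ᶜ n) x) ⟩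
  x ^ᶜ m *ᶜ (x *ᶜ x ^ᶜ n)  ≡⟨ *ᶜ-assoc (x ^ᶜ m) x (x ^ᶜ n) ⟨
  x ^ᶜ m *ᶜ x *ᶜ x ^ᶜ n    ∎
  where open ≡-Reasoning

^ᶜ-* : ∀ x m n → x ^ᶜ (n ℕ.* m) ≡ (x ^ᶜ m) ^ᶜ n
^ᶜ-* x m zero = refl
^ᶜ-* x m (suc n) = trans (^ᶜ-+ x m (n ℕ.* m))
  (trans (*ᶜ-comm (x ^ᶜ m) (x ^ᶜ (n ℕ.* m))) (cong (_*ᶜ x ^ᶜ m) (^ᶜ-* x m n)))

*ᶜ-^ᶜ : ∀ x y n → (x *ᶜ y) ^ᶜ n ≡ x ^ᶜ n *ᶜ y ^ᶜ n
*ᶜ-^ᶜ x y zero = refl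
*ᶜ-^ᶜ x y (suc n) = trans (cong (_*ᶜ (x *ᶜ y)) (*ᶜ-^ᶜ x y n)) (*ᶜ-interchange (x ^ᶜ n) (y ^ᶜ n) x y)

1ᶜ-^ᶜ : ∀ n → 1ᶜ ^ᶜ n ≡ 1ᶜ
1ᶜ-^ᶜ zero = refl
1ᶜ-^ᶜ (suc n) = trans (*ᶜ-identityʳ (1ᶜ ^ᶜ n)) (1ᶜ-^ᶜ n)

conj-* : ∀ x y → conj (x *ᶜ y) ≡ conj x *ᶜ conj y
conj-* (a +𝐢 b) (c +𝐢 d) = cong₂ _+𝐢_ (r a b c d) (i a b c d)
  where
  r : ∀ a b c d → a * c - b * d ≡ a * c - - b * - d
  r = solve-∀ ℚ-ring
  i : ∀ a b c d → - (a * d + b * c) ≡ a * - d + - b * c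
  i = solve-∀ ℚ-ring

conj-^ᶜ : ∀ x n → conj (x ^ᶜ n) ≡ conj x ^ᶜ n
conj-^ᶜ x zero = refl
conj-^ᶜ x (suc n) = trans (conj-* (x ^ᶜ n) x) (cong (_*ᶜ conj x) (conj-^ᶜ x n))

∣∣²-nonNeg : ∀ x → 0ℚ ≤ ∣ x ∣²
∣∣²-nonNeg x = +-nonNeg (²-nonNeg (re x)) (²-nonNeg (im x))

∣∣²-* : ∀ x y → ∣ x *ᶜ y ∣² ≡ ∣ x ∣² * ∣ y ∣²
∣∣²-* (a +𝐢 b) (c +𝐢 d) = ident a b c d
  where
  ident : ∀ a b c d → (a * c - b * d) * (a * c - b * d) + (a * d + b * c) * (a * d + b * c)
    ≡ (a * a + b * b) * (c * c + d * d)
  ident = solve-∀ ℚ-ring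

∣∣²-conj : ∀ x → ∣ conj x ∣² ≡ ∣ x ∣²
∣∣²-conj (a +𝐢 b) = cong (_+_ (a * a)) ([-a]² b)

∣∣²-^ᶜ : ∀ {x} n → ∣ x ∣² ≡ 1ℚ → ∣ x ^ᶜ n ∣² ≡ 1ℚ
∣∣²-^ᶜ zero unit = refl
∣∣²-^ᶜ {x} (suc n) unit = trans (∣∣²-* (x ^ᶜ n) x) (cong₂ _*_ (∣∣²-^ᶜ n unit) unit)

*ᶜ-conj : ∀ {x} → ∣ x ∣² ≡ 1ℚ → x *ᶜ conj x ≡ 1ᶜ
*ᶜ-conj {a +𝐢 b} unit = cong₂ _+𝐢_ (trans (r a b) unit) (i a b)
  where
  r : ∀ a b → a * a - b * - b ≡ a * a + b * b
  r = solve-∀ ℚ-ring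
  i : ∀ a b → a * - b + b * a ≡ 0ℚ
  i = solve-∀ ℚ-ring

re≤ : ∀ x {r} → 0ℚ ≤ r → ∣ x ∣² ≤ r * r → re x ≤ r
re≤ x 0≤r le = ²-cancel-≤ 0≤r (≤-trans (≤-by (im x * im x) refl (²-nonNeg (im x))) le)

im≤ : ∀ x {r} → 0ℚ ≤ r → ∣ x ∣² ≤ r * r → im x ≤ r
im≤ x 0≤r le = ²-cancel-≤ 0≤r (≤-trans (≤-by (re x * re x) (ℚP.+-comm (re x * re x) (im x * im x)) (²-nonNeg (re x))) le)

re-*≤ : ∀ x y {r s} → 0ℚ ≤ r → 0ℚ ≤ s → ∣ x ∣² ≤ r * r → ∣ y ∣² ≤ s * s → re (x *ᶜ y) ≤ r * s
re-*≤ x y {r} {s} 0≤r 0≤s hx hy = re≤ (x *ᶜ y) (*-nonNeg 0≤r 0≤s) (begin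
  ∣ x *ᶜ y ∣²        ≡⟨ ∣∣²-* x y ⟩
  ∣ x ∣² * ∣ y ∣²    ≤⟨ *-mono (∣∣²-nonNeg x) (²-nonNeg s) hx hy ⟩
  r * r * (s * s)    ≡⟨ ident r s ⟩
  r * s * (r * s)    ∎)
  where
  open ≤-Reasoning
  ident : ∀ r s → r * r * (s * s) ≡ r * s * (r * s)
  ident = solve-∀ ℚ-ring

∣∣²-triangle : ∀ x y {r s} → 0ℚ ≤ r → 0ℚ ≤ s → ∣ x ∣² ≤ r * r → ∣ y ∣² ≤ s * s →
  ∣ x +ᶜ y ∣² ≤ (r + s) * (r + s)
∣∣²-triangle x y {r} {s} 0≤r 0≤s hx hy = ≤-by
  ((r * r - ∣ x ∣²) + (s * s - ∣ y ∣²) + 2ℚ * (r * s - re (x *ᶜ conj y)))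
  (ident (re x) (im x) (re y) (im y) r s)
  (+-nonNeg (+-nonNeg (≤⇒0≤- hx) (≤⇒0≤- hy)) (*-nonNeg 0≤2 (≤⇒0≤-
    (re-*≤ x (conj y) 0≤r 0≤s hx (≤-trans (≤-reflexive (∣∣²-conj y)) hy)))))
  where
  ident : ∀ a b c d r s → (r + s) * (r + s) ≡ (a + c) * (a + c) + (b + d) * (b + d)
    + ((r * r - (a * a + b * b)) + (s * s - (c * c + d * d)) + 2ℚ * (r * s - (a * c - b * - d)))
  ident = solve-∀ ℚ-ring

Σᶜ< : ℕ → (ℕ → ℂ) → ℂ
Σᶜ< n f = Σ< n (re ∘ f) +𝐢 Σ< n (im ∘ f)

geometric : ∀ w k → (w -ᶜ 1ᶜ) *ᶜ Σᶜ< k (w ^ᶜ_) ≡ w ^ᶜ k -ᶜ 1ᶜ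
geometric (a +𝐢 b) zero = cong₂ _+𝐢_ (r a b) (i a b)
  where
  r : ∀ a b → (a - 1ℚ) * 0ℚ - (b - 0ℚ) * 0ℚ ≡ 1ℚ - 1ℚ
  r = solve-∀ ℚ-ring
  i : ∀ a b → (a - 1ℚ) * 0ℚ + (b - 0ℚ) * 0ℚ ≡ 0ℚ - 0ℚ
  i = solve-∀ ℚ-ring
geometric w@(a +𝐢 b) (suc k) = cong₂ _+𝐢_
  (≡-by₁ 1ℚ (r a b (re S) (im S) (re p) (im p)) (cong re (geometric w k)))
  (≡-by₁ 1ℚ (i a b (re S) (im S) (re p) (im p)) (cong im (geometric w k)))
  where
  S = Σᶜ< k (w ^ᶜ_)
  p = w ^ᶜ k
  r : ∀ a b s t p q → (a - 1ℚ) * (s + p) - (b - 0ℚ) * (t + q) ≡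
    p * a - q * b - 1ℚ + 1ℚ * ((a - 1ℚ) * s - (b - 0ℚ) * t - (p - 1ℚ))
  r = solve-∀ ℚ-ring
  i : ∀ a b s t p q → (a - 1ℚ) * (t + q) + (b - 0ℚ) * (s + p) ≡
    p * b + q * a - 0ℚ + 1ℚ * ((a - 1ℚ) * t + (b - 0ℚ) * s - (q - 0ℚ))
  i = solve-∀ ℚ-ring

∣Σᶜ∣²≤ : ∀ {f} k → (∀ i → ∣ f i ∣² ≡ 1ℚ) → ∣ Σᶜ< k f ∣² ≤ ι k * ι k
∣Σᶜ∣²≤ zero unit = subst (λ x → 0ℚ ≤ x * x) (sym ι-0) ≤-refl
∣Σᶜ∣²≤ {f} (suc k) unit = subst (λ x → ∣ Σᶜ< (suc k) f ∣² ≤ x * x) (sym (ι-suc k))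
  (∣∣²-triangle (Σᶜ< k f) (f k) (ι-nonNeg k) 0≤1 (∣Σᶜ∣²≤ k unit) (≤-reflexive (trans (unit k) refl)))

∣^-1∣²≤ : ∀ {w} k → ∣ w ∣² ≡ 1ℚ → ∣ w ^ᶜ k -ᶜ 1ᶜ ∣² ≤ ι k * ι k * ∣ w -ᶜ 1ᶜ ∣²
∣^-1∣²≤ {w} k unit = begin
  ∣ w ^ᶜ k -ᶜ 1ᶜ ∣²                            ≡⟨ cong ∣_∣² (geometric w k) ⟨
  ∣ (w -ᶜ 1ᶜ) *ᶜ Σᶜ< k (w ^ᶜ_) ∣²              ≡⟨ ∣∣²-* (w -ᶜ 1ᶜ) (Σᶜ< k (w ^ᶜ_)) ⟩
  ∣ w -ᶜ 1ᶜ ∣² * ∣ Σᶜ< k (w ^ᶜ_) ∣²  ≤⟨ *-monoʳ (∣∣²-nonNeg (w -ᶜ 1ᶜ)) (∣Σᶜ∣²≤ k (λ i → ∣∣²-^ᶜ i unit)) ⟩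
  ∣ w -ᶜ 1ᶜ ∣² * (ι k * ι k)                   ≡⟨ ℚP.*-comm ∣ w -ᶜ 1ᶜ ∣² (ι k * ι k) ⟩
  ι k * ι k * ∣ w -ᶜ 1ᶜ ∣²                     ∎
  where open ≤-Reasoning

∣-1∣² : ∀ {w} → ∣ w ∣² ≡ 1ℚ → ∣ w -ᶜ 1ᶜ ∣² ≡ 2ℚ - 2ℚ * re w
∣-1∣² {a +𝐢 b} unit = ≡-by₁ 1ℚ (ident a b) unit
  where
  ident : ∀ a b → (a - 1ℚ) * (a - 1ℚ) + (b - 0ℚ) * (b - 0ℚ) ≡ 2ℚ - 2ℚ * a + 1ℚ * (a * a + b * b - 1ℚ)
  ident = solve-∀ ℚ-ring

-- A rational rotation z by a small angle, with q + 1 steps to a quarter turn.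
record Rotation (ε : ℚ) : Set where
  field
    z          : ℂ
    unit       : ∣ z ∣² ≡ 1ℚ
    q          : ℕ
    small      : ∣ z -ᶜ 1ᶜ ∣² ≤ ε * ε
    nontrivial : 0ℚ < ∣ z -ᶜ 1ᶜ ∣²
    0≤im-z     : 0ℚ ≤ im z
    0≤re-z     : 0ℚ ≤ re z
    0≤re-^     : ∀ i → i ℕ.≤ q → 0ℚ ≤ re (z ^ᶜ i)
    0≤im-^     : ∀ i → i ℕ.≤ suc q → 0ℚ ≤ im (z ^ᶜ i)
    re-^≤      : ∀ i → i ℕ.≤ q → re (z ^ᶜ suc i) ≤ re z
    turned     : re (z ^ᶜ suc q) ≤ 0ℚ

module FirstQuadrant (c s : ℚ) (0<c : 0ℚ < c) (0<s : 0ℚ < s) (unit : c * c + s * s ≡ 1ℚ) where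

  C S : ℕ → ℚ
  C k = re ((c +𝐢 s) ^ᶜ k)
  S k = im ((c +𝐢 s) ^ᶜ k)

  Positive : ℕ → Set
  Positive k = ∀ i → i ℕ.< k → 0ℚ < C i

  search : ∀ k → Positive k ⊎ (∃ λ Q → Positive Q × C Q ≤ 0ℚ)
  search zero = inj₁ (λ i ())
  search (suc k) with search k
  ... | inj₂ found = inj₂ found
  ... | inj₁ pos with C k ℚP.≤? 0ℚ
  ...   | yes p = inj₂ (k , pos , p)
  ...   | no ¬p = inj₁ pos′
    where
    pos′ : Positive (suc k)
    pos′ i (ℕ.s≤s i≤k) with ℕP.m≤n⇒m<n∨m≡n i≤k
    ... | inj₁ i<k = pos i i<k
    ... | inj₂ refl = ≰⇒> ¬p

  c≤1 : c ≤ 1ℚ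
  c≤1 = ²-cancel-≤ 0≤1 (≤-by (s * s) (sym unit) (²-nonNeg s))

  S-nonNeg : ∀ {k} → Positive k → ∀ i → i ℕ.≤ k → 0ℚ ≤ S i
  S-nonNeg pos zero _ = ≤-refl
  S-nonNeg pos (suc i) i<k = +-nonNeg (*-nonNeg (<⇒≤ (pos i i<k)) (<⇒≤ 0<s))
    (*-nonNeg (S-nonNeg pos i (ℕP.<⇒≤ i<k)) (<⇒≤ 0<c))

  C-anti : ∀ {k} → Positive k → ∀ i → i ℕ.< k → C (suc i) ≤ C i
  C-anti pos i i<k = ≤-by (C i * (1ℚ - c) + S i * s) (ident (C i) (S i) c s)
    (+-nonNeg (*-nonNeg (<⇒≤ (pos i i<k)) (≤⇒0≤- c≤1)) (*-nonNeg (S-nonNeg pos i (ℕP.<⇒≤ i<k)) (<⇒≤ 0<s)))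
    where
    ident : ∀ x y c s → x ≡ x * c - y * s + (x * (1ℚ - c) + y * s)
    ident = solve-∀ ℚ-ring

  C≤c : ∀ {k} → Positive k → ∀ i → i ℕ.< k → C (suc i) ≤ c
  C≤c pos zero _ = ≤-reflexive (ident c s)
    where
    ident : ∀ c s → 1ℚ * c - 0ℚ * s ≡ c
    ident = solve-∀ ℚ-ring
  C≤c pos (suc i) i<k = ≤-trans (C-anti pos (suc i) i<k) (C≤c pos i (ℕP.<⇒≤ i<k))

  s≤S : ∀ {k} → Positive k → ∀ i → suc i ℕ.< k → s ≤ S (suc i)
  s≤S pos i i<k = ²-cancel-≤ (S-nonNeg pos (suc i) (ℕP.<⇒≤ i<k)) (≤-by (c * c - x * x)
    (≡-by₂ 1ℚ (- 1ℚ) (ident x (S (suc i)) c s) (∣∣²-^ᶜ {c +𝐢 s} (suc i) unit) unit)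
    (≤⇒0≤- (*-mono (<⇒≤ (pos (suc i) i<k)) (<⇒≤ 0<c) (C≤c pos i (ℕP.<⇒≤ i<k)) (C≤c pos i (ℕP.<⇒≤ i<k)))))
    where
    x = C (suc i)
    ident : ∀ x y c s → y * y ≡ s * s + (c * c - x * x) + 1ℚ * (x * x + y * y - 1ℚ) + - 1ℚ * (c * c + s * s - 1ℚ)
    ident = solve-∀ ℚ-ring

  -- While the cosine stays positive the sine is at least s after the first step, so each further
  -- step lowers the cosine by at least s². Hence the search for a nonpositive cosine ends.
  C-linear : ∀ {k} → Positive k → ∀ i → i ℕ.< k → C (suc i) ≤ 1ℚ - s * s * ι i
  C-linear pos zero i<k = ≤-trans (C≤c pos zero i<k) (≤-trans c≤1
    (≤-reflexive (sym (trans (cong (λ x → 1ℚ - s * s * x) ι-0) (ident s)))))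
    where
    ident : ∀ s → 1ℚ - s * s * 0ℚ ≡ 1ℚ
    ident = solve-∀ ℚ-ring
  C-linear pos (suc i) i<k = ≤-by
    ((1ℚ - s * s * ι i - x) + (x * (1ℚ - c) + (y - s) * s))
    (trans (cong (λ n → 1ℚ - s * s * n) (ι-suc i)) (ident x y c s (ι i)))
    (+-nonNeg (≤⇒0≤- (C-linear pos i (ℕP.<⇒≤ i<k)))
      (+-nonNeg (*-nonNeg (<⇒≤ (pos (suc i) i<k)) (≤⇒0≤- c≤1)) (*-nonNeg (≤⇒0≤- (s≤S pos i i<k)) (<⇒≤ 0<s))))
    where
    x = C (suc i)
    y = S (suc i)
    ident : ∀ x y c s n → 1ℚ - s * s * (n + 1ℚ) ≡ x * c - y * s + ((1ℚ - s * s * n - x) + (x * (1ℚ - c) + (y - s) * s))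
    ident = solve-∀ ℚ-ring

  first : ∃ λ Q → Positive Q × C Q ≤ 0ℚ
  first with archimedes-* 1ℚ (*-pos 0<s 0<s)
  ... | n , 1≤ with search (suc (suc (suc n)))
  ...   | inj₂ found = found
  ...   | inj₁ pos = contradiction (pos (suc (suc n)) ℕP.≤-refl) (≤⇒≯ (≤-trans (C-linear pos (suc n) (ℕP.n≤1+n _))
            (≤-by (s * s * ι (suc n) - 1ℚ) (ident (s * s * ι (suc n))) (≤⇒0≤- 1≤))))
    where
    ident : ∀ a → 0ℚ ≡ 1ℚ - a + (a - 1ℚ)
    ident = solve-∀ ℚ-ring

module SmallRotation (ε : ℚ) (0<ε : 0ℚ < ε) (ε≤1 : ε ≤ 1ℚ) where

  -- The rational parametrisation of the circle by the tangent of the half angle, at τ = ε/2; it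
  -- gives |z - 1|² = ε²/(1 + τ²).
  τ D r c s : ℚ
  τ = ½ * ε
  D = 1ℚ + τ * τ
  r = inv D
  c = (1ℚ - τ * τ) * r
  s = 2ℚ * τ * r

  0<τ : 0ℚ < τ
  0<τ = *-pos (positive⁻¹ ½) 0<ε

  1≤D : 1ℚ ≤ D
  1≤D = ≤-by (τ * τ) refl (²-nonNeg τ)

  0<D : 0ℚ < D
  0<D = <-≤-trans 0<1 1≤D

  0<r : 0ℚ < r
  0<r = inv-pos 0<D

  τ²<1 : τ * τ < 1ℚ
  τ²<1 = ≤-<-trans {τ * τ} {½ * 1ℚ * (½ * 1ℚ)}
    (*-mono (<⇒≤ 0<τ) 0≤½ (*-monoʳ 0≤½ ε≤1) (*-monoʳ 0≤½ ε≤1))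
    (<-by (+ 3 / 4) refl (positive⁻¹ (+ 3 / 4)))

  0<c : 0ℚ < c
  0<c = *-pos (<⇒0<- τ²<1) 0<r

  0<s : 0ℚ < s
  0<s = *-pos (*-pos (positive⁻¹ 2ℚ) 0<τ) 0<r

  unit : c * c + s * s ≡ 1ℚ
  unit = ≡-by₁ (D * r + 1ℚ) (ident τ r) (inv-* 0<D)
    where
    ident : ∀ t r → (1ℚ - t * t) * r * ((1ℚ - t * t) * r) + 2ℚ * t * r * (2ℚ * t * r) ≡
      1ℚ + ((1ℚ + t * t) * r + 1ℚ) * ((1ℚ + t * t) * r - 1ℚ)
    ident = solve-∀ ℚ-ring

  ∣z-1∣² : ∣ (c +𝐢 s) -ᶜ 1ᶜ ∣² ≡ ε * ε * r
  ∣z-1∣² = trans (∣-1∣² {c +𝐢 s} unit) (≡-by₁ (- 2ℚ) (ident ε r) (inv-* 0<D))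
    where
    ident : ∀ e r → 2ℚ - 2ℚ * ((1ℚ - ½ * e * (½ * e)) * r) ≡ e * e * r + - 2ℚ * ((1ℚ + ½ * e * (½ * e)) * r - 1ℚ)
    ident = solve-∀ ℚ-ring

  r≤1 : r ≤ 1ℚ
  r≤1 = subst₂ _≤_ (*-identityˡ r) (inv-* 0<D) (*-monoˡ (<⇒≤ 0<r) 1≤D)

  open FirstQuadrant c s 0<c 0<s unit

  rotation′ : (∃ λ Q → Positive Q × C Q ≤ 0ℚ) → Rotation ε
  rotation′ (zero , pos , C≤0) = contradiction 0<1 (≤⇒≯ C≤0)
  rotation′ (suc q , pos , C≤0) = record
    { z = c +𝐢 s
    ; unit = unit
    ; q = q
    ; small = subst₂ _≤_ (sym ∣z-1∣²) (*-identityʳ (ε * ε)) (*-monoʳ (²-nonNeg ε) r≤1)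
    ; nontrivial = subst (0ℚ <_) (sym ∣z-1∣²) (*-pos (*-pos 0<ε 0<ε) 0<r)
    ; 0≤im-z = <⇒≤ 0<s
    ; 0≤re-z = <⇒≤ 0<c
    ; 0≤re-^ = λ i i≤q → <⇒≤ (pos i (ℕ.s≤s i≤q))
    ; 0≤im-^ = S-nonNeg pos
    ; re-^≤ = λ i i≤q → C≤c pos i (ℕ.s≤s i≤q)
    ; turned = C≤0
    }

  rotation : Rotation ε
  rotation = rotation′ first

-- Quarter turns, half turns and full turns

module RotationProperties {ε : ℚ} (0<ε : 0ℚ < ε) (R : Rotation ε) where

  open Rotation R

  Q : ℕ
  Q = suc q

  μ : ℚ
  μ = ∣ z -ᶜ 1ᶜ ∣²

  z^-unit : ∀ k → ∣ z ^ᶜ k ∣² ≡ 1ℚ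
  z^-unit k = ∣∣²-^ᶜ k unit

  ∣∣²≡1⇒im≤1 : ∀ x → ∣ x ∣² ≡ 1ℚ → im x ≤ 1ℚ
  ∣∣²≡1⇒im≤1 x eq = im≤ x 0≤1 (≤-reflexive eq)

  -- After Q steps the real part is nonpositive, hence the distance from 1 is at least 1, and every
  -- step covers at most ε.
  1≤ε*Q : 1ℚ ≤ ε * ι Q
  1≤ε*Q = ²-cancel-≤ (*-nonNeg (<⇒≤ 0<ε) (ι-nonNeg Q)) (begin
    1ℚ * 1ℚ  ≤⟨ ≤-by (1ℚ - 2ℚ * re (z ^ᶜ Q)) (ident (re (z ^ᶜ Q))) 0≤e ⟩
    2ℚ - 2ℚ * re (z ^ᶜ Q)            ≡⟨ ∣-1∣² {z ^ᶜ Q} (z^-unit Q) ⟨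
    ∣ z ^ᶜ Q -ᶜ 1ᶜ ∣²                ≤⟨ ∣^-1∣²≤ Q unit ⟩
    ι Q * ι Q * μ                    ≤⟨ *-monoʳ (²-nonNeg (ι Q)) small ⟩
    ι Q * ι Q * (ε * ε)              ≡⟨ ident₂ (ι Q) ε ⟩
    ε * ι Q * (ε * ι Q)              ∎)
    where
    open ≤-Reasoning
    ident : ∀ x → 2ℚ - 2ℚ * x ≡ 1ℚ * 1ℚ + (1ℚ - 2ℚ * x)
    ident = solve-∀ ℚ-ring
    ident₂ : ∀ x e → x * x * (e * e) ≡ e * x * (e * x)
    ident₂ = solve-∀ ℚ-ring
    ident₃ : ∀ x → 1ℚ - 2ℚ * x ≡ 1ℚ + 2ℚ * (0ℚ - x)
    ident₃ = solve-∀ ℚ-ring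
    0≤e : 0ℚ ≤ 1ℚ - 2ℚ * re (z ^ᶜ Q)
    0≤e = subst (0ℚ ≤_) (sym (ident₃ (re (z ^ᶜ Q)))) (+-nonNeg 0≤1 (*-nonNeg 0≤2 (≤⇒0≤- turned)))

  -- z^Q is within one step of the right angle: u = −i z^Q is at most as far from 1 as z.
  u : ℂ
  u = (0ℚ +𝐢 - 1ℚ) *ᶜ z ^ᶜ Q

  re-u : re u ≡ im (z ^ᶜ Q)
  re-u = ident (re (z ^ᶜ Q)) (im (z ^ᶜ Q))
    where
    ident : ∀ a b → 0ℚ * a - - 1ℚ * b ≡ b
    ident = solve-∀ ℚ-ring

  u-unit : ∣ u ∣² ≡ 1ℚ
  u-unit = trans (∣∣²-* (0ℚ +𝐢 - 1ℚ) (z ^ᶜ Q)) (trans (cong (_*_ 1ℚ) (z^-unit Q)) refl)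

  u⁴ : u ^ᶜ 4 ≡ z ^ᶜ (4 ℕ.* Q)
  u⁴ = trans (*ᶜ-^ᶜ (0ℚ +𝐢 - 1ℚ) (z ^ᶜ Q) 4) (trans (*ᶜ-identityˡ ((z ^ᶜ Q) ^ᶜ 4)) (sym (^ᶜ-* z Q 4)))

  -- With θ the angle of z, expand cos θ as cos(Qθ - (Q - 1)θ); the product of the cosines is
  -- nonpositive and sin((Q - 1)θ) ≤ 1.
  re-z≤im-z^Q : re z ≤ im (z ^ᶜ Q)
  re-z≤im-z^Q = begin
    re z                              ≡⟨ ≡-by₁ (- re z) (ident a b (re z) (im z)) (z^-unit q) ⟩
    re (z ^ᶜ Q) * a + im (z ^ᶜ Q) * b ≤⟨ +-mono-≤ (*-monoˡ (0≤re-^ q ℕP.≤-refl) turned)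
                                           (*-monoʳ (0≤im-^ Q ℕP.≤-refl) (∣∣²≡1⇒im≤1 (z ^ᶜ q) (z^-unit q))) ⟩
    0ℚ * a + im (z ^ᶜ Q) * 1ℚ         ≡⟨ ident₂ a (im (z ^ᶜ Q)) ⟩
    im (z ^ᶜ Q)                       ∎
    where
    open ≤-Reasoning
    a = re (z ^ᶜ q)
    b = im (z ^ᶜ q)
    ident : ∀ a b c s → c ≡ (a * c - b * s) * a + (a * s + b * c) * b + - c * (a * a + b * b - 1ℚ)
    ident = solve-∀ ℚ-ring
    ident₂ : ∀ a b → 0ℚ * a + b * 1ℚ ≡ b
    ident₂ = solve-∀ ℚ-ring

  ∣u-1∣²≤μ : ∣ u -ᶜ 1ᶜ ∣² ≤ μ
  ∣u-1∣²≤μ = subst₂ _≤_ (sym (∣-1∣² {u} u-unit)) (sym (∣-1∣² {z} unit))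
    (≤-by (2ℚ * (im (z ^ᶜ Q) - re z)) (trans (ident (re z) (im (z ^ᶜ Q)))
      (cong (λ x → 2ℚ - 2ℚ * x + 2ℚ * (im (z ^ᶜ Q) - re z)) (sym re-u)))
      (*-nonNeg 0≤2 (≤⇒0≤- re-z≤im-z^Q)))
    where
    ident : ∀ x y → 2ℚ - 2ℚ * x ≡ 2ℚ - 2ℚ * y + 2ℚ * (y - x)
    ident = solve-∀ ℚ-ring

  -- A full turn is u⁴, and u is no farther from 1 than z; so j turns miss 1 by at most 4j |z - 1|.
  ∣period-1∣²≤ : ∀ j → ∣ z ^ᶜ (j ℕ.* (4 ℕ.* Q)) -ᶜ 1ᶜ ∣² ≤ ι (j ℕ.* 4) * ι (j ℕ.* 4) * μ
  ∣period-1∣²≤ j = begin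
    ∣ z ^ᶜ (j ℕ.* (4 ℕ.* Q)) -ᶜ 1ᶜ ∣²                ≡⟨ cong (λ x → ∣ x -ᶜ 1ᶜ ∣²) eq ⟩
    ∣ u ^ᶜ (j ℕ.* 4) -ᶜ 1ᶜ ∣²                         ≤⟨ ∣^-1∣²≤ (j ℕ.* 4) u-unit ⟩
    ι (j ℕ.* 4) * ι (j ℕ.* 4) * ∣ u -ᶜ 1ᶜ ∣²  ≤⟨ *-monoʳ (²-nonNeg (ι (j ℕ.* 4))) ∣u-1∣²≤μ ⟩
    ι (j ℕ.* 4) * ι (j ℕ.* 4) * μ                     ∎
    where
    open ≤-Reasoning
    eq : z ^ᶜ (j ℕ.* (4 ℕ.* Q)) ≡ u ^ᶜ (j ℕ.* 4)
    eq = trans (^ᶜ-* z (4 ℕ.* Q) j) (trans (cong (_^ᶜ j) (sym u⁴)) (sym (^ᶜ-* u 4 j)))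

  -- Replaces the vanishing of a sum over all roots of unity. The exponent is at most Q, hence |w -
  -- 1| ≥ |z - 1|, and this factor cancels against the defect of the period.
  ∣full-turn∣²≤ : ∀ j → suc j ℕ.≤ Q →
    ∣ Σᶜ< (4 ℕ.* Q) (λ r → z ^ᶜ (r ℕ.* suc j)) ∣² ≤ ι (suc j ℕ.* 4) * ι (suc j ℕ.* 4)
  ∣full-turn∣²≤ j (ℕ.s≤s j≤q) = *-cancelˡ nontrivial (begin
    μ * ∣ Sum ∣²                                ≤⟨ *-monoˡ (∣∣²-nonNeg Sum) μ≤ ⟩
    ∣ w -ᶜ 1ᶜ ∣² * ∣ Sum ∣²                     ≡⟨ cong (λ x → ∣ w -ᶜ 1ᶜ ∣² * ∣ x ∣²) Sum≡ ⟩
    ∣ w -ᶜ 1ᶜ ∣² * ∣ Σᶜ< (4 ℕ.* Q) (w ^ᶜ_) ∣²   ≡⟨ ∣∣²-* (w -ᶜ 1ᶜ) (Σᶜ< (4 ℕ.* Q) (w ^ᶜ_)) ⟨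
    ∣ (w -ᶜ 1ᶜ) *ᶜ Σᶜ< (4 ℕ.* Q) (w ^ᶜ_) ∣²     ≡⟨ cong ∣_∣² (geometric w (4 ℕ.* Q)) ⟩
    ∣ w ^ᶜ (4 ℕ.* Q) -ᶜ 1ᶜ ∣²  ≡⟨ cong (λ x → ∣ x -ᶜ 1ᶜ ∣²) (trans (sym (^ᶜ-* z (suc j) (4 ℕ.* Q))) (cong (z ^ᶜ_) (ℕP.*-comm (4 ℕ.* Q) (suc j)))) ⟩
    ∣ z ^ᶜ (suc j ℕ.* (4 ℕ.* Q)) -ᶜ 1ᶜ ∣²       ≤⟨ ∣period-1∣²≤ (suc j) ⟩
    B * B * μ                                   ≡⟨ ℚP.*-comm (B * B) μ ⟩
    μ * (B * B)                                 ∎)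
    where
    open ≤-Reasoning
    B = ι (suc j ℕ.* 4)
    w = z ^ᶜ suc j
    Sum = Σᶜ< (4 ℕ.* Q) (λ r → z ^ᶜ (r ℕ.* suc j))
    Sum≡ : Sum ≡ Σᶜ< (4 ℕ.* Q) (w ^ᶜ_)
    Sum≡ = cong₂ _+𝐢_ (Σ<-cong (4 ℕ.* Q) (λ r → cong re (^ᶜ-* z (suc j) r)))
                      (Σ<-cong (4 ℕ.* Q) (λ r → cong im (^ᶜ-* z (suc j) r)))
    ident : ∀ x y → 2ℚ - 2ℚ * y ≡ 2ℚ - 2ℚ * x + 2ℚ * (x - y)
    ident = solve-∀ ℚ-ring
    μ≤ : μ ≤ ∣ w -ᶜ 1ᶜ ∣²
    μ≤ = subst₂ _≤_ (sym (∣-1∣² {z} unit)) (sym (∣-1∣² {w} (z^-unit (suc j))))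
      (≤-by (2ℚ * (re z - re w)) (ident (re z) (re w)) (*-nonNeg 0≤2 (≤⇒0≤- (re-^≤ j j≤q))))

  im-z≤ε : im z ≤ ε
  im-z≤ε = ²-cancel-≤ (<⇒≤ 0<ε) (≤-trans (≤-by ((re z - 1ℚ) * (re z - 1ℚ))
    (ident (re z) (im z)) (²-nonNeg (re z - 1ℚ))) small)
    where
    ident : ∀ c s → (c - 1ℚ) * (c - 1ℚ) + (s - 0ℚ) * (s - 0ℚ) ≡ s * s + (c - 1ℚ) * (c - 1ℚ)
    ident = solve-∀ ℚ-ring

  -ε≤re-z^Q : - ε ≤ re (z ^ᶜ Q)
  -ε≤re-z^Q = ≤-by ((ε - im z) + (im z * (1ℚ - im (z ^ᶜ q)) + re (z ^ᶜ q) * re z))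
    (ident (re (z ^ᶜ q)) (im (z ^ᶜ q)) (re z) (im z) ε)
    (+-nonNeg (≤⇒0≤- im-z≤ε) (+-nonNeg (*-nonNeg 0≤im-z (≤⇒0≤- (∣∣²≡1⇒im≤1 (z ^ᶜ q) (z^-unit q))))
      (*-nonNeg (0≤re-^ q ℕP.≤-refl) 0≤re-z)))
    where
    ident : ∀ a b c s e → a * c - b * s ≡ - e + ((e - s) + (s * (1ℚ - b) + a * c))
    ident = solve-∀ ℚ-ring

  -- In the second quarter the sine is computed from z^Q, which is a right angle only up to ε; this
  -- is the source of the error term.
  half-turn : ∀ i → i ℕ.≤ 2 ℕ.* Q → 0ℚ ≤ im (z ^ᶜ i) + 2ℚ * ε
  half-turn i i≤2Q with i ℕP.≤? Q
  ... | yes i≤Q = +-nonNeg (0≤im-^ i i≤Q) (*-nonNeg 0≤2 (<⇒≤ 0<ε))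
  ... | no i≰Q = subst (λ x → 0ℚ ≤ im x + 2ℚ * ε) (sym split) (main (i ℕ.∸ Q) (ℕP.m≤n⇒m<n∨m≡n k≤Q))
    where
    k≤Q : i ℕ.∸ Q ℕ.≤ Q
    k≤Q = subst (i ℕ.∸ Q ℕ.≤_) (trans (ℕP.m+n∸m≡n Q (Q ℕ.+ 0)) (ℕP.+-identityʳ Q)) (ℕP.∸-monoˡ-≤ Q i≤2Q)
    split : z ^ᶜ i ≡ z ^ᶜ Q *ᶜ z ^ᶜ (i ℕ.∸ Q)
    split = trans (cong (z ^ᶜ_) (sym (ℕP.m+[n∸m]≡n (ℕP.<⇒≤ (ℕP.≰⇒> i≰Q))))) (^ᶜ-+ z Q (i ℕ.∸ Q))
    a = re (z ^ᶜ Q)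
    b = im (z ^ᶜ Q)
    main : ∀ k → k ℕ.< Q ⊎ k ≡ Q → 0ℚ ≤ im (z ^ᶜ Q *ᶜ z ^ᶜ k) + 2ℚ * ε
    main k (inj₁ (ℕ.s≤s k≤q)) = subst (0ℚ ≤_) (sym (ident a b (re (z ^ᶜ k)) (im (z ^ᶜ k)) ε))
      (+-nonNeg (+-nonNeg (*-nonNeg (0≤im-^ k k≤Q′) (≤⇒0≤- -ε≤re-z^Q))
                          (*-nonNeg (<⇒≤ 0<ε) (≤⇒0≤- (∣∣²≡1⇒im≤1 (z ^ᶜ k) (z^-unit k)))))
                (+-nonNeg (*-nonNeg (0≤im-^ Q ℕP.≤-refl) (0≤re-^ k k≤q)) (<⇒≤ 0<ε)))
      where
      k≤Q′ : k ℕ.≤ Q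
      k≤Q′ = ℕP.≤-trans k≤q (ℕP.n≤1+n q)
      ident : ∀ a b c s e → a * s + b * c + 2ℚ * e ≡ s * (a - - e) + e * (1ℚ - s) + (b * c + e)
      ident = solve-∀ ℚ-ring
    main k (inj₂ refl) = subst (0ℚ ≤_) (sym (ident a b ε))
      (*-nonNeg 0≤2 (+-nonNeg (*-nonNeg (0≤im-^ Q ℕP.≤-refl) (≤⇒0≤- -ε≤re-z^Q))
        (*-nonNeg (<⇒≤ 0<ε) (≤⇒0≤- (∣∣²≡1⇒im≤1 (z ^ᶜ Q) (z^-unit Q))))))
      where
      ident : ∀ a b e → a * b + b * a + 2ℚ * e ≡ 2ℚ * (b * (a - - e) + e * (1ℚ - b))
      ident = solve-∀ ℚ-ring

-- Sums over vertices and edges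

sum-mono : ∀ {n} {f g : Fin n → ℚ} → (∀ i → f i ≤ g i) → sum f ≤ sum g
sum-mono {zero} h = ≤-refl
sum-mono {suc n} h = +-mono-≤ (h Fin.zero) (sum-mono (h ∘ Fin.suc))

sum-const : ∀ n c → sum {n} (λ _ → c) ≡ ι n * c
sum-const zero c = sym (trans (cong (_* c) ι-0) (ℚP.*-zeroˡ c))
sum-const (suc n) c = trans (cong (_+_ c) (sum-const n c))
  (trans (ident (ι n) c) (cong (_* c) (sym (ι-suc n))))
  where
  ident : ∀ a c → c + a * c ≡ (a + 1ℚ) * c
  ident = solve-∀ ℚ-ring

sum-split : ∀ m {n} (f : Fin (m ℕ.+ n) → ℚ) → sum f ≡ sum (λ i → f (i ↑ˡ n)) + sum (λ i → f (m ↑ʳ i))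
sum-split zero f = sym (+-identityˡ (sum f))
sum-split (suc m) {n} f = trans (cong (_+_ (f Fin.zero)) (sum-split m (f ∘ Fin.suc)))
  (sym (ℚP.+-assoc (f Fin.zero) (sum (λ i → f (Fin.suc (i ↑ˡ n)))) (sum (λ i → f (Fin.suc (m ↑ʳ i))))))

sum-combine : ∀ m {n} (f : Fin (m ℕ.* n) → ℚ) → sum f ≡ sum (λ i → sum (λ j → f (Fin.combine {m} {n} i j)))
sum-combine zero f = refl
sum-combine (suc m) {n} f = trans (sum-split n f)
  (cong (_+_ (sum (λ j → f (j ↑ˡ (m ℕ.* n))))) (sum-combine m (f ∘ (n ↑ʳ_))))

sum-toℕ : ∀ n (h : ℕ → ℚ) → sum {n} (h ∘ toℕ) ≡ Σ< n h
sum-toℕ zero h = refl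
sum-toℕ (suc n) h = trans (cong (_+_ (h 0)) (sum-toℕ n (h ∘ suc))) (sym (Σ<-first n h))

-- Zeroing one value instead of deleting its index keeps the induction of `Σₗ-unique≤sum` over a
-- fixed `Fin k`.
omit : ∀ {k} → Fin k → (Fin k → ℚ) → Fin k → ℚ
omit x f y = if does (x FinP.≟ y) then 0ℚ else f y

sum-omit : ∀ {k} (x : Fin k) f → sum f ≡ f x + sum (omit x f)
sum-omit Fin.zero f = cong (_+_ (f Fin.zero)) (sym (+-identityˡ (sum (f ∘ Fin.suc))))
sum-omit (Fin.suc x) f = trans (cong (_+_ (f Fin.zero)) (sum-omit x (f ∘ Fin.suc)))
  (swap₃ (f Fin.zero) (f (Fin.suc x)) (sum (omit x (f ∘ Fin.suc))))
  where
  swap₃ : ∀ a b c → a + (b + c) ≡ b + (a + c)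
  swap₃ = solve-∀ ℚ-ring

omit-nonNeg : ∀ {k} (x : Fin k) {f} → (∀ y → 0ℚ ≤ f y) → ∀ y → 0ℚ ≤ omit x f y
omit-nonNeg x h y with x FinP.≟ y
... | yes _ = ≤-refl
... | no _ = h y

omit-≢ : ∀ {k} {x y : Fin k} f → x ≢ y → omit x f y ≡ f y
omit-≢ {x = x} {y} f x≢y with x FinP.≟ y
... | yes x≡y = contradiction x≡y x≢y
... | no _ = refl

Σₗ : ∀ {A : Set} → (A → ℚ) → List A → ℚ
Σₗ f [] = 0ℚ
Σₗ f (x ∷ xs) = f x + Σₗ f xs

Σₗ-lookup : ∀ {A : Set} (f : A → ℚ) xs → Σₗ f xs ≡ sum (f ∘ lookup xs)
Σₗ-lookup f [] = refl
Σₗ-lookup f (x ∷ xs) = cong (_+_ (f x)) (Σₗ-lookup f xs)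

Σₗ-++ : ∀ {A : Set} (f : A → ℚ) xs ys → Σₗ f (xs List.++ ys) ≡ Σₗ f xs + Σₗ f ys
Σₗ-++ f [] ys = sym (+-identityˡ (Σₗ f ys))
Σₗ-++ f (x ∷ xs) ys = trans (cong (_+_ (f x)) (Σₗ-++ f xs ys)) (sym (ℚP.+-assoc (f x) (Σₗ f xs) (Σₗ f ys)))

Σₗ-map : ∀ {A B : Set} (f : B → ℚ) (g : A → B) xs → Σₗ f (List.map g xs) ≡ Σₗ (f ∘ g) xs
Σₗ-map f g [] = refl
Σₗ-map f g (x ∷ xs) = cong (_+_ (f (g x))) (Σₗ-map f g xs)

Σₗ-cong : ∀ {A : Set} {f g : A → ℚ} {xs} → All (λ x → f x ≡ g x) xs → Σₗ f xs ≡ Σₗ g xs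
Σₗ-cong [] = refl
Σₗ-cong (eq ∷ eqs) = cong₂ _+_ eq (Σₗ-cong eqs)

Σₗ-unique≤sum : ∀ {k} (f : Fin k → ℚ) {xs} → (∀ x → 0ℚ ≤ f x) → Unique xs → Σₗ f xs ≤ sum f
Σₗ-unique≤sum {k} f h [] = ≤-trans (≤-reflexive (sym (trans (sum-const k 0ℚ) (*-zeroʳ (ι k))))) (sum-mono h)
Σₗ-unique≤sum f {x ∷ xs} h (x∉ ∷ uniq) = begin
  f x + Σₗ f xs  ≡⟨ cong (_+_ (f x)) (Σₗ-cong (All.map (λ x≢y → sym (omit-≢ f x≢y)) x∉)) ⟩
  f x + Σₗ (omit x f) xs  ≤⟨ +-monoʳ-≤ (f x) (Σₗ-unique≤sum (omit x f) (omit-nonNeg x h) uniq) ⟩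
  f x + sum (omit x f)     ≡⟨ sum-omit x f ⟨
  sum f                    ∎
  where open ≤-Reasoning

sum₂ : ∀ {m n} → (Fin m → Fin n → ℚ) → ℚ
sum₂ g = sum (λ i → sum (g i))

Σₗ-unique≤sum₂ : ∀ {m n} (g : Fin m → Fin n → ℚ) {ps} → (∀ i j → 0ℚ ≤ g i j) → Unique ps →
  Σₗ (uncurry g) ps ≤ sum₂ g
Σₗ-unique≤sum₂ {m} {n} g {ps} h uniq = begin
  Σₗ (uncurry g) ps  ≡⟨ Σₗ-cong {xs = ps} (All.tabulate (λ {p} _ → sym (f-combine (proj₁ p) (proj₂ p)))) ⟩
  Σₗ (f ∘ uncurry Fin.combine) ps            ≡⟨ Σₗ-map f (uncurry Fin.combine) ps ⟨
  Σₗ f (List.map (uncurry Fin.combine) ps)  ≤⟨ Σₗ-unique≤sum f (λ k → h (proj₁ (Fin.remQuot {m} n k)) (proj₂ (Fin.remQuot {m} n k)))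
                                                 (UniqueP.map⁺ (λ {p} {q} → combine-inj p q) uniq) ⟩
  sum f                                      ≡⟨ sum-combine m f ⟩
  sum₂ (λ i j → f (Fin.combine {m} {n} i j))  ≡⟨ sum-cong-≗ (λ i → sum-cong-≗ (λ j → f-combine i j)) ⟩
  sum₂ g                                     ∎
  where
  open ≤-Reasoning
  f : Fin (m ℕ.* n) → ℚ
  f = uncurry g ∘ Fin.remQuot {m} n
  f-combine : ∀ i j → f (Fin.combine i j) ≡ g i j
  f-combine i j = cong (uncurry g) (FinP.remQuot-combine i j)
  combine-inj : ∀ (p q : Fin m × Fin n) → uncurry Fin.combine p ≡ uncurry Fin.combine q → p ≡ q
  combine-inj (i , j) (k , l) eq = cong₂ _,_ (FinP.combine-injectiveˡ i j k l eq) (FinP.combine-injectiveʳ i j k l eq)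

module _ {n : ℕ} (G : Graph n) where

  tail head : Fin (numEdges G) → Fin n
  tail k = proj₁ (lookup (edges G) k)
  head k = proj₂ (lookup (edges G) k)

  -- Simplicity of the graph enters the upper bound here: tail < head makes the two orientations
  -- disjoint, so they are distinct ordered pairs, and the remaining pairs contribute nonnegatively.
  edges≤pairs : ∀ (g : Fin n → Fin n → ℚ) → (∀ i j → 0ℚ ≤ g i j) →
    sum (λ k → g (tail k) (head k)) + sum (λ k → g (head k) (tail k)) ≤ sum₂ g
  edges≤pairs g h = begin
    sum (λ k → g (tail k) (head k)) + sum (λ k → g (head k) (tail k))
      ≡⟨ cong₂ _+_ (Σₗ-lookup (uncurry g) (edges G)) (Σₗ-lookup (uncurry g ∘ swap) (edges G)) ⟨
    Σₗ (uncurry g) (edges G) + Σₗ (uncurry g ∘ swap) (edges G)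
      ≡⟨ cong (_+_ (Σₗ (uncurry g) (edges G))) (Σₗ-map (uncurry g) swap (edges G)) ⟨
    Σₗ (uncurry g) (edges G) + Σₗ (uncurry g) (List.map swap (edges G))
      ≡⟨ Σₗ-++ (uncurry g) (edges G) (List.map swap (edges G)) ⟨
    Σₗ (uncurry g) (edges G List.++ List.map swap (edges G))
      ≤⟨ Σₗ-unique≤sum₂ g h (UniqueP.++⁺ (unique G) (UniqueP.map⁺ (λ { refl → refl }) (unique G)) disjoint) ⟩
    sum₂ g
      ∎
    where
    open ≤-Reasoning
    disjoint : ∀ {p} → p ∈ edges G × p ∈ List.map swap (edges G) → _
    disjoint (p∈ , p∈′) with ∈-map⁻ swap p∈′
    ... | q , q∈ , refl = ℕP.<-asym (All.lookup (ordered G) p∈) (All.lookup (ordered G) q∈)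

module Labelled {n : ℕ} (G : Graph n) (L : EdgeMagicLabelling G) where

  open EdgeMagicLabelling L public

  m N : ℕ
  m = numEdges G
  N = n ℕ.+ m

  -- Labels are shifted down by one, to range over 0, …, N − 1.
  vlab : Fin n → ℕ
  vlab v = toℕ (l (v ↑ˡ m))

  elab : Fin m → ℕ
  elab k = toℕ (l (n ↑ʳ k))

  -- Three labels are lowered by one each. Without edges `s` may be below 3, but `magic′` speaks
  -- only of edges, so the truncation does no harm.
  s′ : ℕ
  s′ = s ℕ.∸ 3

  vlab<N : ∀ v → vlab v ℕ.< N
  vlab<N v = FinP.toℕ<n (l (v ↑ˡ m))

  elab<N : ∀ k → elab k ℕ.< N
  elab<N k = FinP.toℕ<n (l (n ↑ʳ k))

  magic′ : ∀ k → vlab (tail G k) ℕ.+ vlab (head G k) ℕ.+ elab k ≡ s′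
  magic′ k = trans (shift (vlab (tail G k)) (vlab (head G k)) (elab k)) (cong (ℕ._∸ 3) (magic k))
    where
    shift : ∀ a b c → a ℕ.+ b ℕ.+ c ≡ (suc a ℕ.+ suc b ℕ.+ suc c) ℕ.∸ 3
    shift a b c = cong (ℕ._∸ 2) (sym (trans (ℕP.+-suc (a ℕ.+ suc b) c) (cong (λ x → suc (x ℕ.+ c)) (ℕP.+-suc a b))))

  sum-labels : ∀ (h : ℕ → ℚ) → sum (h ∘ vlab) + sum (h ∘ elab) ≡ Σ< N h
  sum-labels h = begin
    sum (h ∘ vlab) + sum (h ∘ elab)   ≡⟨ sum-split n (h ∘ toℕ ∘ l) ⟨
    sum (h ∘ toℕ ∘ l)  ≡⟨ sum-permute (h ∘ toℕ) (Bijection⇒Inverse (mk⤖ bijective)) ⟨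
    sum {N} (h ∘ toℕ)                 ≡⟨ sum-toℕ N h ⟩
    Σ< N h                            ∎
    where open ≡-Reasoning

-- Exponential sums over the vertex labels

[k*w+e]/w : ∀ k e w .{{_ : ℕ.NonZero w}} → (k ℕ.* w ℕ.+ e) ℕ./ w ≡ k ℕ.+ e ℕ./ w
[k*w+e]/w k e w = trans (ℕD.+-distrib-/-∣ˡ e (divides-refl k)) (cong (ℕ._+ e ℕ./ w) (ℕD.m*n/n≡m k w))

/-+-cases : ∀ a b d .{{_ : ℕ.NonZero d}} →
  a ℕ./ d ℕ.+ b ℕ./ d ≡ (a ℕ.+ b) ℕ./ d ⊎ suc (a ℕ./ d ℕ.+ b ℕ./ d) ≡ (a ℕ.+ b) ℕ./ d
/-+-cases a b d with ℕP.m≤n⇒m<n∨m≡n lower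
  where
  lower : a ℕ./ d ℕ.+ b ℕ./ d ℕ.≤ (a ℕ.+ b) ℕ./ d
  lower = subst (ℕ._≤ (a ℕ.+ b) ℕ./ d) (ℕD.m*n/n≡m (a ℕ./ d ℕ.+ b ℕ./ d) d)
    (ℕD./-monoˡ-≤ d (subst (ℕ._≤ a ℕ.+ b) (sym (ℕP.*-distribʳ-+ d (a ℕ./ d) (b ℕ./ d)))
      (ℕP.+-mono-≤ (ℕD.m/n*n≤m a d) (ℕD.m/n*n≤m b d))))
... | inj₂ eq = inj₁ eq
... | inj₁ lt = inj₂ (ℕP.≤-antisym lt (ℕP.≤-pred (ℕD.m<n*o⇒m/o<n upper)))
  where
  open ℕP.≤-Reasoning
  x = a ℕ./ d
  y = b ℕ./ d
  bound : ∀ c → c ℕ.< suc (c ℕ./ d) ℕ.* d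
  bound c = begin-strict
    c                             ≡⟨ ℕD.m≡m%n+[m/n]*n c d ⟩
    c ℕ.% d ℕ.+ c ℕ./ d ℕ.* d     <⟨ ℕP.+-monoˡ-< (c ℕ./ d ℕ.* d) (ℕD.m%n<n c d) ⟩
    d ℕ.+ c ℕ./ d ℕ.* d           ∎
  upper : a ℕ.+ b ℕ.< suc (suc (x ℕ.+ y)) ℕ.* d
  upper = begin-strict
    a ℕ.+ b                            <⟨ ℕP.+-mono-< (bound a) (bound b) ⟩
    suc x ℕ.* d ℕ.+ suc y ℕ.* d        ≡⟨ ℕP.*-distribʳ-+ d (suc x) (suc y) ⟨
    (suc x ℕ.+ suc y) ℕ.* d            ≡⟨ cong (λ k → suc k ℕ.* d) (ℕP.+-suc x y) ⟩
    suc (suc (x ℕ.+ y)) ℕ.* d          ∎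

Σ<-const : ∀ n c → Σ< n (λ _ → c) ≡ ι n * c
Σ<-const zero c = sym (trans (cong (_* c) ι-0) (ℚP.*-zeroˡ c))
Σ<-const (suc n) c = trans (cong (_+ c) (Σ<-const n c)) (trans (ident (ι n) c) (cong (_* c) (sym (ι-suc n))))
  where
  ident : ∀ a c → a * c + c ≡ (a + 1ℚ) * c
  ident = solve-∀ ℚ-ring

Σ<-cong-< : ∀ n {f g} → (∀ i → i ℕ.< n → f i ≡ g i) → Σ< n f ≡ Σ< n g
Σ<-cong-< zero h = refl
Σ<-cong-< (suc n) h = cong₂ _+_ (Σ<-cong-< n (λ i i<n → h i (ℕP.m<n⇒m<1+n i<n))) (h n ℕP.≤-refl)

Σ<-blocks : ∀ P w .{{_ : ℕ.NonZero w}} (h : ℕ → ℚ) → Σ< (P ℕ.* w) (λ i → h (i ℕ./ w)) ≡ ι w * Σ< P h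
Σ<-blocks zero w h = sym (*-zeroʳ (ι w))
Σ<-blocks (suc P) w h = begin
  Σ< (w ℕ.+ P ℕ.* w) h′  ≡⟨ cong (λ k → Σ< k h′) (ℕP.+-comm w (P ℕ.* w)) ⟩
  Σ< (P ℕ.* w ℕ.+ w) h′                            ≡⟨ Σ<-split (P ℕ.* w) w h′ ⟩
  Σ< (P ℕ.* w) h′ + Σ< w (λ i → h′ (P ℕ.* w ℕ.+ i)) ≡⟨ cong₂ _+_ (Σ<-blocks P w h) (trans (Σ<-cong-< w last) (Σ<-const w (h P))) ⟩
  ι w * Σ< P h + ι w * h P                         ≡⟨ ℚP.*-distribˡ-+ (ι w) (Σ< P h) (h P) ⟨
  ι w * (Σ< P h + h P)                             ∎
  where
  open ≡-Reasoning
  h′ : ℕ → ℚ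
  h′ i = h (i ℕ./ w)
  last : ∀ i → i ℕ.< w → h′ (P ℕ.* w ℕ.+ i) ≡ h P
  last i i<w = cong h (trans ([k*w+e]/w P i w) (trans (cong (P ℕ.+_) (ℕD.m<n⇒m/n≡0 i<w)) (ℕP.+-identityʳ P)))

sumᶜ : ∀ {n} → (Fin n → ℂ) → ℂ
sumᶜ x = sum (re ∘ x) +𝐢 sum (im ∘ x)

sum-lin : ∀ {n} a b (f g : Fin n → ℚ) → sum (λ i → a * f i - b * g i) ≡ a * sum f - b * sum g
sum-lin {zero} a b f g = sym (ident a b)
  where
  ident : ∀ a b → a * 0ℚ - b * 0ℚ ≡ 0ℚ
  ident = solve-∀ ℚ-ring
sum-lin {suc n} a b f g = trans
  (cong (_+_ (a * f Fin.zero - b * g Fin.zero)) (sum-lin a b (f ∘ Fin.suc) (g ∘ Fin.suc)))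
  (ident a b (f Fin.zero) (sum (f ∘ Fin.suc)) (g Fin.zero) (sum (g ∘ Fin.suc)))
  where
  ident : ∀ a b x s y t → a * x - b * y + (a * s - b * t) ≡ a * (x + s) - b * (y + t)
  ident = solve-∀ ℚ-ring

sum-re-* : ∀ {n} c (x : Fin n → ℂ) → sum (λ i → re (c *ᶜ x i)) ≡ re (c *ᶜ sumᶜ x)
sum-re-* c x = sum-lin (re c) (im c) (re ∘ x) (im ∘ x)

Σ<-re-* : ∀ n c (x : ℕ → ℂ) → Σ< n (λ i → re (c *ᶜ x i)) ≡ re (c *ᶜ Σᶜ< n x)
Σ<-re-* zero c x = sym (ident (re c) (im c))
  where
  ident : ∀ a b → a * 0ℚ - b * 0ℚ ≡ 0ℚ
  ident = solve-∀ ℚ-ring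
Σ<-re-* (suc n) c x = trans (cong (_+ re (c *ᶜ x n)) (Σ<-re-* n c x))
  (ident (re c) (im c) (re (x n)) (Σ< n (re ∘ x)) (im (x n)) (Σ< n (im ∘ x)))
  where
  ident : ∀ a b x s y t → a * s - b * t + (a * x - b * y) ≡ a * (s + x) - b * (t + y)
  ident = solve-∀ ℚ-ring

^ᶜ-+-conj : ∀ {z} → ∣ z ∣² ≡ 1ℚ → ∀ k e → z ^ᶜ (k ℕ.+ e) *ᶜ conj z ^ᶜ k ≡ z ^ᶜ e
^ᶜ-+-conj {z} unit k e = begin
  z ^ᶜ (k ℕ.+ e) *ᶜ conj z ^ᶜ k  ≡⟨ cong (_*ᶜ conj z ^ᶜ k) (trans (^ᶜ-+ z k e) (*ᶜ-comm (z ^ᶜ k) (z ^ᶜ e))) ⟩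
  z ^ᶜ e *ᶜ z ^ᶜ k *ᶜ conj z ^ᶜ k      ≡⟨ *ᶜ-assoc (z ^ᶜ e) (z ^ᶜ k) (conj z ^ᶜ k) ⟩
  z ^ᶜ e *ᶜ (z ^ᶜ k *ᶜ conj z ^ᶜ k)  ≡⟨ cong (z ^ᶜ e *ᶜ_) (trans (sym (*ᶜ-^ᶜ z (conj z) k)) (trans (cong (_^ᶜ k) (*ᶜ-conj {z} unit)) (1ᶜ-^ᶜ k))) ⟩
  z ^ᶜ e *ᶜ 1ᶜ                         ≡⟨ *ᶜ-identityʳ (z ^ᶜ e) ⟩
  z ^ᶜ e                               ∎
  where open ≡-Reasoning

indicator : ∀ {A : Set} → Dec A → ℚ
indicator (yes _) = 1ℚ
indicator (no _) = 0ℚ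

0≤indicator : ∀ {A : Set} (d : Dec A) → 0ℚ ≤ indicator d
0≤indicator (yes _) = 0≤1
0≤indicator (no _) = ≤-refl

indicator≤1 : ∀ {A : Set} (d : Dec A) → indicator d ≤ 1ℚ
indicator≤1 (yes _) = ≤-refl
indicator≤1 (no _) = 0≤1

∣∣≤ : ∀ y {c} → 0ℚ ≤ c → 0ℚ ≤ y + c → ℚ.∣ y ∣ ≤ y + 2ℚ * c
∣∣≤ y {c} 0≤c 0≤y+c with ℚP.∣p∣≡p∨∣p∣≡-p y
... | inj₁ eq = ≤-trans (≤-reflexive eq) (≤-by (2ℚ * c) refl (*-nonNeg 0≤2 0≤c))
... | inj₂ eq = ≤-trans (≤-reflexive eq) (≤-by (2ℚ * (y + c)) (ident y c) (*-nonNeg 0≤2 0≤y+c))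
  where
  ident : ∀ y c → y + 2ℚ * c ≡ - y + 2ℚ * (y + c)
  ident = solve-∀ ℚ-ring

∣∣-² : ∀ y → ℚ.∣ y ∣ * ℚ.∣ y ∣ ≡ y * y
∣∣-² y with ℚP.∣p∣≡p∨∣p∣≡-p y
... | inj₁ eq = cong₂ _*_ eq eq
... | inj₂ eq = trans (cong₂ _*_ eq eq) ([-a]² y)

-- The labels form P = 4Q blocks of length w, one for each step of a full turn, with `rem` labels
-- left over. The bound 2Q ≤ w keeps this remainder from disturbing the half turn in `phase-middle`.
module Phases {n : ℕ} (G : Graph n) (L : EdgeMagicLabelling G) {ε : ℚ} (0<ε : 0ℚ < ε) (R : Rotation ε)
  (w′ rem : ℕ) (N≡ : n ℕ.+ numEdges G ≡ 4 ℕ.* suc (Rotation.q R) ℕ.* suc w′ ℕ.+ rem)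
  (rem≤ : rem ℕ.≤ 4 ℕ.* suc (Rotation.q R)) (2Q≤w : 2 ℕ.* suc (Rotation.q R) ℕ.≤ suc w′) where

  open Labelled G L public
  open Rotation R public
  open RotationProperties 0<ε R public

  w P : ℕ
  w = suc w′
  P = 4 ℕ.* Q

  -- This is s′ - 2a for the label a, raised by 2Nw to stay in ℕ. Division by 2w makes the shift
  -- exactly N steps, which the factor `conj z ^ᶜ N` of `phase` undoes.
  pos : Fin n → ℕ
  pos v = s′ ℕ.+ 2 ℕ.* (N ℕ.* w ℕ.∸ vlab v)

  vlab≤ : ∀ v → vlab v ℕ.≤ N ℕ.* w
  vlab≤ v = ℕP.≤-trans (ℕP.<⇒≤ (vlab<N v)) (ℕP.m≤m*n N w)

  pos+vlab : ∀ v → pos v ℕ.+ 2 ℕ.* vlab v ≡ s′ ℕ.+ 2 ℕ.* (N ℕ.* w)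
  pos+vlab v = trans (ident s′ (N ℕ.* w ℕ.∸ vlab v) (vlab v)) (cong (λ x → s′ ℕ.+ 2 ℕ.* x) (ℕP.m∸n+n≡m (vlab≤ v)))
    where
    ident : ∀ s a b → s ℕ.+ 2 ℕ.* a ℕ.+ 2 ℕ.* b ≡ s ℕ.+ 2 ℕ.* (a ℕ.+ b)
    ident = ℕSolver.solve-∀

  idx : Fin n → ℕ
  idx v = pos v ℕ./ (2 ℕ.* w)

  pos-edge : ∀ k → pos (tail G k) ℕ.+ pos (head G k) ≡ (N ℕ.+ N) ℕ.* (2 ℕ.* w) ℕ.+ 2 ℕ.* elab k
  pos-edge k = ℕP.+-cancelʳ-≡ (2 ℕ.* a ℕ.+ 2 ℕ.* b) _ _ (begin
    p ℕ.+ q′ ℕ.+ (2 ℕ.* a ℕ.+ 2 ℕ.* b)                         ≡⟨ ident₁ p q′ a b ⟩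
    (p ℕ.+ 2 ℕ.* a) ℕ.+ (q′ ℕ.+ 2 ℕ.* b)  ≡⟨ cong₂ ℕ._+_ (pos+vlab (tail G k)) (pos+vlab (head G k)) ⟩
    (s′ ℕ.+ 2 ℕ.* (N ℕ.* w)) ℕ.+ (s′ ℕ.+ 2 ℕ.* (N ℕ.* w))  ≡⟨ cong (λ x → (x ℕ.+ 2 ℕ.* (N ℕ.* w)) ℕ.+ (x ℕ.+ 2 ℕ.* (N ℕ.* w))) (magic′ k) ⟨
    (a ℕ.+ b ℕ.+ e ℕ.+ 2 ℕ.* (N ℕ.* w)) ℕ.+ (a ℕ.+ b ℕ.+ e ℕ.+ 2 ℕ.* (N ℕ.* w))  ≡⟨ ident₂ a b e N w ⟩
    (N ℕ.+ N) ℕ.* (2 ℕ.* w) ℕ.+ 2 ℕ.* e ℕ.+ (2 ℕ.* a ℕ.+ 2 ℕ.* b)  ∎)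
    where
    open ≡-Reasoning
    p = pos (tail G k)
    q′ = pos (head G k)
    a = vlab (tail G k)
    b = vlab (head G k)
    e = elab k
    ident₁ : ∀ p q a b → p ℕ.+ q ℕ.+ (2 ℕ.* a ℕ.+ 2 ℕ.* b) ≡ (p ℕ.+ 2 ℕ.* a) ℕ.+ (q ℕ.+ 2 ℕ.* b)
    ident₁ = ℕSolver.solve-∀
    ident₂ : ∀ a b e N w → (a ℕ.+ b ℕ.+ e ℕ.+ 2 ℕ.* (N ℕ.* w)) ℕ.+ (a ℕ.+ b ℕ.+ e ℕ.+ 2 ℕ.* (N ℕ.* w)) ≡
      (N ℕ.+ N) ℕ.* (2 ℕ.* w) ℕ.+ 2 ℕ.* e ℕ.+ (2 ℕ.* a ℕ.+ 2 ℕ.* b)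
    ident₂ = ℕSolver.solve-∀

  pos-edge/ : ∀ k → (pos (tail G k) ℕ.+ pos (head G k)) ℕ./ (2 ℕ.* w) ≡ N ℕ.+ N ℕ.+ elab k ℕ./ w
  pos-edge/ k = trans (cong (ℕ._/ (2 ℕ.* w)) (pos-edge k)) (trans ([k*w+e]/w (N ℕ.+ N) (2 ℕ.* elab k) (2 ℕ.* w))
    (cong (λ x → N ℕ.+ N ℕ.+ x) (ℕD.m*n/m*o≡n/o 2 (elab k) w)))

  -- The vertex labelled a lies at angle about π (s′ − 2a) / N, so that the product of the
  -- phases of two adjacent vertices is determined, up to one step, by the edge label.
  phase : Fin n → ℂ
  phase v = z ^ᶜ idx v *ᶜ conj z ^ᶜ N

  phase-unit : ∀ v → ∣ phase v ∣² ≡ 1ℚ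
  phase-unit v = trans (∣∣²-* (z ^ᶜ idx v) (conj z ^ᶜ N))
    (cong₂ _*_ (z^-unit (idx v)) (∣∣²-^ᶜ N (trans (∣∣²-conj z) unit)))

  phase-edge : ∀ k → let e = elab k ℕ./ w; x = phase (tail G k) *ᶜ phase (head G k) in
    x ≡ z ^ᶜ e ⊎ x ≡ z ^ᶜ e *ᶜ conj z
  phase-edge k = cases (/-+-cases (pos (tail G k)) (pos (head G k)) (2 ℕ.* w))
    where
    open ≡-Reasoning
    i = idx (tail G k)
    j = idx (head G k)
    e = elab k ℕ./ w
    c = conj z
    product : phase (tail G k) *ᶜ phase (head G k) ≡ z ^ᶜ (i ℕ.+ j) *ᶜ c ^ᶜ (N ℕ.+ N)
    product = trans (*ᶜ-interchange (z ^ᶜ i) (c ^ᶜ N) (z ^ᶜ j) (c ^ᶜ N)) (sym (cong₂ _*ᶜ_ (^ᶜ-+ z i j) (^ᶜ-+ c N N)))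
    cases : i ℕ.+ j ≡ (pos (tail G k) ℕ.+ pos (head G k)) ℕ./ (2 ℕ.* w) ⊎
            suc (i ℕ.+ j) ≡ (pos (tail G k) ℕ.+ pos (head G k)) ℕ./ (2 ℕ.* w) → _
    cases (inj₁ eq) = inj₁ (begin
      phase (tail G k) *ᶜ phase (head G k)     ≡⟨ product ⟩
      z ^ᶜ (i ℕ.+ j) *ᶜ c ^ᶜ (N ℕ.+ N)  ≡⟨ cong (λ x → z ^ᶜ x *ᶜ c ^ᶜ (N ℕ.+ N)) (trans eq (pos-edge/ k)) ⟩
      z ^ᶜ (N ℕ.+ N ℕ.+ e) *ᶜ c ^ᶜ (N ℕ.+ N)   ≡⟨ ^ᶜ-+-conj unit (N ℕ.+ N) e ⟩
      z ^ᶜ e                                   ∎)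
    -- Rounding has lost one step. Inserting z times its conjugate restores the exponent fixed by
    -- the edge label and leaves one factor `conj z`.
    cases (inj₂ eq) = inj₂ (begin
      phase (tail G k) *ᶜ phase (head G k)                ≡⟨ product ⟩
      z ^ᶜ (i ℕ.+ j) *ᶜ c ^ᶜ (N ℕ.+ N)  ≡⟨ cong (_*ᶜ c ^ᶜ (N ℕ.+ N)) (^ᶜ-+-conj unit 1 (i ℕ.+ j)) ⟨
      z ^ᶜ suc (i ℕ.+ j) *ᶜ (1ᶜ *ᶜ c) *ᶜ c ^ᶜ (N ℕ.+ N)  ≡⟨ cong (λ x → z ^ᶜ suc (i ℕ.+ j) *ᶜ x *ᶜ c ^ᶜ (N ℕ.+ N)) (*ᶜ-identityˡ c) ⟩
      z ^ᶜ suc (i ℕ.+ j) *ᶜ c *ᶜ c ^ᶜ (N ℕ.+ N)  ≡⟨ *ᶜ-assoc (z ^ᶜ suc (i ℕ.+ j)) c (c ^ᶜ (N ℕ.+ N)) ⟩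
      z ^ᶜ suc (i ℕ.+ j) *ᶜ (c *ᶜ c ^ᶜ (N ℕ.+ N))  ≡⟨ cong₂ _*ᶜ_ (cong (z ^ᶜ_) (trans eq (pos-edge/ k))) (*ᶜ-comm c (c ^ᶜ (N ℕ.+ N))) ⟩
      z ^ᶜ (N ℕ.+ N ℕ.+ e) *ᶜ (c ^ᶜ (N ℕ.+ N) *ᶜ c)  ≡⟨ *ᶜ-assoc (z ^ᶜ (N ℕ.+ N ℕ.+ e)) (c ^ᶜ (N ℕ.+ N)) c ⟨
      z ^ᶜ (N ℕ.+ N ℕ.+ e) *ᶜ c ^ᶜ (N ℕ.+ N) *ᶜ c  ≡⟨ cong (_*ᶜ c) (^ᶜ-+-conj unit (N ℕ.+ N) e) ⟩
      z ^ᶜ e *ᶜ c                                         ∎)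

  fourier : ℕ → ℂ
  fourier j = sumᶜ (λ v → phase v ^ᶜ j)

  power : ℕ → ℚ
  power j = ∣ fourier j ∣²

  power-nonNeg : ∀ j → 0ℚ ≤ power j
  power-nonNeg j = ∣∣²-nonNeg (fourier j)

  module Spectral (i : ℕ) (i<Q : suc i ℕ.≤ Q) where

    -- W turns |F²| into the sum of the terms φ u v ≤ ρ; those on edges almost cancel,
    -- because the edge labels fill a period up to n gaps.
    j : ℕ
    j = suc i

    F W : ℂ
    F = fourier j
    W = conj F *ᶜ conj F

    ρ B η : ℚ
    ρ = power j
    B = ι (j ℕ.* 4)
    η = ι j * ε

    0≤ρ : 0ℚ ≤ ρ
    0≤ρ = power-nonNeg j

    0≤η : 0ℚ ≤ η
    0≤η = *-nonNeg (ι-nonNeg j) (<⇒≤ 0<ε)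

    W-norm : ∣ W ∣² ≡ ρ * ρ
    W-norm = trans (∣∣²-* (conj F) (conj F)) (cong₂ _*_ (∣∣²-conj F) (∣∣²-conj F))

    re-W≤ : ∀ x → ∣ x ∣² ≡ 1ℚ → re (W *ᶜ x) ≤ ρ
    re-W≤ x x-unit = ≤-trans
      (re-*≤ W x 0≤ρ 0≤1 (≤-reflexive W-norm) (≤-reflexive (trans x-unit refl)))
      (≤-reflexive (*-identityʳ ρ))

    φ : Fin n → Fin n → ℚ
    φ u v = re (W *ᶜ (phase u ^ᶜ j *ᶜ phase v ^ᶜ j))

    φ≤ρ : ∀ u v → φ u v ≤ ρ
    φ≤ρ u v = re-W≤ (phase u ^ᶜ j *ᶜ phase v ^ᶜ j) (trans (∣∣²-* (phase u ^ᶜ j) (phase v ^ᶜ j))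
      (cong₂ _*_ (∣∣²-^ᶜ j (phase-unit u)) (∣∣²-^ᶜ j (phase-unit v))))

    sum-φ : sum₂ φ ≡ ρ * ρ
    sum-φ = begin
      sum₂ φ  ≡⟨ sum-cong-≗ (λ u → sum-cong-≗ (λ v → cong re (*ᶜ-assoc W (phase u ^ᶜ j) (phase v ^ᶜ j)))) ⟨
      sum (λ u → sum (λ v → re (W *ᶜ phase u ^ᶜ j *ᶜ phase v ^ᶜ j))) ≡⟨ sum-cong-≗ (λ u → sum-re-* (W *ᶜ phase u ^ᶜ j) (λ v → phase v ^ᶜ j)) ⟩
      sum (λ u → re (W *ᶜ phase u ^ᶜ j *ᶜ F))  ≡⟨ sum-cong-≗ (λ u → cong re (rearrange u)) ⟩
      sum (λ u → re (W *ᶜ F *ᶜ phase u ^ᶜ j))  ≡⟨ sum-re-* (W *ᶜ F) (λ u → phase u ^ᶜ j) ⟩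
      re (W *ᶜ F *ᶜ F)                                        ≡⟨ ident (re F) (im F) ⟩
      ρ * ρ                                                   ∎
      where
      open ≡-Reasoning
      rearrange : ∀ u → W *ᶜ phase u ^ᶜ j *ᶜ F ≡ W *ᶜ F *ᶜ phase u ^ᶜ j
      rearrange u = trans (*ᶜ-assoc W (phase u ^ᶜ j) F)
        (trans (cong (W *ᶜ_) (*ᶜ-comm (phase u ^ᶜ j) F)) (sym (*ᶜ-assoc W F (phase u ^ᶜ j))))
      ident : ∀ a b →
        ((a * a - - b * - b) * a - (a * - b + - b * a) * b) * a - ((a * a - - b * - b) * b + (a * - b + - b * a) * a) * b ≡
        (a * a + b * b) * (a * a + b * b)
      ident = solve-∀ ℚ-ring

    χ : ℕ → ℚ
    χ r = re (W *ᶜ z ^ᶜ (r ℕ.* j))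

    χ≤ρ : ∀ r → χ r ≤ ρ
    χ≤ρ r = re-W≤ (z ^ᶜ (r ℕ.* j)) (z^-unit (r ℕ.* j))

    -χ≤ρ : ∀ r → - χ r ≤ ρ
    -χ≤ρ r = ≤-trans (≤-reflexive (ident (re W) (im W) (re x) (im x)))
      (re-W≤ (- re x +𝐢 - im x) (trans (cong₂ _+_ ([-a]² (re x)) ([-a]² (im x))) (z^-unit (r ℕ.* j))))
      where
      x = z ^ᶜ (r ℕ.* j)
      ident : ∀ a b c d → - (a * c - b * d) ≡ a * - c - b * - d
      ident = solve-∀ ℚ-ring

    -- A lost step multiplies the j-th power by the conjugate of z^j, which is within jε of 1.
    φ-edge : ∀ k → φ (tail G k) (head G k) ≤ χ (elab k ℕ./ w) + ρ * η
    φ-edge k = subst (λ x → re (W *ᶜ x) ≤ χ e + ρ * η) (*ᶜ-^ᶜ (phase (tail G k)) (phase (head G k)) j) (cases (phase-edge k))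
      where
      e = elab k ℕ./ w
      x = phase (tail G k) *ᶜ phase (head G k)
      zʲ = z ^ᶜ j
      e-pow : (z ^ᶜ e) ^ᶜ j ≡ z ^ᶜ (e ℕ.* j)
      e-pow = trans (sym (^ᶜ-* z e j)) (cong (z ^ᶜ_) (ℕP.*-comm j e))
      y = z ^ᶜ (e ℕ.* j)
      d = conj zʲ -ᶜ 1ᶜ
      ∣d∣² : ∣ d ∣² ≤ η * η
      ∣d∣² = begin
        ∣ d ∣²                        ≡⟨ ident (re zʲ) (im zʲ) ⟩
        ∣ zʲ -ᶜ 1ᶜ ∣²                 ≤⟨ ∣^-1∣²≤ j unit ⟩
        ι j * ι j * ∣ z -ᶜ 1ᶜ ∣²      ≤⟨ *-monoʳ (²-nonNeg (ι j)) small ⟩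
        ι j * ι j * (ε * ε)           ≡⟨ ident₂ (ι j) ε ⟩
        η * η                         ∎
        where
        open ≤-Reasoning
        ident : ∀ a b → (a - 1ℚ) * (a - 1ℚ) + (- b - 0ℚ) * (- b - 0ℚ) ≡ (a - 1ℚ) * (a - 1ℚ) + (b - 0ℚ) * (b - 0ℚ)
        ident = solve-∀ ℚ-ring
        ident₂ : ∀ a b → a * a * (b * b) ≡ a * b * (a * b)
        ident₂ = solve-∀ ℚ-ring
      split : re (W *ᶜ (y *ᶜ conj zʲ)) ≡ χ e + re (W *ᶜ y *ᶜ d)
      split = ident (re W) (im W) (re y) (im y) (re zʲ) (im zʲ)
        where
        ident : ∀ a b c d p q → a * (c * p - d * - q) - b * (c * - q + d * p) ≡
          a * c - b * d + ((a * c - b * d) * (p - 1ℚ) - (a * d + b * c) * (- q - 0ℚ))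
        ident = solve-∀ ℚ-ring
      cases : x ≡ z ^ᶜ e ⊎ x ≡ z ^ᶜ e *ᶜ conj z → re (W *ᶜ x ^ᶜ j) ≤ χ e + ρ * η
      cases (inj₁ eq) = ≤-trans (≤-reflexive (cong (λ t → re (W *ᶜ t)) (trans (cong (_^ᶜ j) eq) e-pow)))
        (≤-by (ρ * η) refl (*-nonNeg 0≤ρ 0≤η))
      cases (inj₂ eq) = ≤-trans (≤-reflexive (trans
          (cong (λ t → re (W *ᶜ t)) (trans (cong (_^ᶜ j) eq) (trans (*ᶜ-^ᶜ (z ^ᶜ e) (conj z) j)
            (cong₂ _*ᶜ_ e-pow (sym (conj-^ᶜ z j)))))) split))
        (+-monoʳ-≤ (χ e) (re-*≤ (W *ᶜ y) d 0≤ρ 0≤η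
          (≤-reflexive (trans (∣∣²-* W y) (trans (cong₂ _*_ W-norm (z^-unit (e ℕ.* j))) (*-identityʳ (ρ * ρ)))))
          ∣d∣²))

    Σχ≤ : Σ< N (λ r → χ (r ℕ./ w)) ≤ ι w * (ρ * B) + ι P * ρ
    Σχ≤ = begin
      Σ< N (λ r → χ (r ℕ./ w))  ≡⟨ cong (λ k → Σ< k (λ r → χ (r ℕ./ w))) N≡ ⟩
      Σ< (P ℕ.* w ℕ.+ rem) (λ r → χ (r ℕ./ w))  ≡⟨ Σ<-split (P ℕ.* w) rem (λ r → χ (r ℕ./ w)) ⟩
      Σ< (P ℕ.* w) (λ r → χ (r ℕ./ w)) + Σ< rem (λ r → χ ((P ℕ.* w ℕ.+ r) ℕ./ w))  ≤⟨ +-mono-≤ blocks rest ⟩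
      ι w * (ρ * B) + ι P * ρ                                             ∎
      where
      open ≤-Reasoning
      blocks : Σ< (P ℕ.* w) (λ r → χ (r ℕ./ w)) ≤ ι w * (ρ * B)
      blocks = begin
        Σ< (P ℕ.* w) (λ r → χ (r ℕ./ w))                ≡⟨ Σ<-blocks P w χ ⟩
        ι w * Σ< P χ  ≡⟨ cong (_*_ (ι w)) (Σ<-re-* P W (λ r → z ^ᶜ (r ℕ.* j))) ⟩
        ι w * re (W *ᶜ Σᶜ< P (λ r → z ^ᶜ (r ℕ.* j)))  ≤⟨ *-monoʳ (ι-nonNeg w) (re-*≤ W (Σᶜ< P (λ r → z ^ᶜ (r ℕ.* j))) 0≤ρ (ι-nonNeg (j ℕ.* 4))
                                                             (≤-reflexive W-norm) (∣full-turn∣²≤ i i<Q)) ⟩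
        ι w * (ρ * B)                                   ∎
      rest : Σ< rem (λ r → χ ((P ℕ.* w ℕ.+ r) ℕ./ w)) ≤ ι P * ρ
      rest = begin
        Σ< rem (λ r → χ ((P ℕ.* w ℕ.+ r) ℕ./ w))  ≤⟨ Σ<-mono rem (λ r _ → χ≤ρ ((P ℕ.* w ℕ.+ r) ℕ./ w)) ⟩
        Σ< rem (λ _ → ρ)                           ≡⟨ Σ<-const rem ρ ⟩
        ι rem * ρ                                  ≤⟨ *-monoˡ 0≤ρ (ι-mono rem≤) ⟩
        ι P * ρ                                    ∎

    -- Here n² - 2m counts the nonadjacent ordered pairs. The bracket collects what the edges
    -- contribute: rounding, the n missing labels, the imperfect full turn of blocks, and the
    -- leftover labels. The factor 2 is for the two orientations.
    D : ℚ
    D = ι n * ι n - 2ℚ * ι m + 2ℚ * (ι m * η + ι n + ι w * B + ι P)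

    sum-edges : sum (λ k → φ (tail G k) (head G k)) ≤ ρ * (ι m * η + ι n + ι w * B + ι P)
    sum-edges = begin
      sum (λ k → φ (tail G k) (head G k))                     ≤⟨ sum-mono φ-edge ⟩
      sum (λ k → χ (elab k ℕ./ w) + ρ * η)  ≡⟨ ∑-distrib-+ (λ k → χ (elab k ℕ./ w)) (λ _ → ρ * η) ⟩
      E + sum {m} (λ _ → ρ * η)  ≡⟨ cong (_+_ E) (sum-const m (ρ * η)) ⟩
      E + ι m * (ρ * η)                                       ≤⟨ +-monoˡ-≤ (ι m * (ρ * η)) E≤ ⟩
      ι w * (ρ * B) + ι P * ρ + ι n * ρ + ι m * (ρ * η)  ≡⟨ ident (ι w) ρ B (ι P) (ι n) (ι m) η ⟩
      ρ * (ι m * η + ι n + ι w * B + ι P)                     ∎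
      where
      open ≤-Reasoning
      E = sum (λ k → χ (elab k ℕ./ w))
      V = sum (λ v → χ (vlab v ℕ./ w))
      ident : ∀ w ρ B P n m η → w * (ρ * B) + P * ρ + n * ρ + m * (ρ * η) ≡ ρ * (m * η + n + w * B + P)
      ident = solve-∀ ℚ-ring
      0≤V+nρ : 0ℚ ≤ V + ι n * ρ
      0≤V+nρ = ≤-trans
        (≤-reflexive (sym (trans (sum-const n 0ℚ) (*-zeroʳ (ι n)))))
        (≤-trans (sum-mono (λ v → ≤-trans (≤⇒0≤- (-χ≤ρ (vlab v ℕ./ w))) (≤-reflexive (flip (χ (vlab v ℕ./ w)) ρ))))
          (≤-reflexive (trans (∑-distrib-+ (λ v → χ (vlab v ℕ./ w)) (λ _ → ρ)) (cong (_+_ V) (sum-const n ρ)))))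
        where
        flip : ∀ a b → b - - a ≡ a + b
        flip = solve-∀ ℚ-ring
      -- The edge labels are all labels but those of the vertices, and each omitted term has modulus
      -- at most ρ.
      E≤ : E ≤ ι w * (ρ * B) + ι P * ρ + ι n * ρ
      E≤ = ≤-by ((ι w * (ρ * B) + ι P * ρ - Σ< N (λ r → χ (r ℕ./ w))) + (V + ι n * ρ))
        (≡-by₁ 1ℚ (ident₂ (ι w * (ρ * B) + ι P * ρ) (ι n * ρ) V E (Σ< N (λ r → χ (r ℕ./ w)))) (sym (sum-labels (λ r → χ (r ℕ./ w)))))
        (+-nonNeg (≤⇒0≤- Σχ≤) 0≤V+nρ)
        where
        ident₂ : ∀ a b v e s → a + b ≡ e + ((a - s) + (v + b)) + 1ℚ * (s - (v + e))
        ident₂ = solve-∀ ℚ-ring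

    -- `edges≤pairs` applied to ρ - φ ≥ 0, whose sum over all pairs is n²ρ - ρ². The factor ρ stays,
    -- as it may vanish.
    spectral : ρ * ρ ≤ ρ * D
    spectral = ≤-by
      ((ι n * (ι n * ρ) - ρ * ρ - (ι m * ρ - Φ + (ι m * ρ - Φ))) + 2ℚ * (ρ * (ι m * η + ι n + ι w * B + ι P) - Φ))
      (ident (ι n) (ι m) ρ Φ (ι m * η + ι n + ι w * B + ι P))
      (+-nonNeg (≤⇒0≤- pairs) (*-nonNeg 0≤2 (≤⇒0≤- sum-edges)))
      where
      Φ = sum (λ k → φ (tail G k) (head G k))
      ident : ∀ n m ρ Φ x → ρ * (n * n - 2ℚ * m + 2ℚ * x) ≡
        ρ * ρ + ((n * (n * ρ) - ρ * ρ - (m * ρ - Φ + (m * ρ - Φ))) + 2ℚ * (ρ * x - Φ))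
      ident = solve-∀ ℚ-ring
      sum-diff : ∀ {k} c (f : Fin k → ℚ) → sum (λ x → c - f x) ≡ ι k * c - sum f
      sum-diff {k} c f = trans (sum-cong-≗ (λ x → neg c (f x))) (trans (sum-lin 1ℚ 1ℚ (λ _ → c) f)
        (trans (cong (λ x → 1ℚ * x - 1ℚ * sum f) (sum-const k c)) (sym (neg (ι k * c) (sum f)))))
        where
        neg : ∀ a b → a - b ≡ 1ℚ * a - 1ℚ * b
        neg = solve-∀ ℚ-ring
      φ-comm : ∀ u v → φ u v ≡ φ v u
      φ-comm u v = cong (λ x → re (W *ᶜ x)) (*ᶜ-comm (phase u ^ᶜ j) (phase v ^ᶜ j))
      pairs : ι m * ρ - Φ + (ι m * ρ - Φ) ≤ ι n * (ι n * ρ) - ρ * ρ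
      pairs = subst₂ _≤_
        (cong₂ _+_ (sum-diff ρ (λ k → φ (tail G k) (head G k)))
          (trans (sum-cong-≗ (λ k → cong (λ x → ρ - x) (φ-comm (head G k) (tail G k)))) (sum-diff ρ (λ k → φ (tail G k) (head G k)))))
        (trans (sum-cong-≗ (λ u → sum-diff ρ (φ u)))
          (trans (sum-lin′ (λ u → sum (φ u))) (cong (λ x → ι n * (ι n * ρ) - x) sum-φ)))
        (edges≤pairs G (λ u v → ρ - φ u v) (λ u v → ≤⇒0≤- (φ≤ρ u v)))
        where
        sum-lin′ : ∀ (f : Fin n → ℚ) → sum (λ u → ι n * ρ - f u) ≡ ι n * (ι n * ρ) - sum f
        sum-lin′ f = sum-diff (ι n * ρ) f

  -- Two low vertices are never adjacent, nor are two high ones.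
  Low High : Fin n → Set
  Low v = 2 ℕ.* vlab v ℕ.+ N ℕ.≤ s′
  High v = s′ ℕ.< 2 ℕ.* vlab v

  low? : ∀ v → Dec (Low v)
  low? v = 2 ℕ.* vlab v ℕ.+ N ℕP.≤? s′

  high? : ∀ v → Dec (High v)
  high? v = s′ ℕP.<? 2 ℕ.* vlab v

  lo hi : Fin n → ℚ
  lo v = indicator (low? v)
  hi v = indicator (high? v)

  double : ∀ k → 2 ℕ.* vlab (tail G k) ℕ.+ 2 ℕ.* vlab (head G k) ℕ.+ 2 ℕ.* elab k ≡ 2 ℕ.* s′
  double k = trans (ident (vlab (tail G k)) (vlab (head G k)) (elab k)) (cong (2 ℕ.*_) (magic′ k))
    where
    ident : ∀ a b c → 2 ℕ.* a ℕ.+ 2 ℕ.* b ℕ.+ 2 ℕ.* c ≡ 2 ℕ.* (a ℕ.+ b ℕ.+ c)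
    ident = ℕSolver.solve-∀

  lo-edge : ∀ k → lo (tail G k) * lo (head G k) ≡ 0ℚ
  lo-edge k with low? (tail G k) | low? (head G k)
  ... | no _ | no _ = refl
  ... | no _ | yes _ = refl
  ... | yes _ | no _ = refl
  ... | yes p | yes q = contradiction (elab<N k) (ℕP.≤⇒≯ (ℕP.*-cancelˡ-≤ 2 (ℕP.+-cancelˡ-≤ (a ℕ.+ b) _ _ (begin
    a ℕ.+ b ℕ.+ 2 ℕ.* N               ≡⟨ ident a b N ⟩
    (a ℕ.+ N) ℕ.+ (b ℕ.+ N)           ≤⟨ ℕP.+-mono-≤ p q ⟩
    s′ ℕ.+ s′                         ≡⟨ cong (s′ ℕ.+_) (ℕP.+-identityʳ s′) ⟨
    2 ℕ.* s′                          ≡⟨ double k ⟨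
    a ℕ.+ b ℕ.+ 2 ℕ.* elab k          ∎))))
    where
    open ℕP.≤-Reasoning
    a = 2 ℕ.* vlab (tail G k)
    b = 2 ℕ.* vlab (head G k)
    ident : ∀ a b n → a ℕ.+ b ℕ.+ 2 ℕ.* n ≡ (a ℕ.+ n) ℕ.+ (b ℕ.+ n)
    ident = ℕSolver.solve-∀

  hi-edge : ∀ k → hi (tail G k) * hi (head G k) ≡ 0ℚ
  hi-edge k with high? (tail G k) | high? (head G k)
  ... | no _ | no _ = refl
  ... | no _ | yes _ = refl
  ... | yes _ | no _ = refl
  ... | yes p | yes q = contradiction (ℕP.+-mono-< p q) (ℕP.≤⇒≯ (begin
    2 ℕ.* vlab (tail G k) ℕ.+ 2 ℕ.* vlab (head G k)  ≤⟨ ℕP.m≤m+n _ (2 ℕ.* elab k) ⟩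
    2 ℕ.* vlab (tail G k) ℕ.+ 2 ℕ.* vlab (head G k) ℕ.+ 2 ℕ.* elab k   ≡⟨ double k ⟩
    2 ℕ.* s′  ≡⟨ cong (s′ ℕ.+_) (ℕP.+-identityʳ s′) ⟩
    s′ ℕ.+ s′                                                          ∎))
    where open ℕP.≤-Reasoning

  -- Nonnegative because no vertex is both low and high, and equal to 1 on every edge, so that
  -- `edges≤pairs` counts the edges.
  outside : Fin n → Fin n → ℚ
  outside u v = 1ℚ - lo u * lo v - hi u * hi v

  outside-nonNeg : ∀ u v → 0ℚ ≤ outside u v
  outside-nonNeg u v with low? u | high? u
  ... | yes p | yes q = contradiction q (ℕP.≤⇒≯ (ℕP.≤-trans (ℕP.m≤m+n _ N) p))
  ... | no _ | no _ = subst (0ℚ ≤_) (ident (lo v) (hi v)) 0≤1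
    where
    ident : ∀ a b → 1ℚ ≡ 1ℚ - 0ℚ * a - 0ℚ * b
    ident = solve-∀ ℚ-ring
  ... | yes _ | no _ = subst (0ℚ ≤_) (ident (lo v) (hi v)) (≤⇒0≤- (indicator≤1 (low? v)))
    where
    ident : ∀ a b → 1ℚ - a ≡ 1ℚ - 1ℚ * a - 0ℚ * b
    ident = solve-∀ ℚ-ring
  ... | no _ | yes _ = subst (0ℚ ≤_) (ident (lo v) (hi v)) (≤⇒0≤- (indicator≤1 (high? v)))
    where
    ident : ∀ a b → 1ℚ - b ≡ 1ℚ - 0ℚ * a - 1ℚ * b
    ident = solve-∀ ℚ-ring

  lows highs : ℚ
  lows = sum lo
  highs = sum hi

  outliers : lows * lows + highs * highs ≤ ι n * ι n - 2ℚ * ι m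
  outliers = ≤-by (ι n * ι n - lows * lows - highs * highs - (ι m + ι m))
    (ident (ι n) (ι m) lows highs)
    (≤⇒0≤- (subst₂ _≤_
      (cong₂ _+_ (trans (sum-cong-≗ (λ k → cong₂ (λ x y → 1ℚ - x - y) (lo-edge k) (hi-edge k))) ones)
        (trans (sum-cong-≗ (λ k → cong₂ (λ x y → 1ℚ - x - y) (trans (ℚP.*-comm (lo (head G k)) (lo (tail G k))) (lo-edge k))
                                                            (trans (ℚP.*-comm (hi (head G k)) (hi (tail G k))) (hi-edge k)))) ones))
      sum₂≡
      (edges≤pairs G outside outside-nonNeg)))
    where
    ident : ∀ n m a b → n * n - 2ℚ * m ≡ a * a + b * b + (n * n - a * a - b * b - (m + m))
    ident = solve-∀ ℚ-ring
    ones : sum {m} (λ _ → 1ℚ) ≡ ι m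
    ones = trans (sum-const m 1ℚ) (*-identityʳ (ι m))
    sum-lin₃ : ∀ {k} c a b (f g : Fin k → ℚ) → sum (λ v → c - a * f v - b * g v) ≡ ι k * c - a * sum f - b * sum g
    sum-lin₃ {zero} c a b f g = sym (trans (cong (λ x → x * c - a * 0ℚ - b * 0ℚ) ι-0) (id₀ c a b))
      where
      id₀ : ∀ c a b → 0ℚ * c - a * 0ℚ - b * 0ℚ ≡ 0ℚ
      id₀ = solve-∀ ℚ-ring
    sum-lin₃ {suc k} c a b f g = trans
      (cong (_+_ (c - a * f Fin.zero - b * g Fin.zero)) (sum-lin₃ c a b (f ∘ Fin.suc) (g ∘ Fin.suc)))
      (trans (id₁ c a b (f Fin.zero) (g Fin.zero) (ι k) (sum (f ∘ Fin.suc)) (sum (g ∘ Fin.suc)))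
        (cong (λ x → x * c - a * sum f - b * sum g) (sym (ι-suc k))))
      where
      id₁ : ∀ c a b x y k s t → c - a * x - b * y + (k * c - a * s - b * t) ≡ (k + 1ℚ) * c - a * (x + s) - b * (y + t)
      id₁ = solve-∀ ℚ-ring
    comm : ∀ c a b x y → c - a * x - b * y ≡ c - x * a - y * b
    comm = solve-∀ ℚ-ring
    sum₂≡ : sum₂ outside ≡ ι n * ι n - lows * lows - highs * highs
    sum₂≡ = trans (sum-cong-≗ (λ u → trans (sum-lin₃ 1ℚ (lo u) (hi u) lo hi) (comm (ι n * 1ℚ) (lo u) (hi u) lows highs)))
      (trans (sum-lin₃ (ι n * 1ℚ) lows highs lo hi) (cong (λ x → ι n * x - lows * lows - highs * highs) (*-identityʳ (ι n))))

  -- A vertex neither low nor high has 0 ≤ s′ - 2a < N, that is, between 0 and 2Q steps.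
  phase-middle : ∀ v → ¬ Low v → ¬ High v → 0ℚ ≤ im (phase v) + 2ℚ * ε
  phase-middle v ¬low ¬high = subst (λ x → 0ℚ ≤ im x + 2ℚ * ε)
    (sym (trans (cong (λ i → z ^ᶜ i *ᶜ conj z ^ᶜ N) idx≡) (^ᶜ-+-conj unit N (e ℕ./ (2 ℕ.* w)))))
    (half-turn (e ℕ./ (2 ℕ.* w)) (ℕP.≤-pred (ℕD.m<n*o⇒m/o<n e<)))
    where
    a = vlab v
    e = s′ ℕ.∸ 2 ℕ.* a
    2a≤s′ : 2 ℕ.* a ℕ.≤ s′
    2a≤s′ = ℕP.≮⇒≥ ¬high
    e+2a : e ℕ.+ 2 ℕ.* a ≡ s′
    e+2a = ℕP.m∸n+n≡m 2a≤s′
    pos≡ : pos v ≡ N ℕ.* (2 ℕ.* w) ℕ.+ e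
    pos≡ = ℕP.+-cancelʳ-≡ (2 ℕ.* a) _ _ (trans (pos+vlab v)
      (trans (cong (ℕ._+ 2 ℕ.* (N ℕ.* w)) (sym e+2a)) (ident e (2 ℕ.* a) N w)))
      where
      ident : ∀ e a N w → e ℕ.+ a ℕ.+ 2 ℕ.* (N ℕ.* w) ≡ N ℕ.* (2 ℕ.* w) ℕ.+ e ℕ.+ a
      ident = ℕSolver.solve-∀
    idx≡ : idx v ≡ N ℕ.+ e ℕ./ (2 ℕ.* w)
    idx≡ = trans (cong (ℕ._/ (2 ℕ.* w)) pos≡) ([k*w+e]/w N e (2 ℕ.* w))
    e<N : e ℕ.< N
    e<N = ℕP.+-cancelʳ-< (2 ℕ.* a) e N (subst₂ ℕ._<_ (sym e+2a) (ℕP.+-comm (2 ℕ.* a) N) (ℕP.≰⇒> ¬low))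
    -- The leftover is at most P = 4Q ≤ 2w, one unit of 2w, so the quotient still does not exceed
    -- 2Q.
    e< : e ℕ.< suc (2 ℕ.* Q) ℕ.* (2 ℕ.* w)
    e< = begin-strict
      e                                      <⟨ e<N ⟩
      N                                      ≡⟨ N≡ ⟩
      P ℕ.* w ℕ.+ rem  ≤⟨ ℕP.+-monoʳ-≤ (P ℕ.* w) (ℕP.≤-trans rem≤ (subst (ℕ._≤ 2 ℕ.* w) (ident₁ Q) (ℕP.*-monoʳ-≤ 2 2Q≤w))) ⟩
      P ℕ.* w ℕ.+ 2 ℕ.* w                    ≡⟨ ident₂ Q w ⟩
      suc (2 ℕ.* Q) ℕ.* (2 ℕ.* w)            ∎
      where
      open ℕP.≤-Reasoning
      ident₁ : ∀ Q → 2 ℕ.* (2 ℕ.* Q) ≡ 4 ℕ.* Q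
      ident₁ = ℕSolver.solve-∀
      ident₂ : ∀ Q w → 4 ℕ.* Q ℕ.* w ℕ.+ 2 ℕ.* w ≡ (1 ℕ.+ 2 ℕ.* Q) ℕ.* (2 ℕ.* w)
      ident₂ = ℕSolver.solve-∀

  -1≤im : ∀ v → 0ℚ ≤ im (phase v) + 1ℚ
  -1≤im v = subst (0ℚ ≤_) (ident (im (phase v))) (≤⇒0≤-
    (im≤ (conj (phase v)) 0≤1 (≤-reflexive (trans (∣∣²-conj (phase v)) (phase-unit v)))))
    where
    ident : ∀ y → 1ℚ - - y ≡ y + 1ℚ
    ident = solve-∀ ℚ-ring

  slack : Fin n → ℚ
  slack v = 2ℚ * ε + (lo v + hi v)

  0≤slack : ∀ v → 0ℚ ≤ slack v
  0≤slack v = +-nonNeg (*-nonNeg 0≤2 (<⇒≤ 0<ε)) (+-nonNeg (0≤indicator (low? v)) (0≤indicator (high? v)))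

  im+slack : ∀ v → 0ℚ ≤ im (phase v) + slack v
  im+slack v with low? v | high? v
  ... | no p | no q = subst (λ x → 0ℚ ≤ im (phase v) + x) (sym (+-identityʳ (2ℚ * ε))) (phase-middle v p q)
  ... | yes _ | h = subst (0ℚ ≤_) (ident (im (phase v)) ε (indicator h))
    (+-nonNeg (-1≤im v) (+-nonNeg (*-nonNeg 0≤2 (<⇒≤ 0<ε)) (0≤indicator h)))
    where
    ident : ∀ y e h → y + 1ℚ + (2ℚ * e + h) ≡ y + (2ℚ * e + (1ℚ + h))
    ident = solve-∀ ℚ-ring
  ... | no _ | yes _ = subst (0ℚ ≤_) (ident (im (phase v)) ε) (+-nonNeg (-1≤im v) (*-nonNeg 0≤2 (<⇒≤ 0<ε)))
    where
    ident : ∀ y e → y + 1ℚ + 2ℚ * e ≡ y + (2ℚ * e + (0ℚ + 1ℚ))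
    ident = solve-∀ ℚ-ring

  -- Passing from y to |y| costs twice the slack; for outliers this doubling is the 2 in 1 + 2√2.
  sum-∣im∣ : sum (λ v → ℚ.∣ im (phase v) ∣) ≤ im (fourier 1) + 2ℚ * (ι n * (2ℚ * ε) + (lows + highs))
  sum-∣im∣ = begin
    sum (λ v → ℚ.∣ im (phase v) ∣)  ≤⟨ sum-mono (λ v → ∣∣≤ (im (phase v)) (0≤slack v) (im+slack v)) ⟩
    sum (λ v → im (phase v) + 2ℚ * slack v)  ≡⟨ ∑-distrib-+ (im ∘ phase) (λ v → 2ℚ * slack v) ⟩
    sum (im ∘ phase) + sum (λ v → 2ℚ * slack v)  ≡⟨ cong₂ _+_ (sum-cong-≗ (λ v → cong im (sym (*ᶜ-identityˡ (phase v))))) (sym (*-distribˡ-sum 2ℚ slack)) ⟩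
    im (fourier 1) + 2ℚ * sum slack  ≡⟨ cong (λ x → im (fourier 1) + 2ℚ * x) sum-slack ⟩
    im (fourier 1) + 2ℚ * (ι n * (2ℚ * ε) + (lows + highs)) ∎
    where
    open ≤-Reasoning
    sum-slack : sum slack ≡ ι n * (2ℚ * ε) + (lows + highs)
    sum-slack = trans (∑-distrib-+ (λ _ → 2ℚ * ε) (λ v → lo v + hi v)) (cong₂ _+_ (sum-const n (2ℚ * ε)) (∑-distrib-+ lo hi))

  -- Even moments of the cosine and the mean of |sin|

  cos² : Fin n → ℚ
  cos² v = re (phase v) * re (phase v)

  twice : Fin n → ℕ → ℂ
  twice v k = (phase v ^ᶜ 2) ^ᶜ k

  -- Because cos² θ = (1 + cos 2θ)/2, these satisfy the recursion of `walk` in j and k, with the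
  -- even exponential sums as initial values. The expansion of cos²ʲ is thus never written out.
  moment : ℕ → ℕ → ℚ
  moment j k = sum (λ v → cos² v ^ j * re (twice v k))

  cos²-twice : ∀ v → cos² v ≡ ½ + ½ * re (phase v ^ᶜ 2)
  cos²-twice v = ≡-by₁ ½ (ident (re (phase v)) (im (phase v))) (phase-unit v)
    where
    ident : ∀ a b → a * a ≡ ½ + ½ * ((1ℚ * a - 0ℚ * b) * a - (1ℚ * b + 0ℚ * a) * b) + ½ * (a * a + b * b - 1ℚ)
    ident = solve-∀ ℚ-ring

  moment-0 : ∀ k → moment 0 k ≡ re (fourier (k ℕ.* 2))
  moment-0 k = sum-cong-≗ (λ v → trans (*-identityˡ (re (twice v k))) (cong re (sym (^ᶜ-* (phase v) 2 k))))

  moment-suc-0 : ∀ j → moment (suc j) 0 ≡ ½ * moment j 0 + ½ * moment j 1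
  moment-suc-0 j = trans (sum-cong-≗ term) (trans (∑-distrib-+ (λ v → ½ * (cos² v ^ j * re (twice v 0))) (λ v → ½ * (cos² v ^ j * re (twice v 1))))
    (sym (cong₂ _+_ (*-distribˡ-sum ½ (λ v → cos² v ^ j * re (twice v 0))) (*-distribˡ-sum ½ (λ v → cos² v ^ j * re (twice v 1))))))
    where
    ident : ∀ p x y → p * (½ + ½ * x) * 1ℚ ≡ ½ * (p * 1ℚ) + ½ * (p * (1ℚ * x - 0ℚ * y))
    ident = solve-∀ ℚ-ring
    term : ∀ v → cos² v ^ suc j * re (twice v 0) ≡ ½ * (cos² v ^ j * re (twice v 0)) + ½ * (cos² v ^ j * re (twice v 1))
    term v = trans (cong (λ x → cos² v ^ j * x * 1ℚ) (cos²-twice v))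
      (ident (cos² v ^ j) (re (phase v ^ᶜ 2)) (im (phase v ^ᶜ 2)))

  moment-suc-suc : ∀ j k → moment (suc j) (suc k) ≡ ½ * moment j (suc k) + ¼ * (moment j (suc (suc k)) + moment j k)
  moment-suc-suc j k = trans (sum-cong-≗ term)
    (trans (∑-distrib-+ (λ v → ½ * t (suc k) v) (λ v → ¼ * (t (suc (suc k)) v + t k v)))
      (sym (cong₂ _+_ (*-distribˡ-sum ½ (t (suc k)))
        (trans (cong (_*_ ¼) (sym (∑-distrib-+ (t (suc (suc k))) (t k)))) (*-distribˡ-sum ¼ (λ v → t (suc (suc k)) v + t k v))))))
    where
    t : ℕ → Fin n → ℚ
    t k v = cos² v ^ j * re (twice v k)
    ident : ∀ p a b x y → p * (½ + ½ * x) * (a * x - b * y) ≡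
      ½ * (p * (a * x - b * y)) + ¼ * (p * ((a * x - b * y) * x - (a * y + b * x) * y) + p * a)
      + (¼ * p * a) * (x * x + y * y - 1ℚ)
    ident = solve-∀ ℚ-ring
    term : ∀ v → cos² v ^ suc j * re (twice v (suc k)) ≡ ½ * t (suc k) v + ¼ * (t (suc (suc k)) v + t k v)
    term v = trans (cong (λ x → cos² v ^ j * x * re (twice v (suc k))) (cos²-twice v))
      (≡-by₁ (¼ * cos² v ^ j * re (twice v k))
        (ident (cos² v ^ j) (re (twice v k)) (im (twice v k)) (re (phase v ^ᶜ 2)) (im (phase v ^ᶜ 2)))
        (∣∣²-^ᶜ {phase v} 2 (phase-unit v)))

  module Bounded (D : ℚ) (J : ℕ) (im-bound : im (fourier 1) ≤ D)
    (re-bound : ∀ k → suc k ℕ.≤ J → re (fourier (suc k ℕ.* 2)) ≤ D) where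

    -- A convex combination for 0 ≤ p ≤ 1: the walk ends at frequency 0, which contributes n, with
    -- probability p, and elsewhere the contribution is at most D.
    mix : ℚ → ℚ
    mix p = p * ι n + (1ℚ - p) * D

    -- A walk of j steps from k reaches no frequency above j + k, so bounds up to J suffice.
    moment≤ : ∀ j k → j ℕ.+ k ℕ.≤ J → moment j k ≤ mix (walk j k)
    moment≤ zero zero _ = ≤-reflexive (trans (sum-const n (1ℚ * 1ℚ)) (ident (ι n) D))
      where
      ident : ∀ n d → n * (1ℚ * 1ℚ) ≡ 1ℚ * n + (1ℚ - 1ℚ) * d
      ident = solve-∀ ℚ-ring
    moment≤ zero (suc k) k<J = ≤-trans (≤-reflexive (moment-0 (suc k)))
      (≤-trans (re-bound k k<J) (≤-reflexive (ident (ι n) D)))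
      where
      ident : ∀ n d → d ≡ 0ℚ * n + (1ℚ - 0ℚ) * d
      ident = solve-∀ ℚ-ring
    moment≤ (suc j) zero le = ≤-trans (≤-reflexive (moment-suc-0 j))
      (≤-trans (+-mono-≤ (*-monoʳ 0≤½ (moment≤ j 0 (ℕP.<⇒≤ le)))
          (*-monoʳ 0≤½ (moment≤ j 1 (subst (ℕ._≤ J) (sym (ℕP.+-suc j 0)) le))))
        (≤-reflexive (ident (ι n) D (walk j 0) (walk j 1))))
      where
      ident : ∀ n d a b → ½ * (a * n + (1ℚ - a) * d) + ½ * (b * n + (1ℚ - b) * d) ≡
        (½ * a + ½ * b) * n + (1ℚ - (½ * a + ½ * b)) * d
      ident = solve-∀ ℚ-ring
    moment≤ (suc j) (suc k) le = ≤-trans (≤-reflexive (moment-suc-suc j k))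
      (≤-trans (+-mono-≤ (*-monoʳ 0≤½ (moment≤ j (suc k) (ℕP.<⇒≤ le)))
          (*-monoʳ 0≤¼ (+-mono-≤ (moment≤ j (suc (suc k)) (subst (ℕ._≤ J) (sym (ℕP.+-suc j (suc k))) le))
            (moment≤ j k (ℕP.≤-trans (ℕP.+-monoʳ-≤ j (ℕP.n≤1+n k)) (ℕP.<⇒≤ le))))))
        (≤-reflexive (ident (ι n) D (walk j (suc k)) (walk j (suc (suc k))) (walk j k))))
      where
      ident : ∀ n d a b c → ½ * (a * n + (1ℚ - a) * d) + ¼ * (b * n + (1ℚ - b) * d + (c * n + (1ℚ - c) * d)) ≡
        (½ * a + ¼ * (b + c)) * n + (1ℚ - (½ * a + ¼ * (b + c))) * d
      ident = solve-∀ ℚ-ring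

    cos²ʲ≤ : ∀ j → j ℕ.≤ J → sum (λ v → cos² v ^ j) ≤ mix (central j)
    cos²ʲ≤ j j≤J = ≤-trans (≤-reflexive (sum-cong-≗ (λ v → sym (*-identityʳ (cos² v ^ j)))))
      (moment≤ j 0 (subst (ℕ._≤ J) (sym (ℕP.+-identityʳ j)) j≤J))

    -- As n - `mix c` = (1 - c)(n - D), the factor n - D comes out of the whole series and leaves
    -- the sum evaluated by `wallis-sum`.
    sum-sqrtSeries : ∀ k → k ℕ.≤ J →
      (ι n - D) * Σ< k (λ j → weight j * (1ℚ - central (suc j))) ≤ sum (λ v → sqrtSeries (cos² v) k)
    sum-sqrtSeries zero _ = ≤-reflexive (trans (*-zeroʳ (ι n - D)) (sym (trans (sum-const n 0ℚ) (*-zeroʳ (ι n)))))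
    sum-sqrtSeries (suc k) k<J = begin
      (ι n - D) * (A + weight k * (1ℚ - c))           ≡⟨ ident (ι n) D A (weight k) c ⟩
      (ι n - D) * A + weight k * (ι n - mix c)  ≤⟨ +-mono-≤ (sum-sqrtSeries k (ℕP.<⇒≤ k<J)) (*-monoʳ (weight-nonNeg k)
                                                           (+-monoʳ-≤ (ι n) (neg-antimono-≤ (cos²ʲ≤ (suc k) k<J)))) ⟩
      sum (λ v → sqrtSeries (cos² v) k) + weight k * (ι n - S)  ≡⟨ cong (_+_ (sum (λ v → sqrtSeries (cos² v) k))) term ⟩
      sum (λ v → sqrtSeries (cos² v) k) + sum (λ v → weight k * (1ℚ - cos² v ^ suc k)) ≡⟨ ∑-distrib-+ (λ v → sqrtSeries (cos² v) k) (λ v → weight k * (1ℚ - cos² v ^ suc k)) ⟨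
      sum (λ v → sqrtSeries (cos² v) (suc k))         ∎
      where
      open ≤-Reasoning
      c = central (suc k)
      A = Σ< k (λ j → weight j * (1ℚ - central (suc j)))
      S = sum (λ v → cos² v ^ suc k)
      ident : ∀ n d a b c → (n - d) * (a + b * (1ℚ - c)) ≡ (n - d) * a + b * (n - (c * n + (1ℚ - c) * d))
      ident = solve-∀ ℚ-ring
      one : ∀ a b → 1ℚ * a - 1ℚ * b ≡ a - b
      one = solve-∀ ℚ-ring
      term : weight k * (ι n - S) ≡ sum (λ v → weight k * (1ℚ - cos² v ^ suc k))
      term = trans (cong (_*_ (weight k)) (trans (sym (one (ι n) S))
          (trans (cong (λ x → 1ℚ * x - 1ℚ * S) (sym (trans (sum-const n 1ℚ) (*-identityʳ (ι n)))))
            (trans (sym (sum-lin 1ℚ 1ℚ (λ _ → 1ℚ) (λ v → cos² v ^ suc k))) (sum-cong-≗ (λ v → one 1ℚ (cos² v ^ suc k)))))))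
        (*-distribˡ-sum (weight k) (λ v → 1ℚ - cos² v ^ suc k))

    mean-sine : (ι n - D) * (wallis J - central J) ≤ D + 2ℚ * (ι n * (2ℚ * ε) + (lows + highs))
    mean-sine = begin
      (ι n - D) * (wallis J - central J)          ≡⟨ cong (_*_ (ι n - D)) (wallis-sum J) ⟨
      (ι n - D) * Σ< J (λ j → weight j * (1ℚ - central (suc j)))  ≤⟨ sum-sqrtSeries J ℕP.≤-refl ⟩
      sum (λ v → sqrtSeries (cos² v) J)  ≤⟨ sum-mono (λ v → sqrtSeries-≤ {re (phase v)} {ℚ.∣ im (phase v) ∣} J (ℚP.0≤∣p∣ (im (phase v)))
                                                       (trans (cong (_+_ (cos² v)) (∣∣-² (im (phase v)))) (phase-unit v))) ⟩
      sum (λ v → ℚ.∣ im (phase v) ∣)              ≤⟨ sum-∣im∣ ⟩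
      im (fourier 1) + E                          ≤⟨ +-monoˡ-≤ E im-bound ⟩
      D + E                                       ∎
      where
      open ≤-Reasoning
      E = 2ℚ * (ι n * (2ℚ * ε) + (lows + highs))

-- The upper bound

common-lower : ∀ {a b} → 0ℚ < a → 0ℚ < b → ∃ λ h → 0ℚ < h × h ≤ a × h ≤ b
common-lower {a} {b} 0<a 0<b with ℚP.≤-total a b
... | inj₁ a≤b = a , 0<a , ≤-refl , a≤b
... | inj₂ b≤a = b , 0<b , b≤a , ≤-refl

ι-cancel-≤ : ∀ {m n} → ι m ≤ ι n → m ℕ.≤ n
ι-cancel-≤ {m} {n} le with m ℕP.≤? n
... | yes p = p
... | no ¬p = contradiction (≤-trans (ι-mono (ℕP.≰⇒> ¬p)) le)
  (λ le′ → ≤⇒≯ le′ (<-by 1ℚ (ι-suc n) 0<1))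

-- d n bounds the exponential sums when m > q n² (as d² > 1 − 2q), yet d < 2/(2 + (1 + 2B) A);
-- J truncates the square-root series and ε is the step of the rotation.
record Constants (q A B : ℚ) : Set where
  field
    d ε : ℚ
    J : ℕ
    0<d : 0ℚ < d
    d≤1 : d ≤ 1ℚ
    0<gap : 0ℚ < d * d - (1ℚ - 2ℚ * q)
    central-J : (2ℚ + A) * central J ≤ ¼ * (2ℚ - d * (2ℚ + (1ℚ + 2ℚ * B) * A))
    0<γ : 0ℚ < 2ℚ - d * (2ℚ + (1ℚ + 2ℚ * B) * A)
    0<ε : 0ℚ < ε
    4Aε≤ : 4ℚ * A * ε ≤ ¼ * (2ℚ - d * (2ℚ + (1ℚ + 2ℚ * B) * A))
    3Kε≤ : (2ℚ + 1ℚ) * ι (suc (J ℕ.* 2)) * ε ≤ ½ * (d * d - (1ℚ - 2ℚ * q))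
    rot : Rotation ε
    K≤Q : suc (J ℕ.* 2) ℕ.≤ suc (Rotation.q rot)

module ChooseConstants (q A B : ℚ) (0≤A : 0ℚ ≤ A) (0≤B : 0ℚ ≤ B)
  (below : (½ - q) * ((2ℚ + (1ℚ + 2ℚ * B) * A) * (2ℚ + (1ℚ + 2ℚ * B) * A)) < 2ℚ) where

  X κ y : ℚ
  X = 2ℚ + (1ℚ + 2ℚ * B) * A
  κ = 1ℚ - 2ℚ * q
  -- The critical value of d: 2 - dX vanishes at y, and `below` says that y² > 1 - 2q.
  y = 2ℚ * inv X

  2≤X : 2ℚ ≤ X
  2≤X = ≤-by ((1ℚ + 2ℚ * B) * A) refl (*-nonNeg (+-nonNeg 0≤1 (*-nonNeg 0≤2 0≤B)) 0≤A)

  0<X : 0ℚ < X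
  0<X = <-≤-trans (positive⁻¹ 2ℚ) 2≤X

  0<y : 0ℚ < y
  0<y = *-pos (positive⁻¹ 2ℚ) (inv-pos 0<X)

  Xy≡2 : X * y ≡ 2ℚ
  Xy≡2 = ≡-by₁ 2ℚ (ident X (inv X)) (inv-* 0<X)
    where
    ident : ∀ x r → x * (2ℚ * r) ≡ 2ℚ + 2ℚ * (x * r - 1ℚ)
    ident = solve-∀ ℚ-ring

  y≤1 : y ≤ 1ℚ
  y≤1 = *-cancelˡ 0<X (subst₂ _≤_ (sym Xy≡2) (sym (*-identityʳ X)) 2≤X)

  0<y²-κ : 0ℚ < y * y - κ
  0<y²-κ with 0ℚ ℚP.<? y * y - κ
  ... | yes p = p
  ... | no ¬p = contradiction below (≤⇒≯ (≤-by (½ * (X * X * (κ - y * y)))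
    (≡-by₁ (½ * (X * y + 2ℚ)) (ident X y q) Xy≡2)
    (*-nonNeg 0≤½ (*-nonNeg (²-nonNeg X) (subst (0ℚ ≤_) (flip (y * y) κ) (neg-antimono-≤ (≮⇒≥ ¬p)))))))
    where
    flip : ∀ a b → - (a - b) ≡ b - a
    flip = solve-∀ ℚ-ring
    ident : ∀ x y q → (½ - q) * (x * x) ≡ 2ℚ + ½ * (x * x * (1ℚ - 2ℚ * q - y * y)) + ½ * (x * y + 2ℚ) * (x * y - 2ℚ)
    ident = solve-∀ ℚ-ring

  h : ∃ λ h → 0ℚ < h × h ≤ y × h ≤ y * y - κ
  h = common-lower 0<y 0<y²-κ

  t d : ℚ
  t = ½ * proj₁ h
  -- Below y, so that γ = tX is positive, yet close enough that d² still exceeds κ; y ≤ 1 makes t ≤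
  -- (y² - κ)/2 sufficient.
  d = y - t

  0<t : 0ℚ < t
  0<t = *-pos (positive⁻¹ ½) (proj₁ (proj₂ h))

  0<d : 0ℚ < d
  0<d = <-≤-trans 0<t (≤-by (y - proj₁ h) (ident y (proj₁ h)) (≤⇒0≤- (proj₁ (proj₂ (proj₂ h)))))
    where
    ident : ∀ y h → y - ½ * h ≡ ½ * h + (y - h)
    ident = solve-∀ ℚ-ring

  d≤1 : d ≤ 1ℚ
  d≤1 = ≤-trans (≤-by t (ident y t) (<⇒≤ 0<t)) y≤1
    where
    ident : ∀ y t → y ≡ y - t + t
    ident = solve-∀ ℚ-ring

  gap γ : ℚ
  gap = d * d - κ
  γ = 2ℚ - d * X

  0<gap : 0ℚ < gap
  0<gap = <-≤-trans (*-pos 0<t 0<t) (≤-by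
    ((y * y - κ - proj₁ h) + proj₁ h * (1ℚ - y)) (ident y κ (proj₁ h))
    (+-nonNeg (≤⇒0≤- (proj₂ (proj₂ (proj₂ h)))) (*-nonNeg (<⇒≤ (proj₁ (proj₂ h))) (≤⇒0≤- y≤1))))
    where
    ident : ∀ y κ h → (y - ½ * h) * (y - ½ * h) - κ ≡ ½ * h * (½ * h) + ((y * y - κ - h) + h * (1ℚ - y))
    ident = solve-∀ ℚ-ring

  0<γ : 0ℚ < γ
  0<γ = <-by (t * X) (trans (≡-by₁ (- 1ℚ) (ident X y t) Xy≡2) refl) (*-pos 0<t 0<X)
    where
    ident : ∀ x y t → 2ℚ - (y - t) * x ≡ 0ℚ + t * x + - 1ℚ * (x * y - 2ℚ)
    ident = solve-∀ ℚ-ring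

  1+-pos : ∀ {a} → 0ℚ ≤ a → 0ℚ < 1ℚ + a
  1+-pos {a} 0≤a = <-≤-trans 0<1 (≤-by a refl 0≤a)

  -- Dividing by 1 + a rather than a admits a = 0.
  scaled : ∀ {a b} → 0ℚ ≤ a → 0ℚ < b → ∃ λ c → 0ℚ < c × (∀ x → 0ℚ ≤ x → x ≤ c → a * x ≤ b)
  scaled {a} {b} 0≤a 0<b = b * r , *-pos 0<b (inv-pos (1+-pos 0≤a)) , λ x 0≤x x≤c → begin
    a * x                 ≤⟨ *-monoˡ {x} {a} {1ℚ + a} 0≤x (≤-by 1ℚ (ℚP.+-comm 1ℚ a) 0≤1) ⟩
    (1ℚ + a) * x          ≤⟨ *-monoʳ (<⇒≤ (1+-pos 0≤a)) x≤c ⟩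
    (1ℚ + a) * (b * r)    ≡⟨ ≡-by₁ b (ident (1ℚ + a) b r) (inv-* (1+-pos 0≤a)) ⟩
    b                     ∎
    where
    open ≤-Reasoning
    r = inv (1ℚ + a)
    ident : ∀ a b r → a * (b * r) ≡ b + b * (a * r - 1ℚ)
    ident = solve-∀ ℚ-ring

  0≤2+A : 0ℚ ≤ 2ℚ + A
  0≤2+A = +-nonNeg 0≤2 0≤A

  choice₁ = scaled 0≤2+A (*-pos (positive⁻¹ ¼) 0<γ)
  small-central = central-small (proj₁ (proj₂ choice₁))

  -- J is fixed before ε, since ε must be small relative to K. The frequencies in use are 1 and the
  -- even numbers up to 2J; K = 2J + 1 covers them even when J = 0.
  J K : ℕ
  J = proj₁ small-central
  K = suc (J ℕ.* 2)

  central-J : (2ℚ + A) * central J ≤ ¼ * γ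
  central-J = proj₂ (proj₂ choice₁) (central J) (central-nonNeg J) (proj₂ small-central)

  choice₂ = scaled (*-nonNeg 0≤4 0≤A) (*-pos (positive⁻¹ ¼) 0<γ)
  choice₃ = scaled (*-nonNeg (+-nonNeg 0≤2 0≤1) (ι-nonNeg K)) (*-pos (positive⁻¹ ½) 0<gap)
  choice₄ = scaled (ι-nonNeg K) 0<1
  lower₁ = common-lower (proj₁ (proj₂ choice₂)) (proj₁ (proj₂ choice₃))
  lower₂ = common-lower (proj₁ (proj₂ choice₄)) 0<1
  lower₃ = common-lower (proj₁ (proj₂ lower₁)) (proj₁ (proj₂ lower₂))

  ε : ℚ
  ε = proj₁ lower₃

  0<ε : 0ℚ < ε
  0<ε = proj₁ (proj₂ lower₃)

  ε≤₁ : ε ≤ proj₁ lower₁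
  ε≤₁ = proj₁ (proj₂ (proj₂ lower₃))

  ε≤₂ : ε ≤ proj₁ lower₂
  ε≤₂ = proj₂ (proj₂ (proj₂ lower₃))

  4Aε≤ : 4ℚ * A * ε ≤ ¼ * γ
  4Aε≤ = proj₂ (proj₂ choice₂) ε (<⇒≤ 0<ε) (≤-trans ε≤₁ (proj₁ (proj₂ (proj₂ lower₁))))

  3Kε≤ : (2ℚ + 1ℚ) * ι K * ε ≤ ½ * gap
  3Kε≤ = proj₂ (proj₂ choice₃) ε (<⇒≤ 0<ε) (≤-trans ε≤₁ (proj₂ (proj₂ (proj₂ lower₁))))

  Kε≤1 : ι K * ε ≤ 1ℚ
  Kε≤1 = proj₂ (proj₂ choice₄) ε (<⇒≤ 0<ε) (≤-trans ε≤₂ (proj₁ (proj₂ (proj₂ lower₂))))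

  ε≤1 : ε ≤ 1ℚ
  ε≤1 = ≤-trans ε≤₂ (proj₂ (proj₂ (proj₂ lower₂)))

  rot : Rotation ε
  rot = SmallRotation.rotation ε 0<ε ε≤1

  Q : ℕ
  Q = suc (Rotation.q rot)

  K≤Q : K ℕ.≤ Q
  K≤Q = ι-cancel-≤ (*-cancelˡ 0<ε (≤-trans (≤-reflexive (ℚP.*-comm ε (ι K)))
    (≤-trans Kε≤1 (RotationProperties.1≤ε*Q 0<ε rot))))

  constants : Constants q A B
  constants = record
    { d = d ; ε = ε ; J = J ; 0<d = 0<d ; d≤1 = d≤1 ; 0<gap = 0<gap ; central-J = central-J ; 0<γ = 0<γ
    ; 0<ε = 0<ε ; 4Aε≤ = 4Aε≤ ; 3Kε≤ = 3Kε≤ ; rot = rot ; K≤Q = K≤Q }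

module UpperBound (q A B : ℚ) (0≤A : 0ℚ ≤ A) (0≤B : 0ℚ ≤ B) (2<B² : 2ℚ < B * B)
  (2≤A* : ∀ J → 2ℚ * (1ℚ - central J) ≤ A * wallis J) (consts : Constants q A B) where

  open Constants consts

  Q P : ℕ
  Q = suc (Rotation.q rot)
  P = 4 ℕ.* Q

  K : ℕ
  K = suc (J ℕ.* 2)

  gap γ : ℚ
  gap = d * d - (1ℚ - 2ℚ * q)
  γ = 2ℚ - d * (2ℚ + (1ℚ + 2ℚ * B) * A)

  module DenseGraph {n : ℕ} (2QP≤n : 2 ℕ.* Q ℕ.* P ℕ.≤ n) (4≤ : 4ℚ ≤ ½ * gap * ι n)
    (G : Graph n) (L : EdgeMagicLabelling G) (dense : q * ι n * ι n ≤ ι (numEdges G)) where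

    N w w′ : ℕ
    N = n ℕ.+ numEdges G
    w = N ℕ./ P
    w′ = ℕ.pred w

    P≤n : P ℕ.≤ n
    P≤n = ℕP.≤-trans (ℕP.m≤n*m P (2 ℕ.* Q)) 2QP≤n

    2Q≤w : 2 ℕ.* Q ℕ.≤ w
    2Q≤w = subst (ℕ._≤ w) (ℕD.m*n/n≡m (2 ℕ.* Q) P)
      (ℕD./-monoˡ-≤ P (ℕP.≤-trans 2QP≤n (ℕP.m≤m+n n (numEdges G))))

    w≡ : suc w′ ≡ w
    w≡ = ℕP.suc-pred w {{ℕ.>-nonZero (ℕP.≤-trans (ℕ.s≤s ℕ.z≤n) 2Q≤w)}}

    N≡ : N ≡ P ℕ.* suc w′ ℕ.+ N ℕ.% P
    N≡ = trans (ℕD.m≡m%n+[m/n]*n N P) (trans (ℕP.+-comm (N ℕ.% P) (w ℕ.* P))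
      (cong (ℕ._+ N ℕ.% P) (trans (ℕP.*-comm w P) (cong (P ℕ.*_) (sym w≡)))))

    open Phases G L 0<ε rot w′ (N ℕ.% P) N≡ (ℕP.<⇒≤ (ℕD.m%n<n N P)) (subst (2 ℕ.* Q ℕ.≤_) (sym w≡) 2Q≤w)
      hiding (N; P; Q; q; w)

    a b ω : ℚ
    a = ι n
    b = ι m
    ω = ι (suc w′)

    0≤a : 0ℚ ≤ a
    0≤a = ι-nonNeg n

    1≤a : 1ℚ ≤ a
    1≤a = subst (_≤ a) ι-1 (ι-mono (ℕP.≤-trans (ℕ.s≤s ℕ.z≤n) P≤n))

    2b≤a² : 0ℚ ≤ a * a - 2ℚ * b
    2b≤a² = ≤-trans (+-nonNeg (²-nonNeg lows) (²-nonNeg highs)) outliers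

    ι4 : ι 4 ≡ 4ℚ
    ι4 = ι≡ℕtoℚ 4

    2≤a : 2ℚ ≤ a
    2≤a = subst (_≤ a) (ι≡ℕtoℚ 2) (ι-mono (ℕP.≤-trans (ℕP.≤-trans (ℕ.s≤s (ℕ.s≤s ℕ.z≤n)) (ℕP.m≤m*n 4 Q)) P≤n))

    -- The blocks fit into N = n + m, and N ≤ n² because 2m ≤ n² and n ≥ 2.
    4Qω≤a² : 4ℚ * ι Q * ω ≤ a * a
    4Qω≤a² = begin
      4ℚ * ι Q * ω              ≡⟨ cong (λ x → x * ι Q * ω) ι4 ⟨
      ι 4 * ι Q * ω             ≡⟨ trans (ι-* (4 ℕ.* Q) (suc w′)) (cong (_* ω) (ι-* 4 Q)) ⟨
      ι (P ℕ.* suc w′)  ≤⟨ ι-mono (ℕP.≤-trans (ℕP.m≤m+n _ _) (ℕP.≤-reflexive (sym N≡))) ⟩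
      ι N                       ≡⟨ ι-+ n m ⟩
      a + b                     ≤⟨ ≤-by (½ * (a * a - 2ℚ * b) + ½ * (a * (a - 2ℚ))) (ident a b)
                                    (+-nonNeg (*-nonNeg 0≤½ 2b≤a²) (*-nonNeg 0≤½ (*-nonNeg 0≤a (≤⇒0≤- 2≤a)))) ⟩
      a * a                     ∎
      where
      open ≤-Reasoning
      ident : ∀ a b → a * a ≡ a + b + (½ * (a * a - 2ℚ * b) + ½ * (a * (a - 2ℚ)))
      ident = solve-∀ ℚ-ring

    1≤εQ : 1ℚ ≤ ε * ι Q
    1≤εQ = RotationProperties.1≤ε*Q 0<ε rot

    -- A quarter turn takes at least 1/ε steps, so blocks are short compared with n². This absorbs
    -- the error 4jw of a full turn.
    4ω≤ : 4ℚ * ω ≤ ε * (a * a)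
    4ω≤ = begin
      4ℚ * ω                        ≡⟨ *-identityʳ (4ℚ * ω) ⟨
      4ℚ * ω * 1ℚ                   ≤⟨ *-monoʳ (*-nonNeg 0≤4 (ι-nonNeg (suc w′))) 1≤εQ ⟩
      4ℚ * ω * (ε * ι Q)            ≡⟨ ident ω ε (ι Q) ⟩
      ε * (4ℚ * ι Q * ω)            ≤⟨ *-monoʳ (<⇒≤ 0<ε) 4Qω≤a² ⟩
      ε * (a * a)                   ∎
      where
      open ≤-Reasoning
      ident : ∀ w e q → 4ℚ * w * (e * q) ≡ e * (4ℚ * q * w)
      ident = solve-∀ ℚ-ring

    -- A violation would make ρ positive, which allows `spectral` to be divided by it.
    power≤ : ∀ i → suc i ℕ.≤ K → power (suc i) ≤ d * a * (d * a)
    power≤ i i<K with power (suc i) ℚP.≤? d * a * (d * a)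
    ... | yes p = p
    ... | no ¬p = ≤-trans (*-cancelˡ 0<ρ spectral) D≤
      where
      open Spectral i (ℕP.≤-trans i<K K≤Q)
      0<ρ : 0ℚ < ρ
      0<ρ = ≤-<-trans (²-nonNeg (d * a)) (≰⇒> ¬p)
      j≤K : ι (suc i) ≤ ι K
      j≤K = ι-mono i<K
      J₁ = ι (suc i)
      -- Half of the gap pays for 3Kεn², of which one part is rounding and two are the full turn;
      -- the other half pays for the linear terms, at most 4n.
      D≤ : D ≤ d * a * (d * a)
      D≤ = ≤-by
        (((b - q * a * a) + (b - q * a * a))
          + ((ι K - J₁) * ε * (2ℚ * b) + ι K * ε * (a * a - 2ℚ * b))
          + (2ℚ * (ι K - J₁) * (4ℚ * ω) + 2ℚ * ι K * (ε * (a * a) - 4ℚ * ω))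
          + ((½ * gap - (2ℚ + 1ℚ) * ι K * ε) * (a * a) + (½ * gap * a - 4ℚ) * a + 2ℚ * (a - ι P)))
        (trans (ident a b q d ε J₁ (ι K) ω (ι P))
          (cong (λ B → a * a - 2ℚ * b + 2ℚ * (b * (J₁ * ε) + a + ω * B + ι P)
              + (((b - q * a * a) + (b - q * a * a))
              + ((ι K - J₁) * ε * (2ℚ * b) + ι K * ε * (a * a - 2ℚ * b))
              + (2ℚ * (ι K - J₁) * (4ℚ * ω) + 2ℚ * ι K * (ε * (a * a) - 4ℚ * ω))
              + ((½ * gap - (2ℚ + 1ℚ) * ι K * ε) * (a * a) + (½ * gap * a - 4ℚ) * a + 2ℚ * (a - ι P))))
            (sym (trans (ι-* (suc i) 4) (cong (_*_ J₁) ι4)))))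
        (+-nonNeg (+-nonNeg (+-nonNeg
          (+-nonNeg (≤⇒0≤- dense) (≤⇒0≤- dense))
          (+-nonNeg (*-nonNeg (*-nonNeg (≤⇒0≤- j≤K) (<⇒≤ 0<ε)) (*-nonNeg 0≤2 (ι-nonNeg m)))
                    (*-nonNeg (*-nonNeg (ι-nonNeg K) (<⇒≤ 0<ε)) 2b≤a²)))
          (+-nonNeg (*-nonNeg (*-nonNeg 0≤2 (≤⇒0≤- j≤K)) (*-nonNeg 0≤4 (ι-nonNeg (suc w′))))
                    (*-nonNeg (*-nonNeg 0≤2 (ι-nonNeg K)) (≤⇒0≤- 4ω≤))))
          (+-nonNeg (+-nonNeg (*-nonNeg (≤⇒0≤- 3Kε≤) (²-nonNeg a)) (*-nonNeg (≤⇒0≤- 4≤) 0≤a))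
                    (*-nonNeg 0≤2 (≤⇒0≤- (ι-mono P≤n)))))
        where
        ident : ∀ a b q d ε j k w p →
          d * a * (d * a) ≡ a * a - 2ℚ * b + 2ℚ * (b * (j * ε) + a + w * (j * 4ℚ) + p)
            + (((b - q * a * a) + (b - q * a * a))
            + ((k - j) * ε * (2ℚ * b) + k * ε * (a * a - 2ℚ * b))
            + (2ℚ * (k - j) * (4ℚ * w) + 2ℚ * k * (ε * (a * a) - 4ℚ * w))
            + ((½ * (d * d - (1ℚ - 2ℚ * q)) - (2ℚ + 1ℚ) * k * ε) * (a * a)
               + (½ * (d * d - (1ℚ - 2ℚ * q)) * a - 4ℚ) * a + 2ℚ * (a - p)))
        ident = solve-∀ ℚ-ring

    0≤da : 0ℚ ≤ d * a
    0≤da = *-nonNeg (<⇒≤ 0<d) 0≤a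

    open Bounded (d * a) J (im≤ (fourier 1) 0≤da (power≤ 0 (ℕ.s≤s ℕ.z≤n)))
      (λ k k<J → re≤ (fourier (suc k ℕ.* 2)) 0≤da (power≤ (suc (k ℕ.* 2)) (ℕP.≤-trans (ℕP.*-monoˡ-≤ 2 k<J) (ℕP.n≤1+n (J ℕ.* 2)))))

    -- The √2 comes from (l + h)² ≤ 2(l² + h²) ≤ 2(n² - 2m), where n² - 2m ≤ (1 - 2q) n² ≤ d² n².
    outliers≤ : lows + highs ≤ B * (d * a)
    outliers≤ = ²-cancel-≤ (*-nonNeg 0≤B 0≤da) (≤-by
      ((lows - highs) * (lows - highs) + 2ℚ * (a * a - 2ℚ * b - (lows * lows + highs * highs))
        + (4ℚ * (b - q * a * a) + 2ℚ * (gap * (a * a)) + (B * B - 2ℚ) * (d * a * (d * a))))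
      (ident lows highs a b q d B)
      (+-nonNeg (+-nonNeg (²-nonNeg (lows - highs)) (*-nonNeg 0≤2 (≤⇒0≤- outliers)))
        (+-nonNeg (+-nonNeg (*-nonNeg 0≤4 (≤⇒0≤- dense)) (*-nonNeg 0≤2 (*-nonNeg (<⇒≤ 0<gap) (²-nonNeg a))))
          (*-nonNeg (≤⇒0≤- (<⇒≤ 2<B²)) (²-nonNeg (d * a))))))
      where
      ident : ∀ l h a b q d B → B * (d * a) * (B * (d * a)) ≡ (l + h) * (l + h) +
        ((l - h) * (l - h) + 2ℚ * (a * a - 2ℚ * b - (l * l + h * h))
          + (4ℚ * (b - q * a * a) + 2ℚ * ((d * d - (1ℚ - 2ℚ * q)) * (a * a)) + (B * B - 2ℚ) * (d * a * (d * a))))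
      ident = solve-∀ ℚ-ring

    -- Multiply `mean-sine` by A, replace A `wallis J` by 2(1 - `central J`) and the outliers by B d
    -- n: γn is then bounded by the errors from `central J` and from ε, each at most γn/4.
    absurd : ½ * γ ≤ 0ℚ
    absurd = *-cancelˡ {a} (<-≤-trans 0<1 1≤a) (≤-by
      (A * (d * a + 2ℚ * (a * (2ℚ * ε) + (lows + highs)) - (a - d * a) * (M′ - c))
        + (1ℚ - d) * a * (A * M′ - 2ℚ * (1ℚ - c))
        + 2ℚ * A * (B * (d * a) - (lows + highs))
        + d * a * ((2ℚ + A) * c)
        + a * (¼ * γ - (2ℚ + A) * c) + a * (¼ * γ - 4ℚ * A * ε))
      (ident a A B d ε c M′ (lows + highs))
      (+-nonNeg (+-nonNeg (+-nonNeg (+-nonNeg (+-nonNeg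
        (*-nonNeg 0≤A (≤⇒0≤- mean-sine))
        (*-nonNeg (*-nonNeg (≤⇒0≤- d≤1) 0≤a) (≤⇒0≤- (2≤A* J))))
        (*-nonNeg (*-nonNeg 0≤2 0≤A) (≤⇒0≤- outliers≤)))
        (*-nonNeg 0≤da (*-nonNeg (+-nonNeg 0≤2 0≤A) (central-nonNeg J))))
        (*-nonNeg 0≤a (≤⇒0≤- central-J)))
        (*-nonNeg 0≤a (≤⇒0≤- 4Aε≤))))
      where
      c = central J
      M′ = wallis J
      ident : ∀ a A B d ε c M l →
        a * 0ℚ ≡ a * (½ * (2ℚ - d * (2ℚ + (1ℚ + 2ℚ * B) * A))) +
          (A * (d * a + 2ℚ * (a * (2ℚ * ε) + l) - (a - d * a) * (M - c))
          + (1ℚ - d) * a * (A * M - 2ℚ * (1ℚ - c))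
          + 2ℚ * A * (B * (d * a) - l)
          + d * a * ((2ℚ + A) * c)
          + a * (¼ * (2ℚ - d * (2ℚ + (1ℚ + 2ℚ * B) * A)) - (2ℚ + A) * c)
          + a * (¼ * (2ℚ - d * (2ℚ + (1ℚ + 2ℚ * B) * A)) - 4ℚ * A * ε))
      ident = solve-∀ ℚ-ring

  0<½gap : 0ℚ < ½ * gap
  0<½gap = *-pos (positive⁻¹ ½) 0<gap

  threshold : ∃ λ M → 4ℚ ≤ ½ * gap * ι (suc M)
  threshold = archimedes-* 4ℚ 0<½gap

  n₀ : ℕ
  n₀ = suc (proj₁ threshold) ℕ.+ 2 ℕ.* Q ℕ.* P

  upper : ∀ n → n₀ ℕ.≤ n → ∀ (G : Graph n) → EdgeMagic G → ι (numEdges G) ≤ q * ι n * ι n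
  upper n n₀≤n G L with ι (numEdges G) ℚP.≤? q * ι n * ι n
  ... | yes p = p
  ... | no ¬p = contradiction (*-pos (positive⁻¹ ½) 0<γ) (≤⇒≯
    (DenseGraph.absurd (ℕP.≤-trans (ℕP.m≤n+m _ (suc (proj₁ threshold))) n₀≤n) 4≤ G L (<⇒≤ (≰⇒> ¬p))))
    where
    4≤ : 4ℚ ≤ ½ * gap * ι n
    4≤ = ≤-trans (proj₂ threshold)
      (*-monoʳ (<⇒≤ 0<½gap) (ι-mono (ℕP.≤-trans (ℕP.m≤m+n (suc (proj₁ threshold)) _) n₀≤n)))

upper-bound : ∀ q → ConstBelow q → ∃ λ N → ∀ n → N ℕ.≤ n →
  ∀ (G : Graph n) → EdgeMagic G → ℕtoℚ (numEdges G) ≤ q * ℕtoℚ n * ℕtoℚ n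
upper-bound q (A , B , pi , (0≤B , 2<B²) , below) = UpperBound.n₀ q A B 0≤A 0≤B 2<B² 2≤A* consts , λ n le G L →
  subst₂ (λ x y → x ≤ q * y * y) (ι≡ℕtoℚ (numEdges G)) (ι≡ℕtoℚ n)
    (UpperBound.upper q A B 0≤A 0≤B 2<B² 2≤A* consts n le G L)
  where
  2≤A* : ∀ J → 2ℚ * (1ℚ - central J) ≤ A * wallis J
  2≤A* = PiUpper⇒wallis pi
  0≤A : 0ℚ ≤ A
  -- At J = 0 the Wallis inequality reads 0 ≤ A.
  0≤A = subst (0ℚ ≤_) (trans (cong (_*_ A) wallis-0) (*-identityʳ A)) (2≤A* 0)
  consts : Constants q A B
  consts = ChooseConstants.constants q A B 0≤A 0≤B below

-- The lower bound

lookup-injective : ∀ {A : Set} {xs : List A} → Unique xs → ∀ i j → lookup xs i ≡ lookup xs j → i ≡ j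
lookup-injective (_ ∷ _) Fin.zero Fin.zero _ = refl
lookup-injective (x∉ ∷ _) Fin.zero (Fin.suc j) eq = contradiction eq (All.lookup x∉ (∈-lookup j))
lookup-injective (x∉ ∷ _) (Fin.suc i) Fin.zero eq = contradiction (sym eq) (All.lookup x∉ (∈-lookup i))
lookup-injective (_ ∷ uniq) (Fin.suc i) (Fin.suc j) eq = cong Fin.suc (lookup-injective uniq i j eq)

-- A set of labels whose pairwise sums cover S − x for each remaining x < N is
-- the set of vertex labels of an edge-magic graph.
module FromSums (xs : List ℕ) (uniq : Unique xs) (N S : ℕ) (xs<N : All (ℕ._< N) xs)
  (cover : ∀ x → x ℕ.< N → x ∉ xs → ∃₂ λ a b → a ∈ xs × b ∈ xs × a ≢ b × a ℕ.+ b ℕ.+ x ≡ S) where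

  n : ℕ
  n = length xs

  rest : List ℕ
  rest = List.filter (_∉? xs) (List.upTo N)

  rest-unique : Unique rest
  rest-unique = UniqueP.filter⁺ (_∉? xs) (UniqueP.upTo⁺ N)

  ∈-rest : ∀ {x} → x ∈ rest → x ℕ.< N × x ∉ xs
  ∈-rest x∈ = let x∈upTo , x∉ = ∈-filter⁻ (_∉? xs) x∈ in ∈-upTo⁻ x∈upTo , x∉

  EdgeFor : Fin n × Fin n → ℕ → Set
  EdgeFor (u , v) x = u Fin.< v × lookup xs u ℕ.+ lookup xs v ℕ.+ x ≡ S

  edgeFor : ∀ {x} → x ∈ rest → ∃ λ e → EdgeFor e x
  edgeFor {x} x∈ with uncurry (cover x) (∈-rest x∈)
  ... | a , b , a∈ , b∈ , a≢b , eq with FinP.<-cmp (Any.index a∈) (Any.index b∈)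
  ...   | tri< u<v _ _ = (Any.index a∈ , Any.index b∈) , u<v ,
            trans (cong₂ (λ i j → i ℕ.+ j ℕ.+ x) (sym (lookup-index a∈)) (sym (lookup-index b∈))) eq
  ...   | tri≈ _ u≡v _ = contradiction (trans (lookup-index a∈) (trans (cong (lookup xs) u≡v) (sym (lookup-index b∈)))) a≢b
  ...   | tri> _ _ v<u = (Any.index b∈ , Any.index a∈) , v<u ,
            trans (cong₂ (λ i j → i ℕ.+ j ℕ.+ x) (sym (lookup-index b∈)) (sym (lookup-index a∈)))
              (trans (cong (ℕ._+ x) (ℕP.+-comm b a)) eq)

  edgesFor : ∀ {ys} → All (_∈ rest) ys → ∃ λ es → Pointwise EdgeFor es ys
  edgesFor [] = [] , []
  edgesFor (y∈ ∷ ys∈) = let e , h = edgeFor y∈; es , hs = edgesFor ys∈ in e ∷ es , h ∷ hs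

  es : List (Fin n × Fin n)
  es = proj₁ (edgesFor (All.tabulate (λ x∈ → x∈)))

  es-rest : Pointwise EdgeFor es rest
  es-rest = proj₂ (edgesFor (All.tabulate (λ x∈ → x∈)))

  es-ordered : ∀ {es ys} → Pointwise EdgeFor es ys → All (λ e → proj₁ e Fin.< proj₂ e) es
  es-ordered [] = []
  es-ordered (h ∷ hs) = proj₁ h ∷ es-ordered hs

  -- An edge determines its label as S minus the sum at its ends, so different labels receive
  -- different edges.
  es-unique : ∀ {es ys} → Pointwise EdgeFor es ys → Unique ys → Unique es
  es-unique [] [] = []
  es-unique {e ∷ _} {y ∷ _} (h ∷ hs) (y∉ ∷ uniq) = go hs y∉ ∷ es-unique hs uniq
    where
    go : ∀ {es ys} → Pointwise EdgeFor es ys → All (y ≢_) ys → All (e ≢_) es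
    go [] [] = []
    go (h′ ∷ hs) (y≢ ∷ y∉) =
      (λ { refl → y≢ (ℕP.+-cancelˡ-≡ (lookup xs (proj₁ e) ℕ.+ lookup xs (proj₂ e)) _ _ (trans (proj₂ h) (sym (proj₂ h′)))) })
      ∷ go hs y∉

  graph : Graph n
  graph = record { edges = es ; ordered = es-ordered es-rest ; unique = es-unique es-rest rest-unique }

  m : ℕ
  m = numEdges graph

  |es| : length es ≡ length rest
  |es| = Pointwise.Pointwise-length es-rest

  value′ : Fin n ⊎ Fin m → ℕ
  value′ = [ lookup xs , (λ k → lookup rest (Fin.cast |es| k)) ]′

  value : Fin (n ℕ.+ m) → ℕ
  value i = value′ (Fin.splitAt n i)

  value-vertex : ∀ v → value (v ↑ˡ m) ≡ lookup xs v
  value-vertex v = cong value′ (FinP.splitAt-↑ˡ n v m)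

  value-edge : ∀ k → value (n ↑ʳ k) ≡ lookup rest (Fin.cast |es| k)
  value-edge k = cong value′ (FinP.splitAt-↑ʳ n m k)

  value′-injective : ∀ i j → value′ i ≡ value′ j → i ≡ j
  value′-injective (inj₁ u) (inj₁ v) eq = cong inj₁ (lookup-injective uniq u v eq)
  value′-injective (inj₁ u) (inj₂ k) eq = contradiction (subst (_∈ xs) eq (∈-lookup u)) (proj₂ (∈-rest (∈-lookup (Fin.cast |es| k))))
  value′-injective (inj₂ k) (inj₁ u) eq = contradiction (subst (_∈ xs) (sym eq) (∈-lookup u)) (proj₂ (∈-rest (∈-lookup (Fin.cast |es| k))))
  value′-injective (inj₂ k) (inj₂ k′) eq = cong inj₂ (FinP.toℕ-injective (begin
    toℕ k                    ≡⟨ FinP.toℕ-cast |es| k ⟨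
    toℕ (Fin.cast |es| k)    ≡⟨ cong toℕ (lookup-injective rest-unique _ _ eq) ⟩
    toℕ (Fin.cast |es| k′)   ≡⟨ FinP.toℕ-cast |es| k′ ⟩
    toℕ k′                   ∎))
    where open ≡-Reasoning

  value-injective : ∀ i j → value i ≡ value j → i ≡ j
  value-injective i j eq = begin
    i                                       ≡⟨ FinP.join-splitAt n m i ⟨
    Fin.join n m (Fin.splitAt n i)  ≡⟨ cong (Fin.join n m) (value′-injective (Fin.splitAt n i) (Fin.splitAt n j) eq) ⟩
    Fin.join n m (Fin.splitAt n j)          ≡⟨ FinP.join-splitAt n m j ⟩
    j                                       ∎
    where open ≡-Reasoning

  value′<N : ∀ i → value′ i ℕ.< N
  value′<N (inj₁ v) = All.lookup xs<N (∈-lookup v)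
  value′<N (inj₂ k) = proj₁ (∈-rest (∈-lookup (Fin.cast |es| k)))

  value<N : ∀ i → value i ℕ.< N
  value<N i = value′<N (Fin.splitAt n i)

  value-surjective : ∀ x → x ℕ.< N → ∃ λ i → value i ≡ x
  value-surjective x x<N with x ∉? xs
  ... | no ¬x∉ = let x∈ = decidable-stable (x ∈? xs) ¬x∉ in
        Any.index x∈ ↑ˡ m , trans (value-vertex (Any.index x∈)) (sym (lookup-index x∈))
  ... | yes x∉ = n ↑ʳ k , trans (value-edge k) (trans (cong (lookup rest) cast-k) (sym (lookup-index x∈)))
    where
    x∈ : x ∈ rest
    x∈ = ∈-filter⁺ (_∉? xs) (∈-upTo⁺ x<N) x∉
    k : Fin m
    k = Fin.cast (sym |es|) (Any.index x∈)
    cast-k : Fin.cast |es| k ≡ Any.index x∈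
    cast-k = FinP.toℕ-injective (trans (FinP.toℕ-cast |es| k) (FinP.toℕ-cast (sym |es|) (Any.index x∈)))

  -- In place of counting `rest`: `value` injects into `Fin N`, and a choice of preimages injects
  -- back.
  size : n ℕ.+ m ≡ N
  size = ℕP.≤-antisym
    (FinP.injective⇒≤ {f = λ i → fromℕ< (value<N i)}
      (λ {i} {j} eq → value-injective i j (trans (sym (FinP.toℕ-fromℕ< (value<N i))) (trans (cong toℕ eq) (FinP.toℕ-fromℕ< (value<N j))))))
    (FinP.injective⇒≤ {f = preimage}
      (λ {x} {y} eq → FinP.toℕ-injective (trans (sym (preimage-value x)) (trans (cong value eq) (preimage-value y)))))
    where
    preimage : Fin N → Fin (n ℕ.+ m)
    preimage x = proj₁ (value-surjective (toℕ x) (FinP.toℕ<n x))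
    preimage-value : ∀ x → value (preimage x) ≡ toℕ x
    preimage-value x = proj₂ (value-surjective (toℕ x) (FinP.toℕ<n x))

  value<n+m : ∀ i → value i ℕ.< n ℕ.+ m
  value<n+m i = subst (value i ℕ.<_) (sym size) (value<N i)

  label : Fin (n ℕ.+ m) → Fin (n ℕ.+ m)
  label i = fromℕ< (value<n+m i)

  toℕ-label : ∀ i → toℕ (label i) ≡ value i
  toℕ-label i = FinP.toℕ-fromℕ< (value<n+m i)

  label-bijective : Bijective _≡_ _≡_ label
  label-bijective =
    (λ {i} {j} eq → value-injective i j (trans (sym (toℕ-label i)) (trans (cong toℕ eq) (toℕ-label j)))) ,
    (λ y → let i , eq = value-surjective (toℕ y) (subst (toℕ y ℕ.<_) size (FinP.toℕ<n y)) in
      i , λ { refl → FinP.toℕ-injective (trans (toℕ-label i) eq) })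

  edgeMagic : EdgeMagic graph
  edgeMagic = record
    { l = label
    ; bijective = label-bijective
    ; s = 3 ℕ.+ S
    ; magic = λ k → let u = proj₁ (lookup es k); v = proj₂ (lookup es k) in trans
        (cong₂ ℕ._+_
          (cong₂ (λ i j → suc i ℕ.+ suc j) (trans (toℕ-label (u ↑ˡ m)) (value-vertex u)) (trans (toℕ-label (v ↑ˡ m)) (value-vertex v)))
          (cong suc (trans (toℕ-label (n ↑ʳ k)) (value-edge k))))
        (trans (shift (lookup xs u) (lookup xs v) (lookup rest (Fin.cast |es| k)))
          (cong (3 ℕ.+_) (proj₂ (Pointwise.lookup⁺ es-rest k))))
    }
    where
    shift : ∀ a b c → suc a ℕ.+ suc b ℕ.+ suc c ≡ 3 ℕ.+ (a ℕ.+ b ℕ.+ c)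
    shift = ℕSolver.solve-∀

-- Arithmetic progressions and Mrose's basis

block : ℕ → ℕ → ℕ → List ℕ
block a d c = List.applyUpTo (λ i → a ℕ.+ i ℕ.* d) c

SortedFrom : ℕ → List ℕ → Set
SortedFrom a xs = All (a ℕ.≤_) xs × AllPairs ℕ._<_ xs

block-++ : ∀ {a b} d .{{_ : ℕ.NonZero d}} c {xs} → (∀ i → i ℕ.< c → a ℕ.+ i ℕ.* d ℕ.< b) → a ℕ.≤ b →
  SortedFrom b xs → SortedFrom a (block a d c List.++ xs)
block-++ {a} {b} d c {xs} below a≤b (xs≥ , xs<) =
  AllP.++⁺ (AllP.applyUpTo⁺₂ _ c (λ i → ℕP.m≤m+n a (i ℕ.* d))) (All.map (ℕP.≤-trans a≤b) xs≥) ,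
  AllPairsP.++⁺ (AllPairsP.applyUpTo⁺₁ _ c (λ i<j _ → ℕP.+-monoʳ-< a (ℕP.*-monoˡ-< d i<j))) xs<
    (AllP.applyUpTo⁺₁ _ c (λ {i} i<c → All.map (ℕP.<-≤-trans (below i i<c)) xs≥))

-- Mrose's additive basis: 7t + 3 numbers (and r more) whose sums of two reach 14t² + 10t − 1.
module Mrose (t r : ℕ) .{{_ : ℕ.NonZero t}} (2≤t : 2 ℕ.≤ t) (r≤6 : r ℕ.≤ 6) where

  base₃ base₄ base₅ N S : ℕ
  base₃ = 3 ℕ.* (t ℕ.* t) ℕ.+ 2 ℕ.* t
  base₄ = 6 ℕ.* (t ℕ.* t) ℕ.+ 4 ℕ.* t
  base₅ = 10 ℕ.* (t ℕ.* t) ℕ.+ 7 ℕ.* t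
  -- Chosen so that S + 1 = N + 2t: for x below N, S - x runs through 2t, ..., S. Sums below 2t,
  -- such as 0 = 0 + 0, are left out because the summands must differ.
  N = 14 ℕ.* (t ℕ.* t) ℕ.+ 8 ℕ.* t
  S = ℕ.pred (14 ℕ.* (t ℕ.* t) ℕ.+ 10 ℕ.* t)

  B₁ B₂ B₃ B₄ B₅ labels : List ℕ
  B₁ = block 0 1 (suc t)
  B₂ = block (2 ℕ.* t) t (3 ℕ.* t)
  B₃ = block base₃ (suc t) t
  B₄ = block base₄ 1 (suc t)
  -- The r extra elements adjust the number of vertices to every residue modulo 7.
  B₅ = block base₅ 1 (suc t ℕ.+ r)
  labels = B₁ List.++ B₂ List.++ B₃ List.++ B₄ List.++ B₅

  0<t : 0 ℕ.< t
  0<t = ℕP.≤-trans (ℕ.s≤s ℕ.z≤n) 2≤t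

  quadratic-≤ : ∀ a a′ b b′ → a ℕ.* (t ℕ.* t) ℕ.+ b ℕ.* t ℕ.≤ (a ℕ.+ a′) ℕ.* (t ℕ.* t) ℕ.+ (b ℕ.+ b′) ℕ.* t
  quadratic-≤ a a′ b b′ = ℕP.+-mono-≤ (ℕP.*-monoˡ-≤ (t ℕ.* t) (ℕP.m≤m+n a a′)) (ℕP.*-monoˡ-≤ t (ℕP.m≤m+n b b′))

  r<t² : suc r ℕ.≤ 4 ℕ.* (t ℕ.* t)
  r<t² = ℕP.≤-trans (ℕ.s≤s r≤6) (ℕP.≤-trans (ℕP.m≤m+n 7 9)
    (ℕP.*-monoʳ-≤ 4 {4} (ℕP.*-mono-≤ 2≤t 2≤t)))

  block₅<N : ∀ i → i ℕ.< suc t ℕ.+ r → base₅ ℕ.+ i ℕ.* 1 ℕ.< N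
  block₅<N i (ℕ.s≤s i≤t+r) = begin-strict
    base₅ ℕ.+ i ℕ.* 1                     ≡⟨ cong (base₅ ℕ.+_) (ℕP.*-identityʳ i) ⟩
    base₅ ℕ.+ i                           ≤⟨ ℕP.+-monoʳ-≤ base₅ i≤t+r ⟩
    base₅ ℕ.+ (t ℕ.+ r)                   <⟨ ℕP.+-monoʳ-< base₅ (ℕP.+-monoʳ-< t r<t²) ⟩
    base₅ ℕ.+ (t ℕ.+ 4 ℕ.* (t ℕ.* t))     ≡⟨ ident t ⟩
    N                                     ∎
    where
    open ℕP.≤-Reasoning
    ident : ∀ t → 10 ℕ.* (t ℕ.* t) ℕ.+ 7 ℕ.* t ℕ.+ (t ℕ.+ 4 ℕ.* (t ℕ.* t)) ≡ 14 ℕ.* (t ℕ.* t) ℕ.+ 8 ℕ.* t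
    ident = ℕSolver.solve-∀

  step₁ : ∀ i → i ℕ.< suc t → i ℕ.* 1 ℕ.< 2 ℕ.* t
  step₁ i (ℕ.s≤s i≤t) = subst (ℕ._< 2 ℕ.* t) (sym (ℕP.*-identityʳ i))
    (ℕP.≤-<-trans i≤t (subst (t ℕ.<_) (cong (t ℕ.+_) (sym (ℕP.+-identityʳ t))) (ℕP.m<m+n t 0<t)))

  step₂ : ∀ i → i ℕ.< 3 ℕ.* t → 2 ℕ.* t ℕ.+ i ℕ.* t ℕ.< base₃
  step₂ i i<3t = subst (2 ℕ.* t ℕ.+ i ℕ.* t ℕ.<_) (ident t) (ℕP.+-monoʳ-< (2 ℕ.* t) (ℕP.*-monoˡ-< t i<3t))
    where
    ident : ∀ t → 2 ℕ.* t ℕ.+ 3 ℕ.* t ℕ.* t ≡ 3 ℕ.* (t ℕ.* t) ℕ.+ 2 ℕ.* t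
    ident = ℕSolver.solve-∀

  end₃ : ℕ
  end₃ = 4 ℕ.* (t ℕ.* t) ℕ.+ 3 ℕ.* t

  end₃≤base₄ : end₃ ℕ.≤ base₄
  end₃≤base₄ = quadratic-≤ 4 2 3 1

  step₃′ : ∀ i → i ℕ.< t → base₃ ℕ.+ i ℕ.* suc t ℕ.< end₃
  step₃′ i i<t = subst (base₃ ℕ.+ i ℕ.* suc t ℕ.<_) (ident t) (ℕP.+-monoʳ-< base₃ (ℕP.*-monoˡ-< (suc t) i<t))
    where
    ident : ∀ t → 3 ℕ.* (t ℕ.* t) ℕ.+ 2 ℕ.* t ℕ.+ t ℕ.* (1 ℕ.+ t) ≡ 4 ℕ.* (t ℕ.* t) ℕ.+ 3 ℕ.* t
    ident = ℕSolver.solve-∀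

  step₄ : ∀ i → i ℕ.< suc t → base₄ ℕ.+ i ℕ.* 1 ℕ.< base₅
  step₄ i i<1+t = begin-strict
    base₄ ℕ.+ i ℕ.* 1          <⟨ ℕP.+-monoʳ-< base₄ (step₁ i i<1+t) ⟩
    base₄ ℕ.+ 2 ℕ.* t          ≤⟨ ℕP.m≤m+n _ (4 ℕ.* (t ℕ.* t) ℕ.+ t) ⟩
    base₄ ℕ.+ 2 ℕ.* t ℕ.+ (4 ℕ.* (t ℕ.* t) ℕ.+ t)  ≡⟨ ident t ⟩
    base₅                      ∎
    where
    open ℕP.≤-Reasoning
    ident : ∀ t → 6 ℕ.* (t ℕ.* t) ℕ.+ 4 ℕ.* t ℕ.+ 2 ℕ.* t ℕ.+ (4 ℕ.* (t ℕ.* t) ℕ.+ t) ≡ 10 ℕ.* (t ℕ.* t) ℕ.+ 7 ℕ.* t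
    ident = ℕSolver.solve-∀

  sorted : SortedFrom 0 labels
  sorted =
    block-++ 1 (suc t) step₁ ℕ.z≤n
    (block-++ t (3 ℕ.* t) step₂ (ℕP.m≤n+m (2 ℕ.* t) (3 ℕ.* (t ℕ.* t)))
    (block-++ (suc t) t (λ i i<t → ℕP.<-≤-trans (step₃′ i i<t) end₃≤base₄)
      (quadratic-≤ 3 3 2 2)
    (block-++ 1 (suc t) step₄ (quadratic-≤ 6 4 4 3)
    (subst (SortedFrom base₅) (ListP.++-identityʳ B₅) (block-++ 1 (suc t ℕ.+ r) block₅<N
      (quadratic-≤ 10 4 7 1) ([] , []))))))

  labels-unique : Unique labels
  labels-unique = AllPairs.map ℕP.<⇒≢ (proj₂ sorted)

  base₅≤N : base₅ ℕ.≤ N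
  base₅≤N = quadratic-≤ 10 4 7 1

  labels<N : All (ℕ._< N) labels
  labels<N =
    AllP.++⁺ (AllP.applyUpTo⁺₁ _ (suc t) (λ {i} i<c → ℕP.<-≤-trans (step₁ i i<c) (ℕP.≤-trans (ℕP.*-monoˡ-≤ t (ℕP.m≤m+n 2 6)) (ℕP.m≤n+m (8 ℕ.* t) (14 ℕ.* (t ℕ.* t))))))
    (AllP.++⁺ (AllP.applyUpTo⁺₁ _ (3 ℕ.* t) (λ {i} i<c → ℕP.<-≤-trans (step₂ i i<c)
        (quadratic-≤ 3 11 2 6)))
    (AllP.++⁺ (AllP.applyUpTo⁺₁ _ t (λ {i} i<c → ℕP.<-≤-trans (step₃′ i i<c)
        (quadratic-≤ 4 10 3 5)))
    (AllP.++⁺ (AllP.applyUpTo⁺₁ _ (suc t) (λ {i} i<c → ℕP.<-≤-trans (step₄ i i<c) base₅≤N))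
    (AllP.applyUpTo⁺₁ _ (suc t ℕ.+ r) (λ {i} i<c → block₅<N i i<c)))))

  length-labels : length labels ≡ 7 ℕ.* t ℕ.+ 3 ℕ.+ r
  length-labels = begin
    length labels   ≡⟨ ListP.length-++ B₁ ⟩
    length B₁ ℕ.+ _ ≡⟨ cong₂ ℕ._+_ (len 0 1 (suc t)) (trans (ListP.length-++ B₂) (cong₂ ℕ._+_ (len (2 ℕ.* t) t (3 ℕ.* t))
      (trans (ListP.length-++ B₃) (cong₂ ℕ._+_ (len base₃ (suc t) t) (trans (ListP.length-++ B₄)
        (cong₂ ℕ._+_ (len base₄ 1 (suc t)) (len base₅ 1 (suc t ℕ.+ r)))))))) ⟩
    suc t ℕ.+ (3 ℕ.* t ℕ.+ (t ℕ.+ (suc t ℕ.+ (suc t ℕ.+ r)))) ≡⟨ ident t r ⟩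
    7 ℕ.* t ℕ.+ 3 ℕ.+ r ∎
    where
    open ≡-Reasoning
    len : ∀ a d c → length (block a d c) ≡ c
    len a d c = ListP.length-applyUpTo (λ i → a ℕ.+ i ℕ.* d) c
    ident : ∀ t r → (1 ℕ.+ t) ℕ.+ (3 ℕ.* t ℕ.+ (t ℕ.+ ((1 ℕ.+ t) ℕ.+ ((1 ℕ.+ t) ℕ.+ r)))) ≡ 7 ℕ.* t ℕ.+ 3 ℕ.+ r
    ident = ℕSolver.solve-∀

  ∈B₁ : ∀ {i} → i ℕ.≤ t → i ∈ labels
  ∈B₁ {i} i≤t = ∈-++⁺ˡ (subst (_∈ B₁) (ℕP.*-identityʳ i) (∈-applyUpTo⁺ (λ i → 0 ℕ.+ i ℕ.* 1) (ℕ.s≤s i≤t)))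

  ∈B₂ : ∀ {i} → i ℕ.< 3 ℕ.* t → 2 ℕ.* t ℕ.+ i ℕ.* t ∈ labels
  ∈B₂ i< = ∈-++⁺ʳ B₁ (∈-++⁺ˡ (∈-applyUpTo⁺ (λ i → 2 ℕ.* t ℕ.+ i ℕ.* t) i<))

  ∈B₃ : ∀ {i} → i ℕ.< t → base₃ ℕ.+ i ℕ.* suc t ∈ labels
  ∈B₃ i< = ∈-++⁺ʳ B₁ (∈-++⁺ʳ B₂ (∈-++⁺ˡ (∈-applyUpTo⁺ (λ i → base₃ ℕ.+ i ℕ.* suc t) i<)))

  ∈B₄ : ∀ {i} → i ℕ.≤ t → base₄ ℕ.+ i ∈ labels
  ∈B₄ {i} i≤t = ∈-++⁺ʳ B₁ (∈-++⁺ʳ B₂ (∈-++⁺ʳ B₃ (∈-++⁺ˡ (subst (λ x → base₄ ℕ.+ x ∈ B₄) (ℕP.*-identityʳ i)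
    (∈-applyUpTo⁺ (λ i → base₄ ℕ.+ i ℕ.* 1) (ℕ.s≤s i≤t))))))

  ∈B₅ : ∀ {i} → i ℕ.≤ t → base₅ ℕ.+ i ∈ labels
  ∈B₅ {i} i≤t = ∈-++⁺ʳ B₁ (∈-++⁺ʳ B₂ (∈-++⁺ʳ B₃ (∈-++⁺ʳ B₄ (subst (λ x → base₅ ℕ.+ x ∈ B₅) (ℕP.*-identityʳ i)
    (∈-applyUpTo⁺ (λ i → base₅ ℕ.+ i ℕ.* 1) (ℕ.s≤s (ℕP.≤-trans i≤t (ℕP.m≤m+n t r))))))))

  Covered : ℕ → Set
  Covered y = ∃₂ λ a b → a ∈ labels × b ∈ labels × a ≢ b × a ℕ.+ b ≡ y

  -- An edge needs two different ends. The run lies entirely below `B₂` when h = 0, and otherwise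
  -- entirely above `B₃`.
  run-≢ : ∀ {h i b} → h ≡ 0 ⊎ end₃ ℕ.≤ h → i ℕ.≤ t → 2 ℕ.* t ℕ.≤ b → b ℕ.< end₃ → h ℕ.+ i ≢ b
  run-≢ {i = i} (inj₁ refl) i≤t lo _ =
    ℕP.<⇒≢ (ℕP.<-≤-trans (subst (ℕ._< 2 ℕ.* t) (ℕP.*-identityʳ i) (step₁ i (ℕ.s≤s i≤t))) lo)
  run-≢ {h} {i} (inj₂ end₃≤h) _ _ hi eq =
    ℕP.<⇒≢ (ℕP.<-≤-trans hi (ℕP.≤-trans end₃≤h (ℕP.m≤m+n h i))) (sym eq)

  -- A run h, …, h + t fills the gaps of B₂ and then those of B₃.
  run-cover : ∀ h → (∀ i → i ℕ.≤ t → h ℕ.+ i ∈ labels) → h ≡ 0 ⊎ end₃ ℕ.≤ h →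
    ∀ e → 2 ℕ.* t ℕ.≤ e → e ℕ.< end₃ → Covered (h ℕ.+ e)
  run-cover h run away e 2t≤e e<end₃ with e ℕP.<? base₃
  ... | yes e<base₃ = h ℕ.+ i , b , run i (ℕP.<⇒≤ i<t) , ∈B₂ k<3t , run-≢ away (ℕP.<⇒≤ i<t) (ℕP.m≤m+n _ _) (ℕP.<-≤-trans (step₂ k k<3t) base₃≤) ,
          trans (ident h i (2 ℕ.* t) (k ℕ.* t)) (cong (h ℕ.+_) (trans (cong (2 ℕ.* t ℕ.+_) (sym (ℕD.m≡m%n+[m/n]*n e′ t))) (ℕP.m+[n∸m]≡n 2t≤e)))
    where
    e′ = e ℕ.∸ 2 ℕ.* t
    k = e′ ℕ./ t
    i = e′ ℕ.% t
    i<t : i ℕ.< t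
    i<t = ℕD.m%n<n e′ t
    b = 2 ℕ.* t ℕ.+ k ℕ.* t
    base₃≤ : base₃ ℕ.≤ end₃
    base₃≤ = quadratic-≤ 3 1 2 1
    k<3t : k ℕ.< 3 ℕ.* t
    k<3t = ℕD.m<n*o⇒m/o<n (ℕP.+-cancelˡ-< (2 ℕ.* t) e′ (3 ℕ.* t ℕ.* t) (subst₂ ℕ._<_ (sym (ℕP.m+[n∸m]≡n 2t≤e)) (id₁ t) e<base₃))
      where
      id₁ : ∀ t → 3 ℕ.* (t ℕ.* t) ℕ.+ 2 ℕ.* t ≡ 2 ℕ.* t ℕ.+ 3 ℕ.* t ℕ.* t
      id₁ = ℕSolver.solve-∀
    ident : ∀ h i a b → h ℕ.+ i ℕ.+ (a ℕ.+ b) ≡ h ℕ.+ (a ℕ.+ (i ℕ.+ b))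
    ident = ℕSolver.solve-∀
  ... | no e≮base₃ = h ℕ.+ i , b , run i i≤t , ∈B₃ k<t ,
          run-≢ away i≤t (ℕP.≤-trans (ℕP.m≤n+m (2 ℕ.* t) (3 ℕ.* (t ℕ.* t))) (ℕP.m≤m+n base₃ _)) (step₃′ k k<t) ,
          trans (ident h i base₃ (k ℕ.* suc t)) (cong (h ℕ.+_) (trans (cong (base₃ ℕ.+_) (sym (ℕD.m≡m%n+[m/n]*n e′ (suc t)))) (ℕP.m+[n∸m]≡n base₃≤e)))
    where
    base₃≤e : base₃ ℕ.≤ e
    base₃≤e = ℕP.≮⇒≥ e≮base₃
    e′ = e ℕ.∸ base₃
    k = e′ ℕ./ suc t
    i = e′ ℕ.% suc t
    i≤t : i ℕ.≤ t
    i≤t = ℕP.≤-pred (ℕD.m%n<n e′ (suc t))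
    b = base₃ ℕ.+ k ℕ.* suc t
    k<t : k ℕ.< t
    k<t = ℕD.m<n*o⇒m/o<n (ℕP.+-cancelˡ-< base₃ e′ (t ℕ.* suc t) (subst₂ ℕ._<_ (sym (ℕP.m+[n∸m]≡n base₃≤e)) (id₁ t) e<end₃))
      where
      id₁ : ∀ t → 4 ℕ.* (t ℕ.* t) ℕ.+ 3 ℕ.* t ≡ 3 ℕ.* (t ℕ.* t) ℕ.+ 2 ℕ.* t ℕ.+ t ℕ.* (1 ℕ.+ t)
      id₁ = ℕSolver.solve-∀
    ident : ∀ h i a b → h ℕ.+ i ℕ.+ (a ℕ.+ b) ≡ h ℕ.+ (a ℕ.+ (i ℕ.+ b))
    ident = ℕSolver.solve-∀

  two-runs : ∀ h → (∀ i → i ℕ.≤ t → h ℕ.+ i ∈ labels) → 2 ℕ.* t ℕ.≤ h → ∀ e → e ℕ.< 2 ℕ.* t → Covered (h ℕ.+ e)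
  two-runs h run 2t≤h e e<2t with e ℕP.≤? t
  ... | yes e≤t = 0 , h ℕ.+ e , ∈B₁ ℕ.z≤n , run e e≤t ,
          ℕP.<⇒≢ (ℕP.<-≤-trans 0<t (ℕP.≤-trans (ℕP.m≤m+n t (t ℕ.+ 0)) (ℕP.≤-trans 2t≤h (ℕP.m≤m+n h e)))) , refl
  ... | no e≰t = e ℕ.∸ t , h ℕ.+ t , ∈B₁ e∸t≤t , run t ℕP.≤-refl ,
          ℕP.<⇒≢ (ℕP.≤-<-trans e∸t≤t (ℕP.≤-<-trans (ℕP.≤-trans (ℕP.m≤m+n t (t ℕ.+ 0)) 2t≤h) (ℕP.m<m+n h 0<t))) ,
          trans (swap₃ (e ℕ.∸ t) h t) (cong (h ℕ.+_) (ℕP.m+[n∸m]≡n (ℕP.<⇒≤ (ℕP.≰⇒> e≰t))))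
    where
    e∸t≤t : e ℕ.∸ t ℕ.≤ t
    e∸t≤t = subst (e ℕ.∸ t ℕ.≤_) (trans (ℕP.m+n∸m≡n t (t ℕ.+ 0)) (ℕP.+-identityʳ t)) (ℕP.∸-monoˡ-≤ t (ℕP.<⇒≤ e<2t))
    swap₃ : ∀ a h t → a ℕ.+ (h ℕ.+ t) ≡ h ℕ.+ (t ℕ.+ a)
    swap₃ = ℕSolver.solve-∀

  -- base₃ + c t + i is the sum of (c − i) t and base₃ + i (t + 1).
  B₂+B₃ : ∀ y → end₃ ℕ.≤ y → y ℕ.< base₄ → Covered y
  B₂+B₃ y end₃≤y y<base₄ = 2 ℕ.* t ℕ.+ k ℕ.* t , base₃ ℕ.+ i ℕ.* suc t , ∈B₂ k<3t , ∈B₃ i<t ,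
      ℕP.<⇒≢ (ℕP.<-≤-trans (step₂ k k<3t) (ℕP.m≤m+n base₃ _)) , sum≡
    where
    base₃≤y : base₃ ℕ.≤ y
    base₃≤y = ℕP.≤-trans (quadratic-≤ 3 1 2 1) end₃≤y
    e = y ℕ.∸ base₃
    base₃+e : base₃ ℕ.+ e ≡ y
    base₃+e = ℕP.m+[n∸m]≡n base₃≤y
    c = e ℕ./ t
    i = e ℕ.% t
    i<t : i ℕ.< t
    i<t = ℕD.m%n<n e t
    t<c : suc t ℕ.≤ c
    t<c = subst (ℕ._≤ c) (ℕD.m*n/n≡m (suc t) t) (ℕD./-monoˡ-≤ t
      (ℕP.+-cancelˡ-≤ base₃ (suc t ℕ.* t) e (subst₂ ℕ._≤_ (id₁ t) (sym base₃+e) end₃≤y)))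
      where
      id₁ : ∀ t → 4 ℕ.* (t ℕ.* t) ℕ.+ 3 ℕ.* t ≡ 3 ℕ.* (t ℕ.* t) ℕ.+ 2 ℕ.* t ℕ.+ (1 ℕ.+ t) ℕ.* t
      id₁ = ℕSolver.solve-∀
    c<3t+2 : c ℕ.< 2 ℕ.+ 3 ℕ.* t
    c<3t+2 = ℕD.m<n*o⇒m/o<n (ℕP.+-cancelˡ-< base₃ e ((2 ℕ.+ 3 ℕ.* t) ℕ.* t) (subst₂ ℕ._<_ (sym base₃+e) (id₁ t) y<base₄))
      where
      id₁ : ∀ t → 6 ℕ.* (t ℕ.* t) ℕ.+ 4 ℕ.* t ≡ 3 ℕ.* (t ℕ.* t) ℕ.+ 2 ℕ.* t ℕ.+ (2 ℕ.+ 3 ℕ.* t) ℕ.* t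
      id₁ = ℕSolver.solve-∀
    2+i≤c : 2 ℕ.+ i ℕ.≤ c
    2+i≤c = ℕP.≤-trans (ℕ.s≤s i<t) t<c
    -- `B₂` starts at 2t, so (c - i) t has index c - i - 2 in it. The range of y puts c between t +
    -- 1 and 3t + 1, which keeps this index in range.
    k = c ℕ.∸ (2 ℕ.+ i)
    k+ : 2 ℕ.+ i ℕ.+ k ≡ c
    k+ = ℕP.m+[n∸m]≡n 2+i≤c
    k<3t : k ℕ.< 3 ℕ.* t
    k<3t = ℕP.+-cancelˡ-< 2 k (3 ℕ.* t) (ℕP.≤-<-trans (subst (2 ℕ.+ k ℕ.≤_) (trans (id₂ k i) k+) (ℕP.m≤m+n (2 ℕ.+ k) i)) c<3t+2)
      where
      id₂ : ∀ k i → 2 ℕ.+ k ℕ.+ i ≡ 2 ℕ.+ i ℕ.+ k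
      id₂ = ℕSolver.solve-∀
    sum≡ : 2 ℕ.* t ℕ.+ k ℕ.* t ℕ.+ (base₃ ℕ.+ i ℕ.* suc t) ≡ y
    sum≡ = begin
      2 ℕ.* t ℕ.+ k ℕ.* t ℕ.+ (base₃ ℕ.+ i ℕ.* suc t)   ≡⟨ id₃ t k base₃ i ⟩
      base₃ ℕ.+ (i ℕ.+ (2 ℕ.+ i ℕ.+ k) ℕ.* t)  ≡⟨ cong (λ x → base₃ ℕ.+ (i ℕ.+ x ℕ.* t)) k+ ⟩
      base₃ ℕ.+ (i ℕ.+ c ℕ.* t)  ≡⟨ cong (base₃ ℕ.+_) (ℕD.m≡m%n+[m/n]*n e t) ⟨
      base₃ ℕ.+ e                                       ≡⟨ base₃+e ⟩
      y                                                 ∎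
      where
      open ≡-Reasoning
      id₃ : ∀ t k b i → 2 ℕ.* t ℕ.+ k ℕ.* t ℕ.+ (b ℕ.+ i ℕ.* (1 ℕ.+ t)) ≡ b ℕ.+ (i ℕ.+ (2 ℕ.+ i ℕ.+ k) ℕ.* t)
      id₃ = ℕSolver.solve-∀

  run-from : ∀ h → (∀ i → i ℕ.≤ t → h ℕ.+ i ∈ labels) → end₃ ℕ.≤ h → ∀ y → h ℕ.≤ y → y ℕ.< h ℕ.+ end₃ → Covered y
  run-from h run end₃≤h y h≤y y< = subst Covered h+e (case (e ℕP.<? 2 ℕ.* t))
    where
    e = y ℕ.∸ h
    h+e : h ℕ.+ e ≡ y
    h+e = ℕP.m+[n∸m]≡n h≤y
    case : Dec (e ℕ.< 2 ℕ.* t) → Covered (h ℕ.+ e)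
    case (yes e<2t) = two-runs h run (ℕP.≤-trans (ℕP.≤-trans (ℕP.*-monoˡ-≤ t (ℕP.m≤m+n 2 1)) (ℕP.m≤n+m (3 ℕ.* t) (4 ℕ.* (t ℕ.* t)))) end₃≤h) e e<2t
    case (no e≮2t) = run-cover h run (inj₂ end₃≤h) e (ℕP.≮⇒≥ e≮2t) (ℕP.+-cancelˡ-< h e end₃ (subst (ℕ._< h ℕ.+ end₃) (sym h+e) y<))

  -- The intervals abut: base₅ = base₄ + end₃, and base₅ + end₃ = S + 1.
  sums : ∀ y → 2 ℕ.* t ℕ.≤ y → y ℕ.< base₅ ℕ.+ end₃ → Covered y
  sums y 2t≤y y< with y ℕP.<? end₃ | y ℕP.<? base₄ | y ℕP.<? base₅
  ... | yes y<end₃ | _ | _ = run-cover 0 (λ i → ∈B₁) (inj₁ refl) y 2t≤y y<end₃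
  ... | no y≮end₃ | yes y<base₄ | _ = B₂+B₃ y (ℕP.≮⇒≥ y≮end₃) y<base₄
  ... | no _ | no y≮base₄ | yes y<base₅ = run-from base₄ (λ i → ∈B₄) end₃≤base₄ y (ℕP.≮⇒≥ y≮base₄) (subst (y ℕ.<_) (ident t) y<base₅)
    where
    ident : ∀ t → 10 ℕ.* (t ℕ.* t) ℕ.+ 7 ℕ.* t ≡ 6 ℕ.* (t ℕ.* t) ℕ.+ 4 ℕ.* t ℕ.+ (4 ℕ.* (t ℕ.* t) ℕ.+ 3 ℕ.* t)
    ident = ℕSolver.solve-∀
  ... | no _ | no _ | no y≮base₅ = run-from base₅ (λ i → ∈B₅)
          (quadratic-≤ 4 6 3 4) y (ℕP.≮⇒≥ y≮base₅) y<

  suc-S : suc S ≡ N ℕ.+ 2 ℕ.* t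
  suc-S = trans (ℕP.suc-pred (14 ℕ.* (t ℕ.* t) ℕ.+ 10 ℕ.* t) {{ℕ.>-nonZero (ℕP.<-≤-trans 0<t (ℕP.≤-trans (ℕP.m≤n*m t 10) (ℕP.m≤n+m (10 ℕ.* t) (14 ℕ.* (t ℕ.* t)))))}}) (ident t)
    where
    ident : ∀ t → 14 ℕ.* (t ℕ.* t) ℕ.+ 10 ℕ.* t ≡ 14 ℕ.* (t ℕ.* t) ℕ.+ 8 ℕ.* t ℕ.+ 2 ℕ.* t
    ident = ℕSolver.solve-∀

  cover : ∀ x → x ℕ.< N → x ∉ labels → ∃₂ λ a b → a ∈ labels × b ∈ labels × a ≢ b × a ℕ.+ b ℕ.+ x ≡ S
  cover x x<N _ = let a , b , a∈ , b∈ , a≢b , eq = sums (S ℕ.∸ x) 2t≤ S∸x< in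
    a , b , a∈ , b∈ , a≢b , trans (cong (ℕ._+ x) eq) (ℕP.m∸n+n≡m x≤S)
    where
    2t+x<suc-S : 2 ℕ.* t ℕ.+ x ℕ.< suc S
    2t+x<suc-S = subst (2 ℕ.* t ℕ.+ x ℕ.<_) (trans (ℕP.+-comm (2 ℕ.* t) N) (sym suc-S)) (ℕP.+-monoʳ-< (2 ℕ.* t) x<N)
    x≤S : x ℕ.≤ S
    x≤S = ℕP.≤-trans (ℕP.m≤n+m x (2 ℕ.* t)) (ℕP.≤-pred 2t+x<suc-S)
    2t≤ : 2 ℕ.* t ℕ.≤ S ℕ.∸ x
    2t≤ = ℕP.m+n≤o⇒m≤o∸n (2 ℕ.* t) (ℕP.≤-pred 2t+x<suc-S)
    ident : ∀ t → 14 ℕ.* (t ℕ.* t) ℕ.+ 8 ℕ.* t ℕ.+ 2 ℕ.* t ≡ 10 ℕ.* (t ℕ.* t) ℕ.+ 7 ℕ.* t ℕ.+ (4 ℕ.* (t ℕ.* t) ℕ.+ 3 ℕ.* t)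
    ident = ℕSolver.solve-∀
    S∸x< : S ℕ.∸ x ℕ.< base₅ ℕ.+ end₃
    S∸x< = ℕP.≤-<-trans (ℕP.m∸n≤m S x) (subst (S ℕ.<_) (trans suc-S (ident t)) (ℕP.n<1+n S))

  open FromSums labels labels-unique N S labels<N cover public using (graph; edgeMagic; size)

-- Dense edge-magic graphs of every order

emptyGraph : ∀ n → Graph n
emptyGraph n = record { edges = [] ; ordered = [] ; unique = [] }

emptyGraph-edgeMagic : ∀ n → EdgeMagic (emptyGraph n)
emptyGraph-edgeMagic n = record
  { l = λ i → i
  ; bijective = (λ eq → eq) , (λ y → y , λ eq → eq)
  ; s = 0
  ; magic = λ ()
  }

EdgeMagicOfSize : ℕ → ℕ → Set
EdgeMagicOfSize N n = ∃ λ (G : Graph n) → EdgeMagic G × n ℕ.+ numEdges G ≡ N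

mrose : ∀ t r → 2 ℕ.≤ t → r ℕ.≤ 6 →
  EdgeMagicOfSize (14 ℕ.* (t ℕ.* t) ℕ.+ 8 ℕ.* t) (7 ℕ.* t ℕ.+ 3 ℕ.+ r)
mrose t r 2≤t r≤6 = subst (EdgeMagicOfSize N) length-labels (graph , edgeMagic , size)
  where
  instance t≢0 = ℕ.>-nonZero (ℕP.≤-trans (ℕ.s≤s ℕ.z≤n) 2≤t)
  open Mrose t r 2≤t r≤6

-- A generous constant: with n = 7t + 3 + r, the number (2/7)n² - m has t-coefficient 11 + 4r ≤ 35
-- and no quadratic term, against 70t in 10n.
10ℚ : ℚ
10ℚ = + 10 / 1

mrose-dense : ∀ t r {n m} → r ℕ.≤ 6 → 7 ℕ.* t ℕ.+ 3 ℕ.+ r ≡ n → n ℕ.+ m ≡ 14 ℕ.* (t ℕ.* t) ℕ.+ 8 ℕ.* t →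
  (+ 2 / 7) * ι n * ι n - 10ℚ * ι n ≤ ι m
mrose-dense t r {n} {m} r≤6 n≡ m≡ = ≤-by
  (T * ((+ 35 / 1) + 4ℚ * ((+ 6 / 1) - R)) + ((+ 3 / 1) + R) * ((+ 45 / 7) + (+ 2 / 7) * ((+ 6 / 1) - R)))
  (≡-by₂ 1ℚ ((+ 9 / 1) - (+ 2 / 7) * (ι n + ((+ 7 / 1) * T + (+ 3 / 1) + R))) (ident (ι n) (ι m) T R) ιm≡ ιn≡)
  (+-nonNeg (*-nonNeg (ι-nonNeg t) (+-nonNeg (nonNegative⁻¹ (+ 35 / 1)) (*-nonNeg 0≤4 0≤6-R)))
    (*-nonNeg (+-nonNeg (nonNegative⁻¹ (+ 3 / 1)) (ι-nonNeg r))
      (+-nonNeg (nonNegative⁻¹ (+ 45 / 7)) (*-nonNeg (nonNegative⁻¹ (+ 2 / 7)) 0≤6-R))))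
  where
  T = ι t
  R = ι r
  0≤6-R : 0ℚ ≤ (+ 6 / 1) - R
  0≤6-R = ≤⇒0≤- (subst (R ≤_) (ι≡ℕtoℚ 6) (ι-mono r≤6))
  ιn≡ : ι n ≡ (+ 7 / 1) * T + (+ 3 / 1) + R
  ιn≡ = trans (cong ι (sym n≡)) (trans (ι-+ (7 ℕ.* t ℕ.+ 3) r) (cong (_+ R)
    (trans (ι-+ (7 ℕ.* t) 3) (cong₂ _+_ (trans (ι-* 7 t) (cong (_* T) (ι≡ℕtoℚ 7))) (ι≡ℕtoℚ 3)))))
  ιm≡ : ι n + ι m ≡ (+ 14 / 1) * (T * T) + (+ 8 / 1) * T
  ιm≡ = trans (sym (ι-+ n m)) (trans (cong ι m≡) (trans (ι-+ (14 ℕ.* (t ℕ.* t)) (8 ℕ.* t))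
    (cong₂ _+_ (trans (ι-* 14 (t ℕ.* t)) (cong₂ _*_ (ι≡ℕtoℚ 14) (ι-* t t))) (trans (ι-* 8 t) (cong (_* T) (ι≡ℕtoℚ 8))))))
  ident : ∀ n m T R → m ≡ (+ 2 / 7) * n * n - (+ 10 / 1) * n
    + (T * ((+ 35 / 1) + 4ℚ * ((+ 6 / 1) - R)) + ((+ 3 / 1) + R) * ((+ 45 / 7) + (+ 2 / 7) * ((+ 6 / 1) - R)))
    + 1ℚ * (n + m - ((+ 14 / 1) * (T * T) + (+ 8 / 1) * T))
    + ((+ 9 / 1) - (+ 2 / 7) * (n + ((+ 7 / 1) * T + (+ 3 / 1) + R))) * (n - ((+ 7 / 1) * T + (+ 3 / 1) + R))
  ident = solve-∀ ℚ-ring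

empty-dense : ∀ {n} → n ℕ.≤ 35 → (+ 2 / 7) * ι n * ι n - 10ℚ * ι n ≤ 0ℚ
empty-dense {n} n≤35 = ≤-by ((+ 2 / 7) * (ι n * ((+ 35 / 1) - ι n))) (ident (ι n))
  (*-nonNeg (nonNegative⁻¹ (+ 2 / 7)) (*-nonNeg (ι-nonNeg n) (≤⇒0≤- (subst (ι n ≤_) (ι≡ℕtoℚ 35) (ι-mono n≤35)))))
  where
  ident : ∀ n → 0ℚ ≡ (+ 2 / 7) * n * n - (+ 10 / 1) * n + (+ 2 / 7) * (n * ((+ 35 / 1) - n))
  ident = solve-∀ ℚ-ring

DenseEdgeMagic : ℕ → Set
DenseEdgeMagic n = ∃ λ (G : Graph n) → EdgeMagic G × (+ 2 / 7) * ι n * ι n - 10ℚ * ι n ≤ ι (numEdges G)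

denseEdgeMagic : ∀ n → DenseEdgeMagic n
-- 17 = 7·2 + 3 is the least order with t ≥ 2. Below it the bound is at most 0, as for every n ≤ 35,
-- and the empty graph serves.
denseEdgeMagic n with 17 ℕP.≤? n
... | no n<17 = emptyGraph n , emptyGraph-edgeMagic n ,
  subst ((+ 2 / 7) * ι n * ι n - 10ℚ * ι n ≤_) (sym ι-0) (empty-dense (ℕP.≤-trans (ℕP.<⇒≤ (ℕP.≰⇒> n<17)) (ℕP.m≤m+n 17 18)))
... | yes 17≤n = let G , L , size = subst (EdgeMagicOfSize _) n≡ (mrose t r 2≤t r≤6) in
  G , L , mrose-dense t r r≤6 n≡ size
  where
  t r : ℕ
  t = (n ℕ.∸ 3) ℕ./ 7
  r = (n ℕ.∸ 3) ℕ.% 7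
  2≤t : 2 ℕ.≤ t
  2≤t = ℕD./-monoˡ-≤ 7 (ℕP.∸-monoˡ-≤ 3 17≤n)
  r≤6 : r ℕ.≤ 6
  r≤6 = ℕP.≤-pred (ℕD.m%n<n (n ℕ.∸ 3) 7)
  n≡ : 7 ℕ.* t ℕ.+ 3 ℕ.+ r ≡ n
  n≡ = trans (ident t r) (trans (cong (3 ℕ.+_) (sym (ℕD.m≡m%n+[m/n]*n (n ℕ.∸ 3) 7)))
    (ℕP.m+[n∸m]≡n (ℕP.≤-trans (ℕP.m≤m+n 3 14) 17≤n)))
    where
    ident : ∀ t r → 7 ℕ.* t ℕ.+ 3 ℕ.+ r ≡ 3 ℕ.+ (r ℕ.+ t ℕ.* 7)
    ident = ℕSolver.solve-∀

lower-bound : ∃ λ (C : ℚ) → 0ℚ < C × (∀ (n : ℕ) → 1 ℕ.≤ n →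
  ∃ λ (G : Graph n) → EdgeMagic G × ((+ 2 / 7) * ℕtoℚ n * ℕtoℚ n - C * ℕtoℚ n ≤ ℕtoℚ (numEdges G)))
lower-bound = 10ℚ , positive⁻¹ 10ℚ , λ n _ → let G , L , le = denseEdgeMagic n in
  G , L , subst₂ (λ x y → (+ 2 / 7) * x * x - 10ℚ * x ≤ y) (ι≡ℕtoℚ n) (ι≡ℕtoℚ (numEdges G)) le

theorem1 : (∃ λ (C : ℚ) → 0ℚ < C × (∀ (n : ℕ) → 1 ℕ.≤ n →
    ∃ λ (G : Graph n) → EdgeMagic G ×
    ((+ 2 / 7) * ℕtoℚ n * ℕtoℚ n - C * ℕtoℚ n ≤ ℕtoℚ (numEdges G))))
    × (∀ (q : ℚ) → ConstBelow q → ∃ λ (N : ℕ) → ∀ (n : ℕ) → N ℕ.≤ n →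
    ∀ (G : Graph n) → EdgeMagic G → ℕtoℚ (numEdges G) ≤ q * ℕtoℚ n * ℕtoℚ n)
theorem1 = lower-bound , upper-bound
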